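{- Let $G$ be a $4$-regular graph on $n$ vertices, and let $s=\lceil (n+4)/5\rceil$. Then $\operatorname{tvs}(G)=s$. Moreover, $G$ has a vertex irregular total $s$-labeling whose set of vertex weights is exactly $\{5,6,\ldots,n+4\}$.
   Context: All graphs are finite and simple, and need not be connected. For a positive integer $k$, a total $k$-labeling of a graph $G$ is a mapping $\lambda:V(G)\cup E(G)\to\{1,\ldots,k\}$. The weight of a vertex $v$ under $\lambda$ is $\operatorname{wt}_\lambda(v)=\lambda(v)+\sum_{e\ni v}\lambda(e)$, the sum being over the edges $e$ of $G$ incident with $v$. The labeling $\lambda$ is vertex irregular if $\operatorname{wt}_\lambda(u)\ne\operatorname{wt}_\lambda(v)$ for any two distinct vertices $u,v\in V(G)$. The total vertex irregularity strength $\operatorname{tvs}(G)$ is the smallest positive integer $k$ for which $G$ has a vertex irregular total $k$-labeling. -}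

module Defs where

open import Data.Nat using (ℕ; _+_; _≤_)
open import Data.Fin using (Fin)
open import Data.Fin.Subset using (Subset; ∣_∣)
open import Data.Fin.Subset.Properties using (_∈?_)
open import Data.List using (List; length; map; sum; filter; allFin)
open import Data.Product using (Σ-syntax; _×_)
open import Data.Sum using (_⊎_; inj₁; inj₂)
open import Function.Definitions using (Injective)
open import Relation.Binary.PropositionalEquality using (_≡_; _≢_)

-- A finite simple graph with vertex set Fin n.  Its edge set is a set of
-- two-element subsets of Fin n, listed without repetition by Fin size.
record Graph (n : ℕ) : Set where
  field
    size          : ℕ
    edge          : Fin size → Subset n
    twoElement    : ∀ e → ∣ edge e ∣ ≡ 2
    edgeInjective : Injective _≡_ _≡_ edge

  incidentEdges : Fin n → List (Fin size)
  incidentEdges v = filter (λ e → v ∈? edge e) (allFin size)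

  degree : Fin n → ℕ
  degree v = length (incidentEdges v)

Regular : ∀ {n} → ℕ → Graph n → Set
Regular {n} r G = (v : Fin n) → Graph.degree G v ≡ r

record TotalLabeling {n : ℕ} (G : Graph n) (k : ℕ) : Set where
  open Graph G
  field
    label   : Fin n ⊎ Fin size → ℕ
    1≤label : ∀ x → 1 ≤ label x
    label≤k : ∀ x → label x ≤ k

  weight : Fin n → ℕ
  weight v = label (inj₁ v) + sum (map (λ e → label (inj₂ e)) (incidentEdges v))

VertexIrregular : ∀ {n} {G : Graph n} {k} → TotalLabeling G k → Set
VertexIrregular {n} L = (u v : Fin n) → u ≢ v → weight u ≢ weight v
  where open TotalLabeling L

HasVertexIrregularLabeling : ∀ {n} → Graph n → ℕ → Set
HasVertexIrregularLabeling G k = Σ[ L ∈ TotalLabeling G k ] VertexIrregular L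

-- TVS G k reads "tvs(G) = k".  It is a relation, so that the definition does
-- not presuppose that a smallest k exists; there is at most one such k.
TVS : ∀ {n} → Graph n → ℕ → Set
TVS G k = 1 ≤ k
        × HasVertexIrregularLabeling G k
        × (∀ j → 1 ≤ j → HasVertexIrregularLabeling G j → k ≤ j)

{-# OPTIONS --safe #-}
-- Let s = t + 1 and n + k = 5 t + 1 with 0 ≤ k ≤ 4.  Label the edges of some set H with
-- t + 1 and the other edges with 1, rank the vertices by their H-degree and give v the label
-- 1 + rank v − t · deg v.  Then v has weight 5 + rank v.  The labels are legal if, writing
-- M d for the number of vertices of H-degree at most d, every M d with d ≤ 3 lies between
-- (d + 1) t and (d + 1) t + 1 (or n, if that is smaller).
--
-- Such an H comes from a local search.  A vertex set A with about 2 t elements and a small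
-- cut, together with the edges outside A and a few of the cut edges, gives the correct M 1.
-- Next M 2, M 3 and M 0 are brought into place one after the other, each time by toggling at
-- most a few edges; M 3 at its lower end is the case of the complement, since M d and M (3 − d)
-- of complementary sets add up to n.  An edge whose ends have suitable degrees exists by double
-- counting: otherwise a weighted count of edge ends violates a linear inequality between the
-- M d.  These inequalities are checked by Fourier–Motzkin elimination.
--
-- Conversely the weights of a vertex irregular total j-labeling are n different numbers
-- between 5 and 5 j, so that n + 4 ≤ 5 j.
module Submission where

open import Defs
open import Data.Bool using (Bool; true; false; not; if_then_else_; T; _∧_; _∨_; _xor_) renaming (_≟_ to _≟ᵇ_)
open import Data.Bool.Properties using (T-∧; T-∨; T-≡; ∧-zeroʳ)
open import Data.Empty using (⊥; ⊥-elim)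
open import Data.Fin using (Fin; zero; suc; toℕ; fromℕ<; punchOut; #_; _≟_)
open import Data.Fin.Properties using
  (any?; injective⇒≤; punchOut-injective; toℕ<n; toℕ-injective; toℕ-fromℕ<; fromℕ<-injective)
open import Data.Fin.Subset using (Subset; ∣_∣)
open import Data.Fin.Subset.Properties using (_∈?_)
open import Data.Integer as ℤ using (ℤ; +_; -[1+_]; 0ℤ; 1ℤ)
import Data.Integer.DivMod as ℤD
import Data.Integer.Properties as ℤₚ
open import Data.Integer.Solver renaming (module +-*-Solver to ℤ-Solver)
open import Data.List as List using (List; []; _∷_; _++_; filter; tabulate; length)
open import Data.List.Relation.Unary.All as All using (All; []; _∷_)
open import Data.List.Relation.Unary.All.Properties using (++⁺)
open import Data.List.Relation.Unary.Any using (Any; here; there)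
open import Data.Nat hiding (_≟_; _/_)
open import Data.Nat.ListAction using () renaming (sum to List-sum)
open import Data.Nat.Properties renaming (_≟_ to _≟ⁿ_)
open import Algebra.Properties.Semiring.Sum +-*-semiring using
  (sum; sum-syntax; sum-cong-≗; ∑-distrib-+; ∑-comm; *-distribˡ-sum; *-distribʳ-sum)
open import Data.Nat.Solver renaming (module +-*-Solver to ℕ-Solver)
open import Data.Product using (_×_; _,_; proj₁; proj₂; ∃; Σ-syntax; ∃-syntax)
open import Data.Rational.Unnormalised using (_/_; ceiling)
open import Data.Sum as Sum using (_⊎_; inj₁; inj₂; [_,_]′)
open import Data.Vec as Vec using (Vec; []; _∷_; zipWith; lookup)
open import Data.Vec.Properties using (zipWith-assoc)
open import Function using (_∘_; id; Equivalence; _⇔_; mk⇔)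
open import Function.Definitions using (Injective)
open import Relation.Binary.Definitions using (tri<; tri≈; tri>)
open import Relation.Binary.PropositionalEquality hiding ([_])
open import Relation.Nullary using (Dec; yes; no; does; contradiction)
open import Relation.Nullary.Decidable using (_×-dec_; _⊎-dec_)
open import Relation.Unary using (Pred; Decidable)

-- A window leaves at most two values for a count, while toggling an edge whose ends have equal
-- degree moves one count by two. A move that improves one count can thus push another out of its
-- window. This forces the case distinctions on the end of the window at which a count stands, and
-- the compound moves: two additions at a common vertex (`Fan`), or an addition that is paid back by
-- a deletion elsewhere.
--
-- The weights in the double counts are indicators of two sets S and T of degrees. They are chosen
-- so that an edge of the relevant side that meets S and has no useful type joins S to T. Without
-- useful edges the total degree over S is then at most that over T, which contradicts the
-- inequalities at hand. The room is smallest when `t` is small and `k` is near 4; where the count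
-- alone does not suffice, the four distinct neighbours of a vertex decide.

χ : Bool → ℕ
χ true  = 1
χ false = 0

χ≤1 : ∀ b → χ b ≤ 1
χ≤1 true  = ≤-refl
χ≤1 false = z≤n

is : ∀ {n} → Fin n → Fin n → Bool
is u v = does (u ≟ v)

is-refl : ∀ {n} (u : Fin n) → is u u ≡ true
is-refl u with u ≟ u
... | yes _   = refl
... | no  u≢u = contradiction refl u≢u

is-≢ : ∀ {n} {u v : Fin n} → u ≢ v → is u v ≡ false
is-≢ {u = u} {v} u≢v with u ≟ v
... | yes u≡v = contradiction u≡v u≢v
... | no  _   = refl

-- Finite sums

∑-mono : ∀ {n} {f g : Fin n → ℕ} → (∀ i → f i ≤ g i) → sum f ≤ sum g
∑-mono {zero}  h = z≤n
∑-mono {suc n} h = +-mono-≤ (h zero) (∑-mono (h ∘ suc))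

∑-zero : ∀ n → ∑[ i < n ] 0 ≡ 0
∑-zero zero    = refl
∑-zero (suc n) = ∑-zero n

∑-one : ∀ n → ∑[ i < n ] 1 ≡ n
∑-one zero    = refl
∑-one (suc n) = cong suc (∑-one n)

∑-pick : ∀ {n} (u : Fin n) (g : Fin n → ℕ) → ∑[ v < n ] (χ (is u v) * g v) ≡ g u
∑-pick {suc n} zero    g =
  trans (cong₂ _+_ (+-identityʳ (g zero)) (∑-zero n)) (+-identityʳ (g zero))
∑-pick {suc n} (suc u) g = ∑-pick u (g ∘ suc)

∑-term : ∀ {n} (f : Fin n → ℕ) i → f i ≤ sum f
∑-term f zero    = m≤m+n _ _
∑-term f (suc i) = ≤-trans (∑-term (f ∘ suc) i) (m≤n+m _ _)

∑-two-terms : ∀ {n} (f : Fin n → ℕ) {i j} → i ≢ j → f i + f j ≤ sum f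
∑-two-terms f {zero}  {zero}  i≢j = contradiction refl i≢j
∑-two-terms f {zero}  {suc j} i≢j = +-monoʳ-≤ (f zero) (∑-term (f ∘ suc) j)
∑-two-terms f {suc i} {zero}  i≢j =
  subst (_≤ sum f) (+-comm (f zero) (f (suc i))) (+-monoʳ-≤ (f zero) (∑-term (f ∘ suc) i))
∑-two-terms f {suc i} {suc j} i≢j =
  ≤-trans (∑-two-terms (f ∘ suc) (i≢j ∘ cong suc)) (m≤n+m _ _)

∑-exists : ∀ {n} (f : Fin n → ℕ) → 1 ≤ sum f → ∃ λ i → 1 ≤ f i
∑-exists {suc n} f 1≤ with f zero in eq
... | suc _ = zero , subst (1 ≤_) (sym eq) (s≤s z≤n)
... | zero with i , h ← ∑-exists (f ∘ suc) 1≤ = suc i , h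

∑-exists-two : ∀ {n} (f : Fin n → ℕ) → (∀ i → f i ≤ 1) → 2 ≤ sum f →
               ∃ λ i → ∃ λ j → i ≢ j × 1 ≤ f i × 1 ≤ f j
∑-exists-two {suc n} f f≤1 2≤ with f zero in eq
... | zero with i , j , i≢j , hi , hj ← ∑-exists-two (f ∘ suc) (f≤1 ∘ suc) 2≤
  = suc i , suc j , (λ { refl → i≢j refl }) , hi , hj
... | suc zero with i , h ← ∑-exists (f ∘ suc) (s≤s⁻¹ 2≤)
  = zero , suc i , (λ ()) , subst (1 ≤_) (sym eq) (s≤s z≤n) , h
... | suc (suc _) = contradiction (subst (_≤ 1) eq (f≤1 zero)) λ { (s≤s ()) }

-- Edge sets and their degrees

-- The order of the two ends of an edge is arbitrary. `inc` counts ends, so every edge contributes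
-- two in total.
record Multigraph (n m : ℕ) : Set where
  field
    src tgt : Fin m → Fin n

  On : Fin n → Fin m → Set
  On v e = src e ≡ v ⊎ tgt e ≡ v

  inc : Fin m → Fin n → ℕ
  inc e v = χ (is (src e) v) + χ (is (tgt e) v)

record Simple4 (n m : ℕ) : Set where
  field
    multigraph : Multigraph n m
  open Multigraph multigraph public
  field
    loopless : ∀ e → src e ≢ tgt e
    simple   : ∀ {e e′ v w} → v ≢ w → On v e → On w e → On v e′ → On w e′ → e ≡ e′
    regular  : ∀ v → ∑[ e < m ] inc e v ≡ 4

module Graphs {n m : ℕ} (G : Simple4 n m) where
  open Simple4 G public

  inc-src : ∀ e → inc e (src e) ≡ 1
  inc-src e rewrite is-refl (src e) | is-≢ (loopless e ∘ sym) = refl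

  inc-tgt : ∀ e → inc e (tgt e) ≡ 1
  inc-tgt e rewrite is-refl (tgt e) | is-≢ (loopless e) = refl

  inc-on : ∀ {e v} → On v e → inc e v ≡ 1
  inc-on (inj₁ refl) = inc-src _
  inc-on (inj₂ refl) = inc-tgt _

  inc-off : ∀ {e v} → src e ≢ v → tgt e ≢ v → inc e v ≡ 0
  inc-off s≢v t≢v rewrite is-≢ s≢v | is-≢ t≢v = refl

  on? : ∀ v e → On v e ⊎ (src e ≢ v × tgt e ≢ v)
  on? v e with src e ≟ v | tgt e ≟ v
  ... | yes p | _     = inj₁ (inj₁ p)
  ... | no _  | yes q = inj₁ (inj₂ q)
  ... | no p  | no q  = inj₂ (p , q)

  inc≤1 : ∀ e v → inc e v ≤ 1
  inc≤1 e v with on? v e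
  ... | inj₁ on        = ≤-reflexive (inc-on on)
  ... | inj₂ (s≢ , t≢) = ≤-trans (≤-reflexive (inc-off s≢ t≢)) z≤n

  -- Exchange of summation: an edge contributes once at each of its ends. The weight may depend on
  -- both the edge and the end, so one identity serves degree sums, cuts and charging arguments.
  handshake : ∀ (f : Fin m → Fin n → ℕ) →
    ∑[ v < n ] ∑[ e < m ] (inc e v * f e v) ≡ ∑[ e < m ] (f e (src e) + f e (tgt e))
  handshake f = trans (∑-comm (λ v e → inc e v * f e v)) (sum-cong-≗ λ e → begin
    ∑[ v < n ] (inc e v * f e v)
      ≡⟨ sum-cong-≗ (λ v → *-distribʳ-+ (f e v) (χ (is (src e) v)) (χ (is (tgt e) v))) ⟩
    ∑[ v < n ] (χ (is (src e) v) * f e v + χ (is (tgt e) v) * f e v)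
      ≡⟨ ∑-distrib-+ (λ v → χ (is (src e) v) * f e v) (λ v → χ (is (tgt e) v) * f e v) ⟩
    ∑[ v < n ] (χ (is (src e) v) * f e v) + ∑[ v < n ] (χ (is (tgt e) v) * f e v)
      ≡⟨ cong₂ _+_ (∑-pick (src e) (f e)) (∑-pick (tgt e) (f e)) ⟩
    f e (src e) + f e (tgt e) ∎)
    where open ≡-Reasoning

  EdgeSet : Set
  EdgeSet = Fin m → Bool

  ∁ : EdgeSet → EdgeSet
  ∁ H e = not (H e)

  side : Bool → EdgeSet → EdgeSet
  side true  H = H
  side false H = ∁ H

  deg : EdgeSet → Fin n → ℕ
  deg H v = ∑[ e < m ] (inc e v * χ (H e))

  deg+codeg : ∀ H v → deg H v + deg (∁ H) v ≡ 4
  deg+codeg H v = begin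
    deg H v + deg (∁ H) v ≡⟨ ∑-distrib-+ (λ e → inc e v * χ (H e)) (λ e → inc e v * χ (not (H e))) ⟨
    ∑[ e < m ] (inc e v * χ (H e) + inc e v * χ (not (H e))) ≡⟨ sum-cong-≗ (λ e → pointwise (inc e v) (H e)) ⟩
    ∑[ e < m ] inc e v ≡⟨ regular v ⟩
    4 ∎
    where
    open ≡-Reasoning
    pointwise : ∀ i b → i * χ b + i * χ (not b) ≡ i
    pointwise i true  = trans (cong₂ _+_ (*-identityʳ i) (*-zeroʳ i)) (+-identityʳ i)
    pointwise i false = cong₂ _+_ (*-zeroʳ i) (*-identityʳ i)

  deg≤4 : ∀ H v → deg H v ≤ 4
  deg≤4 H v = subst (deg H v ≤_) (deg+codeg H v) (m≤m+n _ _)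

  -- An edge set and its complement divide the four edges at a vertex, so the degree on either side
  -- is a function of the `H`-degree alone.
  share : Bool → ℕ → ℕ
  share true  d = d
  share false d = 4 ∸ d

  deg-side : ∀ b H v → deg (side b H) v ≡ share b (deg H v)
  deg-side true  H v = refl
  deg-side false H v = trans (sym (m+n∸m≡n (deg H v) _)) (cong (_∸ deg H v) (deg+codeg H v))

  M : ℕ → EdgeSet → ℕ
  M d H = ∑[ v < n ] χ (deg H v ≤ᵇ d)

  -- Summation by parts: the vertices of degree d number M d - M (d - 1), with M 4 = n. The negative
  -- terms stand on the left because the identity is over the natural numbers.
  tally : ∀ H (g : ℕ → ℕ) →
    ∑[ v < n ] g (deg H v) + (g 1 * M 0 H + (g 2 * M 1 H + (g 3 * M 2 H + g 4 * M 3 H)))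
    ≡ g 0 * M 0 H + (g 1 * M 1 H + (g 2 * M 2 H + (g 3 * M 3 H + g 4 * n)))
  tally H g = begin
    ∑[ v < n ] g (deg H v) + (g 1 * M 0 H + (g 2 * M 1 H + (g 3 * M 2 H + g 4 * M 3 H)))
      ≡⟨ cong (λ z → ∑[ v < n ] g (deg H v) + z)
           (cong₂ _+_ (out 1 0) (cong₂ _+_ (out 2 1) (cong₂ _+_ (out 3 2) (out 4 3)))) ⟩
    _ ≡⟨ cong (λ z → ∑[ v < n ] g (deg H v) + z) (merge₄ (t 1 0) (t 2 1) (t 3 2) (t 4 3)) ⟩
    _ ≡⟨ ∑-distrib-+ (λ v → g (deg H v)) (λ v → t 1 0 v + (t 2 1 v + (t 3 2 v + t 4 3 v))) ⟨
    ∑[ v < n ] (g (deg H v) + (t 1 0 v + (t 2 1 v + (t 3 2 v + t 4 3 v))))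
      ≡⟨ sum-cong-≗ (λ v → pointwise (deg≤4 H v)) ⟩
    ∑[ v < n ] (t 0 0 v + (t 1 1 v + (t 2 2 v + (t 3 3 v + g 4 * 1))))
      ≡⟨ ∑-distrib-+ (t 0 0) (λ v → t 1 1 v + (t 2 2 v + (t 3 3 v + g 4 * 1))) ⟩
    _ ≡⟨ cong (λ z → sum (t 0 0) + z) (merge₄ (t 1 1) (t 2 2) (t 3 3) (λ _ → g 4 * 1)) ⟨
    _ ≡⟨ cong₂ _+_ (out 0 0) (cong₂ _+_ (out 1 1) (cong₂ _+_ (out 2 2) (cong₂ _+_ (out 3 3) total))) ⟨
    g 0 * M 0 H + (g 1 * M 1 H + (g 2 * M 2 H + (g 3 * M 3 H + g 4 * n))) ∎
    where
    open ≡-Reasoning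
    t : ℕ → ℕ → Fin n → ℕ
    t i d v = g i * χ (deg H v ≤ᵇ d)
    out : ∀ i d → g i * M d H ≡ sum (t i d)
    out i d = *-distribˡ-sum (g i) (λ v → χ (deg H v ≤ᵇ d))
    total : g 4 * n ≡ ∑[ v < n ] (g 4 * 1)
    total = trans (cong (λ z → g 4 * z) (sym (∑-one n))) (*-distribˡ-sum {n} (g 4) (λ _ → 1))
    merge₄ : ∀ (a b c d : Fin n → ℕ) →
      sum a + (sum b + (sum c + sum d)) ≡ ∑[ v < n ] (a v + (b v + (c v + d v)))
    merge₄ a b c d = sym (begin
      ∑[ v < n ] (a v + (b v + (c v + d v)))  ≡⟨ ∑-distrib-+ a (λ v → b v + (c v + d v)) ⟩
      sum a + ∑[ v < n ] (b v + (c v + d v))  ≡⟨ cong (λ z → sum a + z) (∑-distrib-+ b (λ v → c v + d v)) ⟩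
      sum a + (sum b + ∑[ v < n ] (c v + d v)) ≡⟨ cong (λ z → sum a + (sum b + z)) (∑-distrib-+ c d) ⟩
      sum a + (sum b + (sum c + sum d)) ∎)
    open ℕ-Solver
    pointwise : ∀ {d} → d ≤ 4 →
      g d + (g 1 * χ (d ≤ᵇ 0) + (g 2 * χ (d ≤ᵇ 1) + (g 3 * χ (d ≤ᵇ 2) + g 4 * χ (d ≤ᵇ 3))))
      ≡ g 0 * χ (d ≤ᵇ 0) + (g 1 * χ (d ≤ᵇ 1) + (g 2 * χ (d ≤ᵇ 2) + (g 3 * χ (d ≤ᵇ 3) + g 4 * 1)))
    pointwise {0} _ = solve 5 (λ a b c d e →
      a :+ (b :* con 1 :+ (c :* con 1 :+ (d :* con 1 :+ e :* con 1)))
      := a :* con 1 :+ (b :* con 1 :+ (c :* con 1 :+ (d :* con 1 :+ e :* con 1)))) refl (g 0) (g 1) (g 2) (g 3) (g 4)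
    pointwise {1} _ = solve 5 (λ a b c d e →
      b :+ (b :* con 0 :+ (c :* con 1 :+ (d :* con 1 :+ e :* con 1)))
      := a :* con 0 :+ (b :* con 1 :+ (c :* con 1 :+ (d :* con 1 :+ e :* con 1)))) refl (g 0) (g 1) (g 2) (g 3) (g 4)
    pointwise {2} _ = solve 5 (λ a b c d e →
      c :+ (b :* con 0 :+ (c :* con 0 :+ (d :* con 1 :+ e :* con 1)))
      := a :* con 0 :+ (b :* con 0 :+ (c :* con 1 :+ (d :* con 1 :+ e :* con 1)))) refl (g 0) (g 1) (g 2) (g 3) (g 4)
    pointwise {3} _ = solve 5 (λ a b c d e →
      d :+ (b :* con 0 :+ (c :* con 0 :+ (d :* con 0 :+ e :* con 1)))
      := a :* con 0 :+ (b :* con 0 :+ (c :* con 0 :+ (d :* con 1 :+ e :* con 1)))) refl (g 0) (g 1) (g 2) (g 3) (g 4)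
    pointwise {4} _ = solve 5 (λ a b c d e →
      e :+ (b :* con 0 :+ (c :* con 0 :+ (d :* con 0 :+ e :* con 0)))
      := a :* con 0 :+ (b :* con 0 :+ (c :* con 0 :+ (d :* con 0 :+ e :* con 1)))) refl (g 0) (g 1) (g 2) (g 3) (g 4)
    pointwise {suc (suc (suc (suc (suc _))))} (s≤s (s≤s (s≤s (s≤s ()))))

  -- Insertion and deletion are this one relation read in its two directions, so the effect on
  -- degrees and counts is computed once.
  record Adds (K : EdgeSet) (e : Fin m) (H : EdgeSet) : Set where
    field
      absent  : K e ≡ false
      present : H e ≡ true
      others  : ∀ {e′} → e ≢ e′ → H e′ ≡ K e′

  set : Fin m → Bool → EdgeSet → EdgeSet
  set e b H e′ = if is e e′ then b else H e′

  set-self : ∀ e b H → set e b H e ≡ b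
  set-self e b H rewrite is-refl e = refl

  set-other : ∀ {e e′} b H → e ≢ e′ → set e b H e′ ≡ H e′
  set-other b H e≢ rewrite is-≢ e≢ = refl

  insert : ∀ {K e} → K e ≡ false → Adds K e (set e true K)
  insert {K} {e} abs = record
    { absent = abs ; present = set-self e true K ; others = set-other true K }

  delete : ∀ {H e} → H e ≡ true → Adds (set e false H) e H
  delete {H} {e} pre = record
    { absent = set-self e false H ; present = pre ; others = λ e≢ → sym (set-other false H e≢) }

  module _ {K e H} (a : Adds K e H) where
    open Adds a

    deg-adds : ∀ v → deg H v ≡ deg K v + inc e v
    deg-adds v = begin
      deg H v ≡⟨ sum-cong-≗ pointwise ⟩
      ∑[ e′ < m ] (inc e′ v * χ (K e′) + χ (is e e′) * inc e′ v)
        ≡⟨ ∑-distrib-+ (λ e′ → inc e′ v * χ (K e′)) (λ e′ → χ (is e e′) * inc e′ v) ⟩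
      deg K v + ∑[ e′ < m ] (χ (is e e′) * inc e′ v) ≡⟨ cong (λ z → deg K v + z) (∑-pick e (λ e′ → inc e′ v)) ⟩
      deg K v + inc e v ∎
      where
      open ≡-Reasoning
      pointwise : ∀ e′ → inc e′ v * χ (H e′) ≡ inc e′ v * χ (K e′) + χ (is e e′) * inc e′ v
      pointwise e′ with e ≟ e′
      ... | yes refl rewrite absent | present =
        trans (*-identityʳ (inc e v)) (sym (trans (cong (_+ (inc e v + 0)) (*-zeroʳ (inc e v))) (+-identityʳ (inc e v))))
      ... | no e≢ rewrite others e≢ = sym (+-identityʳ _)

    -- Both ends gain one degree, so an end leaves the count exactly when its old degree is `d`.
    M-adds : ∀ d → M d H + (χ (deg K (src e) ≡ᵇ d) + χ (deg K (tgt e) ≡ᵇ d)) ≡ M d K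
    M-adds d = begin
      M d H + (δ (src e) + δ (tgt e))
        ≡⟨ cong (λ z → M d H + z) (cong₂ _+_ (∑-pick (src e) δ) (∑-pick (tgt e) δ)) ⟨
      M d H + (∑[ v < n ] (χ (is (src e) v) * δ v) + ∑[ v < n ] (χ (is (tgt e) v) * δ v))
        ≡⟨ cong (λ z → M d H + z) (∑-distrib-+ (λ v → χ (is (src e) v) * δ v) (λ v → χ (is (tgt e) v) * δ v)) ⟨
      M d H + ∑[ v < n ] (χ (is (src e) v) * δ v + χ (is (tgt e) v) * δ v)
        ≡⟨ ∑-distrib-+ (λ v → χ (deg H v ≤ᵇ d)) (λ v → χ (is (src e) v) * δ v + χ (is (tgt e) v) * δ v) ⟨
      ∑[ v < n ] (χ (deg H v ≤ᵇ d) + (χ (is (src e) v) * δ v + χ (is (tgt e) v) * δ v))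
        ≡⟨ sum-cong-≗ (λ v → trans (cong (λ z → χ (deg H v ≤ᵇ d) + z)
             (sym (*-distribʳ-+ (δ v) (χ (is (src e) v)) (χ (is (tgt e) v))))) (pointwise v)) ⟩
      M d K ∎
      where
      open ≡-Reasoning
      δ : Fin n → ℕ
      δ v = χ (deg K v ≡ᵇ d)
      shift : ∀ i d → χ (suc i ≤ᵇ d) + (χ (i ≡ᵇ d) + 0) ≡ χ (i ≤ᵇ d)
      shift zero    zero    = refl
      shift zero    (suc d) = refl
      shift (suc i) zero    = refl
      shift (suc i) (suc d) = shift′ i d
        where
        shift′ : ∀ i d → χ (i <ᵇ d) + (χ (i ≡ᵇ d) + 0) ≡ χ (i <ᵇ suc d)
        shift′ zero    zero    = refl
        shift′ zero    (suc d) = refl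
        shift′ (suc i) zero    = refl
        shift′ (suc i) (suc d) = shift′ i d
      pointwise : ∀ v → χ (deg H v ≤ᵇ d) + inc e v * δ v ≡ χ (deg K v ≤ᵇ d)
      pointwise v with on? v e
      ... | inj₁ on rewrite deg-adds v | inc-on on | +-comm (deg K v) 1 = shift (deg K v) d
      ... | inj₂ (s≢ , t≢) rewrite deg-adds v | inc-off s≢ t≢ | +-identityʳ (deg K v) = +-identityʳ _

  Link : Fin m → Fin n → Fin n → Set
  Link e u v = (src e ≡ u × tgt e ≡ v) ⊎ (src e ≡ v × tgt e ≡ u)

  edges-between : ∀ {v w} → v ≢ w → ∑[ e < m ] (inc e v * inc e w) ≤ 1
  edges-between {v} {w} v≢w = ≮⇒≥ λ two → case two
    where
    on-both : ∀ e → 1 ≤ inc e v * inc e w → On v e × On w e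
    on-both e h with on? v e | on? w e
    ... | inj₁ a | inj₁ b = a , b
    ... | inj₂ (s≢ , t≢) | _ = contradiction (subst (λ z → 1 ≤ z * inc e w) (inc-off s≢ t≢) h) λ ()
    ... | inj₁ _ | inj₂ (s≢ , t≢) =
      contradiction (subst (1 ≤_) (trans (cong (inc e v *_) (inc-off s≢ t≢)) (*-zeroʳ (inc e v))) h) λ ()
    case : 2 ≤ ∑[ e < m ] (inc e v * inc e w) → ⊥
    case two with e₁ , e₂ , e₁≢e₂ , h₁ , h₂ ← ∑-exists-two (λ e → inc e v * inc e w)
                                                (λ e → *-mono-≤ (inc≤1 e v) (inc≤1 e w)) two
      with a , b ← on-both e₁ h₁ | c , d ← on-both e₂ h₂ = e₁≢e₂ (simple v≢w a b c d)

  -- As the graph is simple, the four neighbours of x are distinct.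
  neighbours : ∀ x (P : Fin n → Bool) →
    (∃ λ e → ∃ λ w → Link e x w × P w ≡ false) ⊎ 4 ≤ ∑[ w < n ] χ (P w)
  neighbours x P with any? (λ e → any? (λ w → link? e w ×-dec (P w ≟ᵇ false)))
    where
    link? : ∀ e w → Dec (Link e x w)
    link? e w = ((src e ≟ x) ×-dec (tgt e ≟ w)) ⊎-dec ((src e ≟ w) ×-dec (tgt e ≟ x))
  ... | yes (e , w , l , p) = inj₁ (e , w , l , p)
  ... | no none = inj₂ (begin
    4 ≡⟨ regular x ⟨
    ∑[ e < m ] inc e x ≤⟨ ∑-mono each ⟩
    ∑[ e < m ] ∑[ w < n ] (inc e x * inc e w * (χ (P w) * χ (not (is x w))))
      ≡⟨ ∑-comm (λ e w → inc e x * inc e w * (χ (P w) * χ (not (is x w)))) ⟩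
    ∑[ w < n ] ∑[ e < m ] (inc e x * inc e w * (χ (P w) * χ (not (is x w))))
      ≡⟨ sum-cong-≗ (λ w → *-distribʳ-sum (χ (P w) * χ (not (is x w))) (λ e → inc e x * inc e w)) ⟨
    ∑[ w < n ] (∑[ e < m ] (inc e x * inc e w) * (χ (P w) * χ (not (is x w))))
      ≤⟨ ∑-mono once ⟩
    ∑[ w < n ] χ (P w) ∎)
    where
    open ≤-Reasoning
    all-P : ∀ e w → Link e x w → P w ≡ true
    all-P e w l with P w in eq
    ... | true  = refl
    ... | false = contradiction (e , w , l , eq) none
    term : ∀ e w → On x e → On w e → x ≢ w → P w ≡ true →
           inc e x ≤ ∑[ w < n ] (inc e x * inc e w * (χ (P w) * χ (not (is x w))))
    term e w x-on w-on x≢w pw = ≤-trans (≤-reflexive (sym value))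
      (∑-term (λ w → inc e x * inc e w * (χ (P w) * χ (not (is x w)))) w)
      where
      value : inc e x * inc e w * (χ (P w) * χ (not (is x w))) ≡ inc e x
      value rewrite inc-on x-on | inc-on w-on | pw | is-≢ x≢w = refl
    each : ∀ e → inc e x ≤ ∑[ w < n ] (inc e x * inc e w * (χ (P w) * χ (not (is x w))))
    each e with on? x e
    ... | inj₂ (s≢ , t≢) rewrite inc-off s≢ t≢ = z≤n
    ... | inj₁ (inj₁ p) = term e (tgt e) (inj₁ p) (inj₂ refl) (λ eq → loopless e (trans p eq)) (all-P e _ (inj₁ (p , refl)))
    ... | inj₁ (inj₂ p) = term e (src e) (inj₂ p) (inj₁ refl) (λ eq → loopless e (trans (sym eq) (sym p))) (all-P e _ (inj₂ (refl , p)))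
    once : ∀ w → ∑[ e < m ] (inc e x * inc e w) * (χ (P w) * χ (not (is x w))) ≤ χ (P w)
    once w with x ≟ w
    ... | yes _ = ≤-trans (≤-reflexive (trans (cong (λ z → ∑[ e < m ] (inc e x * inc e w) * z) (*-zeroʳ (χ (P w)))) (*-zeroʳ (∑[ e < m ] (inc e x * inc e w))))) z≤n
    ... | no x≢w = ≤-trans (*-mono-≤ (edges-between x≢w) (≤-reflexive (*-identityʳ (χ (P w))))) (≤-reflexive (+-identityʳ (χ (P w))))

  -- In a loopless graph every neighbour of `x` differs from `x`, so `neighbours` yields four
  -- further vertices. The bound excludes `t = 0` later.
  five-vertices : Fin n → 5 ≤ n
  five-vertices x = [ (λ (e , w , l , p) → ⊥-elim (self-link l p)) , count ]′ (neighbours x (not ∘ is x))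
    where
    self-link : ∀ {e w} → Link e x w → not (is x w) ≡ false → ⊥
    self-link {e} {w} l p with x ≟ w
    self-link (inj₁ (s≡ , t≡)) p | yes x≡w = loopless _ (trans s≡ (trans x≡w (sym t≡)))
    self-link (inj₂ (s≡ , t≡)) p | yes x≡w = loopless _ (trans s≡ (trans (sym x≡w) (sym t≡)))
    count : 4 ≤ ∑[ w < n ] χ (not (is x w)) → 5 ≤ n
    count four = begin
      5 ≤⟨ +-mono-≤ four (≤-reflexive (sym (∑-pick x (λ _ → 1)))) ⟩
      ∑[ w < n ] χ (not (is x w)) + ∑[ w < n ] (χ (is x w) * 1)
        ≡⟨ ∑-distrib-+ (λ w → χ (not (is x w))) (λ w → χ (is x w) * 1) ⟨
      ∑[ w < n ] (χ (not (is x w)) + χ (is x w) * 1) ≡⟨ sum-cong-≗ (λ w → complementary (is x w)) ⟩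
      ∑[ w < n ] 1 ≡⟨ ∑-one n ⟩
      n ∎
      where
      open ≤-Reasoning
      complementary : ∀ b → χ (not b) + χ b * 1 ≡ 1
      complementary true  = refl
      complementary false = refl

sub-selection : ∀ {m} (P : Fin m → Bool) r → r ≤ ∑[ e < m ] χ (P e) →
         Σ[ Q ∈ (Fin m → Bool) ] (∑[ e < m ] χ (Q e) ≡ r × (∀ e → Q e ≡ true → P e ≡ true))
sub-selection {zero}  P zero r≤ = P , refl , λ ()
sub-selection {suc m} P r r≤ with P zero in eq
sub-selection {suc m} P r r≤ | false with Q , size , Q⊆P ← sub-selection (P ∘ suc) r r≤
  = (λ { zero → false ; (suc e) → Q e }) , size , λ { zero () ; (suc e) → Q⊆P e }
sub-selection {suc m} P zero r≤ | true = (λ _ → false) , ∑-zero m , λ _ ()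
sub-selection {suc m} P (suc r) r≤ | true with Q , size , Q⊆P ← sub-selection (P ∘ suc) r (s≤s⁻¹ r≤)
  = (λ { zero → true ; (suc e) → Q e }) , cong suc size , λ { zero _ → eq ; (suc e) → Q⊆P e }

-- Cuts

module Cuts {n m : ℕ} (G : Simple4 n m) where
  open Graphs G

  VertexSet : Set
  VertexSet = Fin n → Bool

  ∣_∣ᵥ : VertexSet → ℕ
  ∣ A ∣ᵥ = ∑[ v < n ] χ (A v)

  crosses : VertexSet → EdgeSet
  crosses A e = A (src e) xor A (tgt e)

  cut : VertexSet → ℕ
  cut A = ∑[ e < m ] χ (crosses A e)

  dcut : VertexSet → Fin n → ℕ
  dcut A = deg (crosses A)

  flip : Fin n → VertexSet → VertexSet
  flip v A w = if is v w then not (A w) else A w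

  flip-self : ∀ v A → flip v A v ≡ not (A v)
  flip-self v A rewrite is-refl v = refl

  flip-other : ∀ {v w} A → v ≢ w → flip v A w ≡ A w
  flip-other A v≢w rewrite is-≢ v≢w = refl

  -- Moving `v` across the cut exchanges its crossing and non-crossing edges: d crossing edges
  -- become 4 - d.
  cut-flip : ∀ v A → cut (flip v A) + 2 * dcut A v ≡ cut A + 4
  cut-flip v A = begin
    cut (flip v A) + 2 * dcut A v
      ≡⟨ cong (λ z → cut (flip v A) + z) (*-distribˡ-sum 2 (λ e → inc e v * χ (crosses A e))) ⟩
    cut (flip v A) + ∑[ e < m ] (2 * (inc e v * χ (crosses A e)))
      ≡⟨ ∑-distrib-+ (λ e → χ (crosses (flip v A) e)) (λ e → 2 * (inc e v * χ (crosses A e))) ⟨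
    ∑[ e < m ] (χ (crosses (flip v A) e) + 2 * (inc e v * χ (crosses A e)))
      ≡⟨ sum-cong-≗ pointwise ⟩
    ∑[ e < m ] (χ (crosses A e) + inc e v)
      ≡⟨ ∑-distrib-+ (λ e → χ (crosses A e)) (λ e → inc e v) ⟩
    cut A + ∑[ e < m ] inc e v
      ≡⟨ cong (λ z → cut A + z) (regular v) ⟩
    cut A + 4 ∎
    where
    open ≡-Reasoning
    left : ∀ a b → χ (not a xor b) + 2 * (1 * χ (a xor b)) ≡ χ (a xor b) + 1
    left false false = refl
    left false true  = refl
    left true  false = refl
    left true  true  = refl
    right : ∀ a b → χ (a xor not b) + 2 * (1 * χ (a xor b)) ≡ χ (a xor b) + 1
    right false false = refl
    right false true  = refl
    right true  false = refl
    right true  true  = refl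
    pointwise : ∀ e → χ (crosses (flip v A) e) + 2 * (inc e v * χ (crosses A e)) ≡ χ (crosses A e) + inc e v
    pointwise e with on? v e
    ... | inj₁ (inj₁ refl) rewrite inc-src e | flip-self (src e) A | flip-other A (loopless e) = left (A (src e)) (A (tgt e))
    ... | inj₁ (inj₂ refl) rewrite inc-tgt e | flip-self (tgt e) A | flip-other A (loopless e ∘ sym) = right (A (src e)) (A (tgt e))
    ... | inj₂ (s≢ , t≢) rewrite inc-off s≢ t≢ | flip-other A (s≢ ∘ sym) | flip-other A (t≢ ∘ sym) = refl

  size-insert : ∀ v A → A v ≡ false → ∣ flip v A ∣ᵥ ≡ suc ∣ A ∣ᵥ
  size-insert v A Av = begin
    ∣ flip v A ∣ᵥ ≡⟨ sum-cong-≗ pointwise ⟩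
    ∑[ w < n ] (χ (is v w) * 1 + χ (A w)) ≡⟨ ∑-distrib-+ (λ w → χ (is v w) * 1) (λ w → χ (A w)) ⟩
    ∑[ w < n ] (χ (is v w) * 1) + ∣ A ∣ᵥ ≡⟨ cong (λ z → z + ∣ A ∣ᵥ) (∑-pick v (λ _ → 1)) ⟩
    suc ∣ A ∣ᵥ ∎
    where
    open ≡-Reasoning
    pointwise : ∀ w → χ (flip v A w) ≡ χ (is v w) * 1 + χ (A w)
    pointwise w with v ≟ w
    ... | yes refl rewrite Av = refl
    ... | no _ = refl

  size-remove : ∀ v A → A v ≡ true → suc ∣ flip v A ∣ᵥ ≡ ∣ A ∣ᵥ
  size-remove v A Av = begin
    suc ∣ flip v A ∣ᵥ ≡⟨ cong (λ z → z + ∣ flip v A ∣ᵥ) (∑-pick v (λ _ → 1)) ⟨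
    ∑[ w < n ] (χ (is v w) * 1) + ∣ flip v A ∣ᵥ ≡⟨ ∑-distrib-+ (λ w → χ (is v w) * 1) (λ w → χ (flip v A w)) ⟨
    ∑[ w < n ] (χ (is v w) * 1 + χ (flip v A w)) ≡⟨ sum-cong-≗ pointwise ⟩
    ∣ A ∣ᵥ ∎
    where
    open ≡-Reasoning
    pointwise : ∀ w → χ (is v w) * 1 + χ (flip v A w) ≡ χ (A w)
    pointwise w with v ≟ w
    ... | yes refl rewrite Av = refl
    ... | no _ = refl

  dcut-positive : ∀ A {v e} → On v e → crosses A e ≡ true → 1 ≤ dcut A v
  dcut-positive A {v} {e} on c = subst (_≤ dcut A v) (cong₂ (λ i b → i * χ b) (inc-on on) c)
    (∑-term (λ e → inc e v * χ (crosses A e)) e)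

  -- A new vertex that meets a crossing edge adds at most 4 - 2 = 2 to the cut. If nothing crosses,
  -- the cut is empty and any new vertex makes it 4; this case, which includes the first vertex, is
  -- the origin of the constant 2.
  grow : ∀ a → a ≤ n → Σ[ A ∈ VertexSet ] (∣ A ∣ᵥ ≡ a × cut A ≤ 2 * a + 2)
  grow zero _ = (λ _ → false) , ∑-zero n , ≤-trans (≤-reflexive (∑-zero m)) z≤n
  grow (suc a) a<n with A , size , bound ← grow a (<⇒≤ a<n) = extend (any? λ e → crosses A e ≟ᵇ true)
    where
    insert-vertex : ∀ v → A v ≡ false → cut A + 4 ≤ 2 * suc a + 2 + 2 * dcut A v →
             Σ[ A ∈ VertexSet ] (∣ A ∣ᵥ ≡ suc a × cut A ≤ 2 * suc a + 2)
    insert-vertex v Av h = flip v A , trans (size-insert v A Av) (cong suc size) ,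
      +-cancelʳ-≤ (2 * dcut A v) _ _ (≤-trans (≤-reflexive (cut-flip v A)) h)
    open ℕ-Solver
    grown : 2 * a + 2 + 4 ≡ 2 * suc a + 2 + 2
    grown = solve 1 (λ a → con 2 :* a :+ con 2 :+ con 4 := con 2 :* (con 1 :+ a) :+ con 2 :+ con 2) refl a
    touching : ∀ {v e} → On v e → A v ≡ false → crosses A e ≡ true → Σ[ A ∈ VertexSet ] (∣ A ∣ᵥ ≡ suc a × cut A ≤ 2 * suc a + 2)
    touching {v} on Av c = insert-vertex v Av (≤-trans (+-monoˡ-≤ 4 bound) (≤-trans (≤-reflexive grown)
      (+-monoʳ-≤ (2 * suc a + 2) (*-monoʳ-≤ 2 (dcut-positive A on c)))))
    extend : Dec (∃ λ e → crosses A e ≡ true) → Σ[ A ∈ VertexSet ] (∣ A ∣ᵥ ≡ suc a × cut A ≤ 2 * suc a + 2)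
    extend (yes (e , c)) with A (src e) in eqs | A (tgt e) in eqt
    ... | false | _     = touching (inj₁ refl) eqs (trans (cong₂ _xor_ eqs eqt) c)
    ... | true  | false = touching (inj₂ refl) eqt (trans (cong₂ _xor_ eqs eqt) refl)
    ... | true  | true  = contradiction c λ ()
    extend (no none) with any? (λ v → A v ≟ᵇ false)
    ... | yes (v , Av) = insert-vertex v Av (≤-trans (≤-reflexive (cong (λ z → z + 4) closed))
            (≤-trans (≤-trans (m≤n+m 4 (2 * a)) (≤-reflexive (solve 1 (λ a → con 2 :* a :+ con 4 := con 2 :* (con 1 :+ a) :+ con 2) refl a))) (m≤m+n (2 * suc a + 2) (2 * dcut A v))))
      where
      closed : cut A ≡ 0
      closed = trans (sum-cong-≗ {m} {λ e → χ (crosses A e)} {λ _ → 0} (λ e → uncrossed e)) (∑-zero m)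
        where
        uncrossed : ∀ e → χ (crosses A e) ≡ 0
        uncrossed e with crosses A e in eq
        ... | true  = contradiction (e , eq) none
        ... | false = refl
    ... | no full = contradiction (trans (sym size) everything) (<⇒≢ a<n)
      where
      everything : ∣ A ∣ᵥ ≡ n
      everything = trans (sum-cong-≗ {n} {λ v → χ (A v)} {λ _ → 1} (λ v → inside v)) (∑-one n)
        where
        inside : ∀ v → χ (A v) ≡ 1
        inside v with A v in eq
        ... | true  = refl
        ... | false = contradiction (v , eq) full

  -- Every crossing edge has exactly one end on each side. `b` selects the side: `false` the inside
  -- of `A`, `true` the outside.
  one-side : ∀ A b → ∑[ v < n ] (χ (b xor A v) * dcut A v) ≡ cut A
  one-side A b = begin
    ∑[ v < n ] (χ (b xor A v) * dcut A v)
      ≡⟨ sum-cong-≗ (λ v → trans (*-distribˡ-sum (χ (b xor A v)) (λ e → inc e v * χ (crosses A e)))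
           (sum-cong-≗ λ e → rearrange (χ (b xor A v)) (inc e v) (χ (crosses A e)))) ⟩
    ∑[ v < n ] ∑[ e < m ] (inc e v * (χ (crosses A e) * χ (b xor A v)))
      ≡⟨ handshake (λ e v → χ (crosses A e) * χ (b xor A v)) ⟩
    ∑[ e < m ] (χ (crosses A e) * χ (b xor A (src e)) + χ (crosses A e) * χ (b xor A (tgt e)))
      ≡⟨ sum-cong-≗ (λ e → pointwise b (A (src e)) (A (tgt e))) ⟩
    cut A ∎
    where
    open ≡-Reasoning
    rearrange : ∀ x y z → x * (y * z) ≡ y * (z * x)
    rearrange = solve 3 (λ x y z → x :* (y :* z) := y :* (z :* x)) refl where open ℕ-Solver
    pointwise : ∀ b x y → χ (x xor y) * χ (b xor x) + χ (x xor y) * χ (b xor y) ≡ χ (x xor y)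
    pointwise false false false = refl
    pointwise false false true  = refl
    pointwise false true  false = refl
    pointwise false true  true  = refl
    pointwise true  false false = refl
    pointwise true  false true  = refl
    pointwise true  true  false = refl
    pointwise true  true  true  = refl

  -- The two ways in which `refine` can stop. Both sizes are legal values of `M 1`. The crossing
  -- edges are few at each outer vertex in the even case, and at each inner vertex in the odd case.
  data Good (t : ℕ) (A : VertexSet) : Set where
    even : ∣ A ∣ᵥ ≡ 2 * t → cut A ≤ 4 * t + 2 → (∀ v → A v ≡ false → dcut A v ≤ 2) → Good t A
    odd  : ∣ A ∣ᵥ ≡ 2 * t + 1 → (∀ u → A u ≡ true → dcut A u ≤ 1) → Good t A

  -- While some vertex outside A has at least three neighbours in A, add it and remove a
  -- vertex with at least two neighbours outside: the cut gets smaller.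
  refine : ∀ t N A → cut A ≤ N → ∣ A ∣ᵥ ≡ 2 * t → cut A ≤ 4 * t + 2 → ∃ (Good t)
  refine t N A cut≤N size bound with any? (λ v → (A v ≟ᵇ false) ×-dec (3 ≤? dcut A v))
  ... | no none = A , even size bound λ v Av → s≤s⁻¹ (≰⇒> λ h → none (v , Av , h))
  ... | yes (v , Av , 3≤) with any? (λ u → (flip v A u ≟ᵇ true) ×-dec (2 ≤? dcut (flip v A) u))
  ...   | no none = flip v A , odd (trans (size-insert v A Av) (trans (cong suc size) (+-comm 1 (2 * t))))
                      λ u Au → s≤s⁻¹ (≰⇒> λ h → none (u , Au , h))
  ...   | yes (u , Au , 2≤) = continue N cut≤N
    where
    B : VertexSet
    B = flip u (flip v A)
    -- By `cut-flip`, adding `v` lowers the cut by at least 2·3 - 4 = 2, and removing `u` cannot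
    -- raise it since 2·2 - 4 = 0.
    first : cut (flip v A) + 2 ≤ cut A
    first = +-cancelʳ-≤ 4 _ _ (≤-trans (≤-reflexive (+-assoc (cut (flip v A)) 2 4))
      (≤-trans (+-monoʳ-≤ (cut (flip v A)) (*-monoʳ-≤ 2 3≤)) (≤-reflexive (cut-flip v A))))
    second : cut B ≤ cut (flip v A)
    second = +-cancelʳ-≤ 4 _ _ (≤-trans (+-monoʳ-≤ (cut B) (*-monoʳ-≤ 2 2≤)) (≤-reflexive (cut-flip u (flip v A))))
    drop : suc (cut B) ≤ cut A
    drop = ≤-trans (≤-trans (s≤s second) (≤-trans (m≤m+n _ 1) (≤-reflexive (lemma (cut (flip v A)))))) first
      where
      lemma : ∀ x → suc x + 1 ≡ x + 2
      lemma x = trans (sym (+-suc x 1)) refl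
    continue : ∀ N → cut A ≤ N → ∃ (Good t)
    continue zero    le = contradiction (≤-trans drop le) λ ()
    continue (suc N) le = refine t N B (s≤s⁻¹ (≤-trans drop le))
      (suc-injective (trans (size-remove u (flip v A) Au) (trans (size-insert v A Av) (cong suc size))))
      (≤-trans (<⇒≤ drop) bound)

-- The edge set of a cut

module FromCut {n m : ℕ} (G : Simple4 n m) (A : Fin n → Bool) where
  open Graphs G
  open Cuts G

  d : Fin n → ℕ
  d = dcut A

  at-cut : Fin n → EdgeSet
  at-cut v e = (is (src e) v ∨ is (tgt e) v) ∧ crosses A e

  at-cut-size : ∀ v → ∑[ e < m ] χ (at-cut v e) ≡ d v
  at-cut-size v = sum-cong-≗ pointwise
    where
    pointwise : ∀ e → χ (at-cut v e) ≡ inc e v * χ (crosses A e)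
    pointwise e with on? v e
    ... | inj₁ (inj₁ refl) rewrite inc-src e | is-refl (src e) = sym (+-identityʳ _)
    ... | inj₁ (inj₂ refl) rewrite inc-tgt e | is-refl (tgt e) | is-≢ (loopless e) = sym (+-identityʳ _)
    ... | inj₂ (s≢ , t≢) rewrite is-≢ s≢ | is-≢ t≢ = refl

  -- A vertex v outside A has 4 − d v edges that do not cross; keeping d v ∸ 2 of the
  -- crossing ones gives it degree at least 2.
  chosen : ∀ v → Σ[ Q ∈ EdgeSet ] (∑[ e < m ] χ (Q e) ≡ d v ∸ 2 × (∀ e → Q e ≡ true → at-cut v e ≡ true))
  chosen v = sub-selection (at-cut v) (d v ∸ 2) (≤-trans (m∸n≤m (d v) 2) (≤-reflexive (sym (at-cut-size v))))

  Q : Fin n → EdgeSet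
  Q v = proj₁ (chosen v)

  Q-crosses : ∀ v e → crosses A e ≡ false → Q v e ≡ false
  Q-crosses v e c with Q v e in eq
  ... | false = refl
  ... | true = contradiction (trans (sym off) (proj₂ (proj₂ (chosen v)) e eq)) λ ()
    where
    off : at-cut v e ≡ false
    off = trans (cong (λ z → (is (src e) v ∨ is (tgt e) v) ∧ z) c) (∧-zeroʳ _)

  Q-off : ∀ v e → src e ≢ v → tgt e ≢ v → Q v e ≡ false
  Q-off v e s≢ t≢ with Q v e in eq
  ... | false = refl
  ... | true = contradiction (trans (sym off) (proj₂ (proj₂ (chosen v)) e eq)) λ ()
    where
    off : at-cut v e ≡ false
    off rewrite is-≢ s≢ | is-≢ t≢ = refl

  -- A crossing edge is decided by its end outside `A`.
  H : EdgeSet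
  H e = if A (src e) then (if A (tgt e) then false else Q (tgt e) e)
                     else (if A (tgt e) then Q (src e) e else true)

  outside : ∀ v → A v ≡ false → deg H v + d v ≡ 4 + (d v ∸ 2)
  outside v Av = begin
    deg H v + d v ≡⟨ ∑-distrib-+ (λ e → inc e v * χ (H e)) (λ e → inc e v * χ (crosses A e)) ⟨
    ∑[ e < m ] (inc e v * χ (H e) + inc e v * χ (crosses A e)) ≡⟨ sum-cong-≗ pointwise ⟩
    ∑[ e < m ] (inc e v + χ (Q v e)) ≡⟨ ∑-distrib-+ (λ e → inc e v) (λ e → χ (Q v e)) ⟩
    ∑[ e < m ] inc e v + ∑[ e < m ] χ (Q v e) ≡⟨ cong₂ _+_ (regular v) (proj₁ (proj₂ (chosen v))) ⟩
    4 + (d v ∸ 2) ∎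
    where
    open ≡-Reasoning
    pointwise : ∀ e → inc e v * χ (H e) + inc e v * χ (crosses A e) ≡ inc e v + χ (Q v e)
    pointwise e with on? v e
    ... | inj₂ (s≢ , t≢) rewrite inc-off s≢ t≢ | Q-off v e s≢ t≢ = refl
    pointwise e | inj₁ (inj₁ refl) with Q-crosses (src e) e
    ... | q rewrite inc-src e | Av with A (tgt e)
    ...   | true  = trans (cong (λ z → z + 1) (+-identityʳ _)) (+-comm _ 1)
    ...   | false rewrite q refl = refl
    pointwise e | inj₁ (inj₂ refl) with Q-crosses (tgt e) e
    ... | q rewrite inc-tgt e | Av with A (src e)
    ...   | true  = trans (cong (λ z → z + 1) (+-identityʳ _)) (+-comm _ 1)
    ...   | false rewrite q refl = refl

  inside : ∀ u → A u ≡ true → deg H u ≤ d u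
  inside u Au = ∑-mono pointwise
    where
    pointwise : ∀ e → inc e u * χ (H e) ≤ inc e u * χ (crosses A e)
    pointwise e with on? u e
    ... | inj₂ (s≢ , t≢) rewrite inc-off s≢ t≢ = z≤n
    pointwise e | inj₁ (inj₁ refl) rewrite inc-src e | Au with A (tgt e)
    ... | true  = z≤n
    ... | false = +-monoˡ-≤ 0 (χ≤1 (Q (tgt e) e))
    pointwise e | inj₁ (inj₂ refl) rewrite inc-tgt e | Au with A (src e)
    ... | true  = z≤n
    ... | false = +-monoˡ-≤ 0 (χ≤1 (Q (src e) e))

  -- The number of crossing edges kept in `H`, each counted at its outer end.
  extra : ℕ
  extra = ∑[ v < n ] (χ (not (A v)) * (d v ∸ 2))

  inside-total : ∑[ u < n ] (χ (A u) * deg H u) ≤ extra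
  inside-total = begin
    ∑[ u < n ] (χ (A u) * deg H u)
      ≡⟨ sum-cong-≗ (λ u → trans (*-distribˡ-sum (χ (A u)) (λ e → inc e u * χ (H e)))
           (sum-cong-≗ λ e → rearrange (χ (A u)) (inc e u) (χ (H e)))) ⟩
    ∑[ u < n ] ∑[ e < m ] (inc e u * (χ (H e) * χ (A u)))
      ≡⟨ handshake (λ e u → χ (H e) * χ (A u)) ⟩
    ∑[ e < m ] (χ (H e) * χ (A (src e)) + χ (H e) * χ (A (tgt e)))
      ≤⟨ ∑-mono paid ⟩
    ∑[ e < m ] ∑[ v < n ] (χ (not (A v)) * χ (Q v e))
      ≡⟨ ∑-comm (λ e v → χ (not (A v)) * χ (Q v e)) ⟩
    ∑[ v < n ] ∑[ e < m ] (χ (not (A v)) * χ (Q v e))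
      ≡⟨ sum-cong-≗ (λ v → trans (sym (*-distribˡ-sum (χ (not (A v))) (λ e → χ (Q v e))))
           (cong (λ z → χ (not (A v)) * z) (proj₁ (proj₂ (chosen v))))) ⟩
    extra ∎
    where
    open ≤-Reasoning
    rearrange : ∀ x y z → x * (y * z) ≡ y * (z * x)
    rearrange = solve 3 (λ x y z → x :* (y :* z) := y :* (z :* x)) refl where open ℕ-Solver
    outer : ∀ e v → A v ≡ false → χ (Q v e) ≤ ∑[ v < n ] (χ (not (A v)) * χ (Q v e))
    outer e v Av = subst (_≤ ∑[ v < n ] (χ (not (A v)) * χ (Q v e)))
      (trans (cong (λ a → χ (not a) * χ (Q v e)) Av) (+-identityʳ _)) (∑-term (λ v → χ (not (A v)) * χ (Q v e)) v)
    paid : ∀ e → χ (H e) * χ (A (src e)) + χ (H e) * χ (A (tgt e)) ≤ ∑[ v < n ] (χ (not (A v)) * χ (Q v e))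
    paid e with A (src e) in eqs | A (tgt e) in eqt
    ... | true  | true  = z≤n
    ... | true  | false = ≤-trans (≤-reflexive (simplify (χ (Q (tgt e) e)))) (outer e (tgt e) eqt)
      where
      simplify : ∀ x → x * 1 + x * 0 ≡ x
      simplify x = trans (cong₂ _+_ (*-identityʳ x) (*-zeroʳ x)) (+-identityʳ x)
    ... | false | true  = ≤-trans (≤-reflexive (simplify (χ (Q (src e) e)))) (outer e (src e) eqs)
      where
      simplify : ∀ x → x * 0 + x * 1 ≡ x
      simplify x = cong₂ _+_ (*-zeroʳ x) (*-identityʳ x)
    ... | false | false = z≤n

  d≤4 : ∀ v → d v ≤ 4
  d≤4 = deg≤4 (crosses A)

  outside-degree : ∀ {v} → A v ≡ false → deg H v ≡ 4 + (d v ∸ 2) ∸ d v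
  outside-degree {v} Av = trans (sym (m+n∸n≡m (deg H v) (d v))) (cong (λ z → z ∸ d v) (outside v Av))

  -- Outside `A` the degree is determined by the number of crossing edges: 4, 3, 2, 2, 2 for 0, 1,
  -- 2, 3, 4 of them. Bounds on the counts thus reduce to a table there, and to `inside` within `A`.
  sides : (f g : ℕ → Fin n → ℕ) → (∀ v → A v ≡ true → f (deg H v) v ≤ g (deg H v) v) →
    (∀ v → A v ≡ false → f (4 + (d v ∸ 2) ∸ d v) v ≤ g (4 + (d v ∸ 2) ∸ d v) v) →
    ∑[ v < n ] f (deg H v) v ≤ ∑[ v < n ] g (deg H v) v
  sides f g in-A out-A = ∑-mono pointwise
    where
    pointwise : ∀ v → f (deg H v) v ≤ g (deg H v) v
    pointwise v with A v in eq
    ... | true  = in-A v eq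
    ... | false = subst (λ z → f z v ≤ g z v) (sym (outside-degree eq)) (out-A v eq)

  size≤ : ∀ e → (∀ u → A u ≡ true → deg H u ≤ e) → ∣ A ∣ᵥ ≤ M e H
  size≤ e h = sides (λ _ v → χ (A v)) (λ i _ → χ (i ≤ᵇ e)) in-A out-A
    where
    in-A : ∀ v → A v ≡ true → χ (A v) ≤ χ (deg H v ≤ᵇ e)
    in-A v Av rewrite Av with deg H v ≤ᵇ e in eq
    ... | true  = ≤-refl
    ... | false = contradiction (subst T eq (≤⇒≤ᵇ (h v Av))) λ ()
    out-A : ∀ v → A v ≡ false → χ (A v) ≤ χ (4 + (d v ∸ 2) ∸ d v ≤ᵇ e)
    out-A v Av rewrite Av = z≤n

  M₁≤size : M 1 H ≤ ∣ A ∣ᵥ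
  M₁≤size = sides (λ i _ → χ (i ≤ᵇ 1)) (λ _ v → χ (A v)) in-A out-A
    where
    in-A : ∀ v → A v ≡ true → χ (deg H v ≤ᵇ 1) ≤ χ (A v)
    in-A v Av rewrite Av with deg H v ≤ᵇ 1
    ... | true  = ≤-refl
    ... | false = z≤n
    out-A : ∀ v → A v ≡ false → χ (4 + (d v ∸ 2) ∸ d v ≤ᵇ 1) ≤ χ (A v)
    out-A v Av with d v | d≤4 v
    ... | 0 | _ = z≤n
    ... | 1 | _ = z≤n
    ... | 2 | _ = z≤n
    ... | 3 | _ = z≤n
    ... | 4 | _ = z≤n
    ... | suc (suc (suc (suc (suc _)))) | s≤s (s≤s (s≤s (s≤s ())))

  private
    split-sum : ∀ (f g : Fin n → ℕ) c → ∑[ v < n ] (c * f v + g v) ≡ c * sum f + sum g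
    split-sum f g c = trans (∑-distrib-+ (λ v → c * f v) g) (cong (λ z → z + sum g) (sym (*-distribˡ-sum c f)))

    out : Fin n → ℕ
    out v = χ (true xor A v) * d v

  -- An outer vertex of degree at most 2 has at least two crossing edges, and the cut counts each of
  -- them at one outer end only.
  2M₂≤ : 2 * M 2 H ≤ 2 * ∣ A ∣ᵥ + cut A
  2M₂≤ = begin
    2 * M 2 H ≡⟨ *-distribˡ-sum 2 (λ v → χ (deg H v ≤ᵇ 2)) ⟩
    ∑[ v < n ] (2 * χ (deg H v ≤ᵇ 2))
      ≤⟨ sides (λ i _ → 2 * χ (i ≤ᵇ 2)) (λ _ v → 2 * χ (A v) + out v) in-A out-A ⟩
    ∑[ v < n ] (2 * χ (A v) + out v) ≡⟨ split-sum (λ v → χ (A v)) out 2 ⟩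
    2 * ∣ A ∣ᵥ + sum out ≡⟨ cong (λ z → 2 * ∣ A ∣ᵥ + z) (one-side A true) ⟩
    2 * ∣ A ∣ᵥ + cut A ∎
    where
    open ≤-Reasoning
    in-A : ∀ v → A v ≡ true → 2 * χ (deg H v ≤ᵇ 2) ≤ 2 * χ (A v) + out v
    in-A v Av rewrite Av = ≤-trans (*-monoʳ-≤ 2 (χ≤1 (deg H v ≤ᵇ 2))) (m≤m+n 2 0)
    out-A : ∀ v → A v ≡ false → 2 * χ (4 + (d v ∸ 2) ∸ d v ≤ᵇ 2) ≤ 2 * χ (A v) + out v
    out-A v Av rewrite Av with d v | d≤4 v
    ... | 0 | _ = z≤n
    ... | 1 | _ = z≤n
    ... | 2 | _ = s≤s (s≤s z≤n)
    ... | 3 | _ = s≤s (s≤s z≤n)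
    ... | 4 | _ = s≤s (s≤s z≤n)
    ... | suc (suc (suc (suc (suc _)))) | s≤s (s≤s (s≤s (s≤s ())))

  -- Under the hypothesis an outer vertex has degree 4 - d, so it is counted exactly d times on the
  -- left.
  M₂+M₃≤ : (∀ v → A v ≡ false → d v ≤ 2) → M 2 H + M 3 H ≤ 2 * ∣ A ∣ᵥ + cut A
  M₂+M₃≤ d≤2 = begin
    M 2 H + M 3 H ≡⟨ ∑-distrib-+ (λ v → χ (deg H v ≤ᵇ 2)) (λ v → χ (deg H v ≤ᵇ 3)) ⟨
    ∑[ v < n ] (χ (deg H v ≤ᵇ 2) + χ (deg H v ≤ᵇ 3))
      ≤⟨ sides (λ i _ → χ (i ≤ᵇ 2) + χ (i ≤ᵇ 3)) (λ _ v → 2 * χ (A v) + out v) in-A out-A ⟩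
    ∑[ v < n ] (2 * χ (A v) + out v) ≡⟨ split-sum (λ v → χ (A v)) out 2 ⟩
    2 * ∣ A ∣ᵥ + sum out ≡⟨ cong (λ z → 2 * ∣ A ∣ᵥ + z) (one-side A true) ⟩
    2 * ∣ A ∣ᵥ + cut A ∎
    where
    open ≤-Reasoning
    in-A : ∀ v → A v ≡ true → χ (deg H v ≤ᵇ 2) + χ (deg H v ≤ᵇ 3) ≤ 2 * χ (A v) + out v
    in-A v Av rewrite Av = +-mono-≤ (χ≤1 (deg H v ≤ᵇ 2)) (≤-trans (χ≤1 (deg H v ≤ᵇ 3)) (m≤m+n 1 0))
    out-A : ∀ v → A v ≡ false → χ (4 + (d v ∸ 2) ∸ d v ≤ᵇ 2) + χ (4 + (d v ∸ 2) ∸ d v ≤ᵇ 3) ≤ 2 * χ (A v) + out v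
    out-A v Av with d≤2 v Av
    ... | h rewrite Av with d v | h
    ...   | 0 | _ = z≤n
    ...   | 1 | _ = s≤s z≤n
    ...   | 2 | _ = s≤s (s≤s z≤n)
    ...   | suc (suc (suc _)) | s≤s (s≤s ())

  size≤M₀+extra : ∣ A ∣ᵥ ≤ M 0 H + extra
  size≤M₀+extra = begin
    ∣ A ∣ᵥ ≤⟨ ∑-mono pointwise ⟩
    ∑[ v < n ] (χ (deg H v ≤ᵇ 0) + χ (A v) * deg H v) ≡⟨ ∑-distrib-+ (λ v → χ (deg H v ≤ᵇ 0)) (λ v → χ (A v) * deg H v) ⟩
    M 0 H + ∑[ v < n ] (χ (A v) * deg H v) ≤⟨ +-monoʳ-≤ (M 0 H) inside-total ⟩
    M 0 H + extra ∎
    where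
    open ≤-Reasoning
    pointwise : ∀ v → χ (A v) ≤ χ (deg H v ≤ᵇ 0) + χ (A v) * deg H v
    pointwise v with A v | deg H v
    ... | false | _     = z≤n
    ... | true  | zero  = s≤s z≤n
    ... | true  | suc _ = s≤s z≤n

  -- For d ≤ 4 at most half of the d crossing edges at a vertex are kept: 2 (d ∸ 2) ≤ d.
  2extra≤ : 2 * extra ≤ cut A
  2extra≤ = begin
    2 * extra ≡⟨ *-distribˡ-sum 2 (λ v → χ (not (A v)) * (d v ∸ 2)) ⟩
    ∑[ v < n ] (2 * (χ (not (A v)) * (d v ∸ 2))) ≤⟨ ∑-mono pointwise ⟩
    sum out ≡⟨ one-side A true ⟩
    cut A ∎
    where
    open ≤-Reasoning
    pointwise : ∀ v → 2 * (χ (not (A v)) * (d v ∸ 2)) ≤ out v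
    pointwise v with A v | d v | d≤4 v
    ... | true  | _ | _ = z≤n
    ... | false | 0 | _ = z≤n
    ... | false | 1 | _ = z≤n
    ... | false | 2 | _ = z≤n
    ... | false | 3 | _ = s≤s (s≤s z≤n)
    ... | false | 4 | _ = ≤-refl
    ... | false | suc (suc (suc (suc (suc _)))) | s≤s (s≤s (s≤s (s≤s ())))

  -- M 3 - M 2 counts vertices of degree 3. By hypothesis these lie outside `A`, where degree 3
  -- means a single crossing edge, while `extra` comes from vertices with at least three. So the two
  -- never draw on the same vertex.
  M₃+extra≤ : (∀ u → A u ≡ true → d u ≤ 1) → M 3 H + extra ≤ M 2 H + cut A
  M₃+extra≤ d≤1 = begin
    M 3 H + extra ≡⟨ ∑-distrib-+ (λ v → χ (deg H v ≤ᵇ 3)) (λ v → χ (not (A v)) * (d v ∸ 2)) ⟨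
    ∑[ v < n ] (χ (deg H v ≤ᵇ 3) + χ (not (A v)) * (d v ∸ 2))
      ≤⟨ sides (λ i v → χ (i ≤ᵇ 3) + χ (not (A v)) * (d v ∸ 2)) (λ i v → χ (i ≤ᵇ 2) + out v) in-A out-A ⟩
    ∑[ v < n ] (χ (deg H v ≤ᵇ 2) + out v) ≡⟨ ∑-distrib-+ (λ v → χ (deg H v ≤ᵇ 2)) out ⟩
    M 2 H + sum out ≡⟨ cong (λ z → M 2 H + z) (one-side A true) ⟩
    M 2 H + cut A ∎
    where
    open ≤-Reasoning
    in-A : ∀ v → A v ≡ true → χ (deg H v ≤ᵇ 3) + χ (not (A v)) * (d v ∸ 2) ≤ χ (deg H v ≤ᵇ 2) + out v
    in-A v Av with ≤-trans (inside v Av) (d≤1 v Av)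
    ... | h rewrite Av with deg H v | h
    ...   | 0 | _ = s≤s z≤n
    ...   | 1 | _ = s≤s z≤n
    ...   | suc (suc _) | s≤s ()
    out-A : ∀ v → A v ≡ false → χ (4 + (d v ∸ 2) ∸ d v ≤ᵇ 3) + χ (not (A v)) * (d v ∸ 2) ≤ χ (4 + (d v ∸ 2) ∸ d v ≤ᵇ 2) + out v
    out-A v Av rewrite Av with d v | d≤4 v
    ... | 0 | _ = z≤n
    ... | 1 | _ = s≤s z≤n
    ... | 2 | _ = s≤s z≤n
    ... | 3 | _ = s≤s (s≤s z≤n)
    ... | 4 | _ = s≤s (s≤s (s≤s z≤n))
    ... | suc (suc (suc (suc (suc _)))) | s≤s (s≤s (s≤s (s≤s ())))

  -- The hypothesis makes `extra` zero: no crossing edge is kept.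
  zeros-inside : (∀ v → A v ≡ false → d v ≤ 2) → ∀ u → A u ≡ true → deg H u ≤ 0
  zeros-inside d≤2 u Au = ≤-trans (≤-reflexive (sym (trans (cong (λ a → χ a * deg H u) Au) (+-identityʳ _))))
    (≤-trans (∑-term (λ u → χ (A u) * deg H u) u) (≤-trans inside-total (≤-reflexive
      (trans (sum-cong-≗ {n} {λ v → χ (not (A v)) * (d v ∸ 2)} {λ _ → 0} nothing) (∑-zero n)))))
    where
    nothing : ∀ v → χ (not (A v)) * (d v ∸ 2) ≡ 0
    nothing v with A v in eq
    ... | true  = refl
    ... | false = trans (+-identityʳ _) (m≤n⇒m∸n≡0 (d≤2 v eq))

-- Linear inequalities

-- Affine forms in m variables; the last entry is the constant term.
Form : ℕ → Set
Form m = Vec ℤ (suc m)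

eval : ∀ {m} → Form m → Vec ℤ m → ℤ
eval (c ∷ [])     []      = c
eval (a ∷ b ∷ as) (x ∷ ρ) = a ℤ.* x ℤ.+ eval (b ∷ as) ρ

-- A record rather than a bare inequality of values, so that the form and the point can be recovered
-- from the type.
record Holds {m} (ρ : Vec ℤ m) (f : Form m) : Set where
  constructor holds
  field
    nonneg : 0ℤ ℤ.≤ eval f ρ

infixl 6 _⊕_ _⊖_
infixl 7 _⊙_
infix  4 _≼_

_⊕_ _⊖_ _≼_ : ∀ {m} → Form m → Form m → Form m
_⊕_ = zipWith ℤ._+_
_⊖_ = zipWith ℤ._-_
f ≼ g = g ⊖ f

_⊙_ : ∀ {m} → ℤ → Form m → Form m
a ⊙ f = Vec.map (a ℤ.*_) f

const : ∀ {m} → ℤ → Form m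
const {zero}  c = c ∷ []
const {suc m} c = 0ℤ ∷ const c

eval-⊕ : ∀ {m} (f g : Form m) ρ → eval (f ⊕ g) ρ ≡ eval f ρ ℤ.+ eval g ρ
eval-⊕ (c ∷ [])     (d ∷ [])      []      = refl
eval-⊕ (a ∷ b ∷ as) (a′ ∷ b′ ∷ bs) (x ∷ ρ)
  rewrite eval-⊕ (b ∷ as) (b′ ∷ bs) ρ = lemma a a′ x (eval (b ∷ as) ρ) (eval (b′ ∷ bs) ρ)
  where
  open ℤ-Solver
  lemma : ∀ a a′ x p q → (a ℤ.+ a′) ℤ.* x ℤ.+ (p ℤ.+ q) ≡ a ℤ.* x ℤ.+ p ℤ.+ (a′ ℤ.* x ℤ.+ q)
  lemma = solve 5 (λ a a′ x p q → (a :+ a′) :* x :+ (p :+ q) := a :* x :+ p :+ (a′ :* x :+ q)) refl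

eval-⊖ : ∀ {m} (f g : Form m) ρ → eval (f ⊖ g) ρ ≡ eval f ρ ℤ.- eval g ρ
eval-⊖ (c ∷ [])     (d ∷ [])      []      = refl
eval-⊖ (a ∷ b ∷ as) (a′ ∷ b′ ∷ bs) (x ∷ ρ)
  rewrite eval-⊖ (b ∷ as) (b′ ∷ bs) ρ = lemma a a′ x (eval (b ∷ as) ρ) (eval (b′ ∷ bs) ρ)
  where
  open ℤ-Solver
  lemma : ∀ a a′ x p q → (a ℤ.- a′) ℤ.* x ℤ.+ (p ℤ.- q) ≡ a ℤ.* x ℤ.+ p ℤ.- (a′ ℤ.* x ℤ.+ q)
  lemma = solve 5 (λ a a′ x p q → (a :- a′) :* x :+ (p :- q) := a :* x :+ p :- (a′ :* x :+ q)) refl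

eval-⊙ : ∀ {m} c (f : Form m) ρ → eval (c ⊙ f) ρ ≡ c ℤ.* eval f ρ
eval-⊙ c (d ∷ [])     []      = refl
eval-⊙ c (a ∷ b ∷ as) (x ∷ ρ) rewrite eval-⊙ c (b ∷ as) ρ = lemma c a x (eval (b ∷ as) ρ)
  where
  open ℤ-Solver
  lemma : ∀ c a x p → c ℤ.* a ℤ.* x ℤ.+ c ℤ.* p ≡ c ℤ.* (a ℤ.* x ℤ.+ p)
  lemma = solve 4 (λ c a x p → c :* a :* x :+ c :* p := c :* (a :* x :+ p)) refl

eval-const : ∀ {m} c (ρ : Vec ℤ m) → eval (const c) ρ ≡ c
eval-const c []      = refl
eval-const {suc zero} c (x ∷ [])  = trans (ℤₚ.+-identityˡ c) refl
eval-const {suc (suc m)} c (x ∷ ρ) = trans (ℤₚ.+-identityˡ _) (eval-const c ρ)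

unit : ∀ {m} → Fin m → Form m
unit zero    = 1ℤ ∷ const 0ℤ
unit (suc i) = 0ℤ ∷ unit i

eval-∷ : ∀ {m} a (f : Form m) x ρ → eval (a ∷ f) (x ∷ ρ) ≡ a ℤ.* x ℤ.+ eval f ρ
eval-∷ a (b ∷ f) x ρ = refl

eval-unit : ∀ {m} i (ρ : Vec ℤ m) → eval (unit i) ρ ≡ lookup ρ i
eval-unit zero    (x ∷ ρ) = trans (eval-∷ 1ℤ (const 0ℤ) x ρ)
  (trans (cong₂ ℤ._+_ (ℤₚ.*-identityˡ x) (eval-const 0ℤ ρ)) (ℤₚ.+-identityʳ x))
eval-unit (suc i) (x ∷ ρ) = trans (eval-∷ 0ℤ (unit i) x ρ)
  (trans (ℤₚ.+-identityˡ _) (eval-unit i ρ))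

-- Fourier–Motzkin elimination of the first variable.
Bounds : ℕ → Set
Bounds m = List (ℕ × Form m)

lowers uppers : ∀ {m} → List (Form (suc m)) → Bounds m
lowers []                       = []
lowers ((+ suc a ∷ f) ∷ fs)     = (suc a , f) ∷ lowers fs
lowers ((_ ∷ f) ∷ fs)           = lowers fs
uppers []                       = []
uppers ((-[1+ a ] ∷ f) ∷ fs)    = (suc a , f) ∷ uppers fs
uppers ((_ ∷ f) ∷ fs)           = uppers fs

frees : ∀ {m} → List (Form (suc m)) → List (Form m)
frees []                   = []
frees ((+ zero ∷ f) ∷ fs)  = f ∷ frees fs
frees (_ ∷ fs)             = frees fs

-- From a x + f ≥ 0 and - b x + g ≥ 0, the multipliers b and a cancel x. `Bounds` stores the
-- absolute values a and b.
resolve : ∀ {m} → ℕ × Form m → ℕ × Form m → Form m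
resolve (a , f) (b , g) = (+ b) ⊙ f ⊕ (+ a) ⊙ g

resolveAll : ∀ {m} → Bounds m → Bounds m → List (Form m)
resolveAll []       us = []
resolveAll (l ∷ ls) us = List.map (resolve l) us ++ resolveAll ls us

eliminate : ∀ {m} → List (Form (suc m)) → List (Form m)
eliminate fs = frees fs ++ resolveAll (lowers fs) (uppers fs)

negative : Form 0 → Bool
negative (+ _ ∷ [])      = false
negative (-[1+ _ ] ∷ []) = true

refutes : ∀ {m} → List (Form m) → Bool
refutes {zero}  []       = false
refutes {zero}  (f ∷ fs) = negative f ∨ refutes fs
refutes {suc m} fs       = refutes (eliminate fs)

module _ {m} (x : ℤ) (ρ : Vec ℤ m) where

  Lower Upper : ℕ × Form m → Set
  Lower (a , f) = 0ℤ ℤ.≤ + a ℤ.* x ℤ.+ eval f ρ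
  Upper (a , f) = 0ℤ ℤ.≤ ℤ.- + a ℤ.* x ℤ.+ eval f ρ

  lowers-sound : ∀ fs → All (Holds (x ∷ ρ)) fs → All Lower (lowers fs)
  lowers-sound []                              []       = []
  lowers-sound ((+ zero ∷ _ ∷ _) ∷ fs)   (h ∷ hs) = lowers-sound fs hs
  lowers-sound ((+ suc a ∷ _ ∷ _) ∷ fs)  (holds h ∷ hs) = h ∷ lowers-sound fs hs
  lowers-sound ((-[1+ _ ] ∷ _ ∷ _) ∷ fs) (h ∷ hs) = lowers-sound fs hs

  uppers-sound : ∀ fs → All (Holds (x ∷ ρ)) fs → All Upper (uppers fs)
  uppers-sound []                              []       = []
  uppers-sound ((+ _ ∷ _ ∷ _) ∷ fs)      (h ∷ hs) = uppers-sound fs hs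
  uppers-sound ((-[1+ _ ] ∷ _ ∷ _) ∷ fs) (holds h ∷ hs) = h ∷ uppers-sound fs hs

  frees-sound : ∀ fs → All (Holds (x ∷ ρ)) fs → All (Holds ρ) (frees fs)
  frees-sound []                              []       = []
  frees-sound ((+ zero ∷ f@(_ ∷ _)) ∷ fs) (holds h ∷ hs) =
    holds (subst (0ℤ ℤ.≤_) (ℤₚ.+-identityˡ (eval f ρ)) h) ∷ frees-sound fs hs
  frees-sound ((+ suc a ∷ _ ∷ _) ∷ fs)  (h ∷ hs) = frees-sound fs hs
  frees-sound ((-[1+ _ ] ∷ _ ∷ _) ∷ fs) (h ∷ hs) = frees-sound fs hs

  resolve-sound : ∀ l u → Lower l → Upper u → Holds ρ (resolve l u)
  resolve-sound (a , f) (b , g) hl hu = holds (subst (0ℤ ℤ.≤_) (sym eq)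
    (ℤₚ.+-mono-≤ (scaled b hl) (scaled a hu)))
    where
    scaled : ∀ c {y} → 0ℤ ℤ.≤ y → 0ℤ ℤ.≤ + c ℤ.* y
    scaled c {y} h = subst (ℤ._≤ + c ℤ.* y) (ℤₚ.*-zeroʳ (+ c)) (ℤₚ.*-monoˡ-≤-nonNeg (+ c) h)
    open ℤ-Solver
    lemma : ∀ a b x p q → b ℤ.* p ℤ.+ a ℤ.* q ≡ b ℤ.* (a ℤ.* x ℤ.+ p) ℤ.+ a ℤ.* (ℤ.- b ℤ.* x ℤ.+ q)
    lemma = solve 5 (λ a b x p q → b :* p :+ a :* q := b :* (a :* x :+ p) :+ a :* (:- b :* x :+ q)) refl
    eq : eval (resolve (a , f) (b , g)) ρ ≡
         + b ℤ.* (+ a ℤ.* x ℤ.+ eval f ρ) ℤ.+ + a ℤ.* (ℤ.- + b ℤ.* x ℤ.+ eval g ρ)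
    eq = trans (eval-⊕ ((+ b) ⊙ f) ((+ a) ⊙ g) ρ)
         (trans (cong₂ ℤ._+_ (eval-⊙ (+ b) f ρ) (eval-⊙ (+ a) g ρ))
           (lemma (+ a) (+ b) x (eval f ρ) (eval g ρ)))

  resolveAll-sound : ∀ ls us → All Lower ls → All Upper us → All (Holds ρ) (resolveAll ls us)
  resolveAll-sound []       us []       hus = []
  resolveAll-sound (l ∷ ls) us (hl ∷ hls) hus = ++⁺ (row us hus) (resolveAll-sound ls us hls hus)
    where
    row : ∀ us → All Upper us → All (Holds ρ) (List.map (resolve l) us)
    row []       []         = []
    row (u ∷ us) (hu ∷ hus) = resolve-sound l u hl hu ∷ row us hus

-- Every derived form is a combination of given ones with nonnegative coefficients, hence holds
-- where they do; a negative constant cannot hold.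
refutes-sound : ∀ {m} (fs : List (Form m)) → T (refutes fs) → ∀ ρ → All (Holds ρ) fs → ⊥
refutes-sound {zero} ((+ _ ∷ []) ∷ fs)      r [] (h ∷ hs) = refutes-sound fs r [] hs
refutes-sound {zero} ((-[1+ _ ] ∷ []) ∷ fs) r [] (holds () ∷ hs)
refutes-sound {suc m} fs r (x ∷ ρ) hs = refutes-sound (eliminate fs) r ρ
  (++⁺ (frees-sound x ρ fs hs)
       (resolveAll-sound x ρ (lowers fs) (uppers fs) (lowers-sound x ρ fs hs) (uppers-sound x ρ fs hs)))

-- Integrality enters here: the failure of 0 ≤ f is sharpened to 0 ≤ -1 - f.
neg : ∀ {m} → Form m → Form m
neg f = const (ℤ.- 1ℤ) ⊖ f

excluded-middle : ∀ {m} (f : Form m) ρ → Holds ρ f ⊎ Holds ρ (neg f)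
excluded-middle f ρ with 0ℤ ℤ.≤? eval f ρ
... | yes h = inj₁ (holds h)
... | no ¬h = inj₂ (holds (subst (0ℤ ℤ.≤_) (sym eq) (ℤₚ.i≤j⇒0≤j-i (ℤₚ.i<j⇒i≤pred[j] (ℤₚ.≰⇒> ¬h)))))
  where
  eq : eval (neg f) ρ ≡ ℤ.pred 0ℤ ℤ.- eval f ρ
  eq = trans (eval-⊖ (const (ℤ.- 1ℤ)) f ρ)
         (cong (ℤ._- eval f ρ) (eval-const (ℤ.- 1ℤ) ρ))

entails : ∀ {m} → List (Form m) → List (Form m) → Bool
entails fs []       = true
entails fs (g ∷ gs) = refutes (neg g ∷ fs) ∧ entails fs gs

entails-sound : ∀ {m} (fs gs : List (Form m)) → T (entails fs gs) → ∀ ρ →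
                All (Holds ρ) fs → All (Holds ρ) gs
entails-sound fs []       e ρ hs = []
entails-sound fs (g ∷ gs) e ρ hs with Equivalence.to T-∧ e | excluded-middle g ρ
... | r , e′ | inj₁ h  = h ∷ entails-sound fs gs e′ ρ hs
... | r , e′ | inj₂ ¬h = ⊥-elim (refutes-sound (neg g ∷ fs) r ρ (¬h ∷ hs))

substitute : ∀ {m p} → Vec (Form p) m → Form m → Form p
substitute []      (c ∷ [])     = const c
substitute (g ∷ σ) (a ∷ b ∷ as) = a ⊙ g ⊕ substitute σ (b ∷ as)

eval-substitute : ∀ {m p} (f : Form m) (σ : Vec (Form p) m) ρ →
  eval (substitute σ f) ρ ≡ eval f (Vec.map (λ g → eval g ρ) σ)
eval-substitute (c ∷ [])     []      ρ = eval-const c ρ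
eval-substitute (a ∷ b ∷ as) (g ∷ σ) ρ = trans (eval-⊕ (a ⊙ g) (substitute σ (b ∷ as)) ρ)
  (cong₂ ℤ._+_ (eval-⊙ a g ρ) (eval-substitute (b ∷ as) σ ρ))

-- Search for edges by the degrees of their ends

-- The order of the variables is the order in which they are eliminated.
𝐌₀ 𝐌₁ 𝐌₂ 𝐌₃ 𝐪 𝐤 𝐭 𝐧 : Form 7
𝐌₀ = unit (# 0)
𝐌₃ = unit (# 1)
𝐌₁ = unit (# 2)
𝐌₂ = unit (# 3)
𝐪  = unit (# 4)
𝐤  = unit (# 5)
𝐭  = unit (# 6)

num : ℕ → Form 7
num c = const (+ c)

infixl 7 _•_
_•_ : ℕ → Form 7 → Form 7
c • f = (+ c) ⊙ f

-- The order is no variable of its own; n + k = 5 t + 1 expresses it through the parameters.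
𝐧 = 5 • 𝐭 ⊕ num 1 ⊖ 𝐤

-- The number of vertices of degree d.
𝐜 : ℕ → Form 7
𝐜 0 = 𝐌₀
𝐜 1 = 𝐌₁ ⊖ 𝐌₀
𝐜 2 = 𝐌₂ ⊖ 𝐌₁
𝐜 3 = 𝐌₃ ⊖ 𝐌₂
𝐜 _ = 𝐧 ⊖ 𝐌₃

total : (ℕ → ℕ) → Form 7
total g = g 0 • 𝐜 0 ⊕ (g 1 • 𝐜 1 ⊕ (g 2 • 𝐜 2 ⊕ (g 3 • 𝐜 3 ⊕ g 4 • 𝐜 4)))

slope : ∀ {m} → Form m → Vec ℤ m → ℤ
slope (c ∷ [])     []      = 0ℤ
slope (a ∷ b ∷ as) (x ∷ δ) = a ℤ.* x ℤ.+ slope (b ∷ as) δ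

-- A move by a fixed vector adds a constant to a form. So a claim about the edge set after several
-- moves is an inequality about the original one, and all claims can be compared at a single point.
shift : ∀ {m} → Vec ℤ m → Form m → Form m
shift δ f = f ⊕ const (slope f δ)

eval-shift : ∀ {m} (f : Form m) (ρ δ : Vec ℤ m) → eval (shift δ f) ρ ≡ eval f (zipWith ℤ._+_ ρ δ)
eval-shift f ρ δ = trans (eval-⊕ f (const (slope f δ)) ρ)
  (trans (cong (λ z → eval f ρ ℤ.+ z) (eval-const (slope f δ) ρ)) (go f ρ δ))
  where
  open ℤ-Solver
  lemma : ∀ a x e p s → a ℤ.* x ℤ.+ p ℤ.+ (a ℤ.* e ℤ.+ s) ≡ a ℤ.* (x ℤ.+ e) ℤ.+ (p ℤ.+ s)
  lemma = solve 5 (λ a x e p s → a :* x :+ p :+ (a :* e :+ s) := a :* (x :+ e) :+ (p :+ s)) refl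
  go : ∀ {m} (f : Form m) ρ δ → eval f ρ ℤ.+ slope f δ ≡ eval f (zipWith ℤ._+_ ρ δ)
  go (c ∷ [])     []      []      = ℤₚ.+-identityʳ c
  go (a ∷ b ∷ as) (x ∷ ρ) (e ∷ δ) =
    trans (lemma a x e (eval (b ∷ as) ρ) (slope (b ∷ as) δ)) (cong (λ z → a ℤ.* (x ℤ.+ e) ℤ.+ z) (go (b ∷ as) ρ δ))

all₄ : (ℕ → Bool) → Bool
all₄ P = P 0 ∧ P 1 ∧ P 2 ∧ P 3

all₄-sound : ∀ P → T (all₄ P) → ∀ {x} → x < 4 → T (P x)
all₄-sound P h {x} x<4 = select x x<4
  where
  h₁ : T (P 1 ∧ P 2 ∧ P 3)
  h₁ = proj₂ (Equivalence.to (T-∧ {P 0}) h)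
  h₂ : T (P 2 ∧ P 3)
  h₂ = proj₂ (Equivalence.to (T-∧ {P 1}) h₁)
  select : ∀ x → x < 4 → T (P x)
  select 0 _ = proj₁ (Equivalence.to (T-∧ {P 0}) h)
  select 1 _ = proj₁ (Equivalence.to (T-∧ {P 1}) h₁)
  select 2 _ = proj₁ (Equivalence.to (T-∧ {P 2}) h₂)
  select 3 _ = proj₂ (Equivalence.to (T-∧ {P 2}) h₂)
  select (suc (suc (suc (suc _)))) (s≤s (s≤s (s≤s (s≤s ()))))

Types : Set
Types = List (ℕ × ℕ)

elem : ℕ → ℕ → Types → Bool
elem i j []              = false
elem i j ((i′ , j′) ∷ W) = ((i ≡ᵇ i′) ∧ (j ≡ᵇ j′)) ∨ elem i j W

-- The least degree of an end of an edge on the side b.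
low : Bool → ℕ
low true  = 1
low false = 0

-- A pair of end degrees is harmless if it respects the weights, or welcome if it is one of the
-- types sought.
permitted : Types → (φ ψ : ℕ → ℕ) → ℕ → ℕ → Bool
permitted W φ ψ i j = (φ i + φ j ≤ᵇ ψ i + ψ j) ∨ (elem i j W ∨ elem j i W)

covers : Bool → Types → (φ ψ : ℕ → ℕ) → Bool
covers b W φ ψ = all₄ λ x → all₄ λ y → permitted W φ ψ (low b + x) (low b + y)

module Counting {n m : ℕ} (G : Simple4 n m) (q k t : ℕ) (size : n + k ≡ 5 * t + 1) where
  open Graphs G public

  ρ : EdgeSet → Vec ℤ 7
  ρ H = + M 0 H ∷ + M 3 H ∷ + M 1 H ∷ + M 2 H ∷ + q ∷ + k ∷ + t ∷ []

  module _ (H : EdgeSet) where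
    private
      w : Vec ℤ 7
      w = ρ H
      m₀ m₁ m₂ m₃ : ℤ
      m₀ = + M 0 H
      m₁ = + M 1 H
      m₂ = + M 2 H
      m₃ = + M 3 H
      E₀ : eval 𝐌₀ w ≡ m₀
      E₀ = eval-unit (# 0) (ρ H)
      E₁ : eval 𝐌₁ w ≡ m₁
      E₁ = eval-unit (# 2) (ρ H)
      E₂ : eval 𝐌₂ w ≡ m₂
      E₂ = eval-unit (# 3) (ρ H)
      E₃ : eval 𝐌₃ w ≡ m₃
      E₃ = eval-unit (# 1) (ρ H)

    eval-𝐧 : eval 𝐧 w ≡ + n
    eval-𝐧 = begin
      eval 𝐧 w ≡⟨ eval-⊖ (5 • 𝐭 ⊕ num 1) 𝐤 w ⟩
      eval (5 • 𝐭 ⊕ num 1) w ℤ.- eval 𝐤 w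
        ≡⟨ cong₂ ℤ._-_ (trans (eval-⊕ (5 • 𝐭) (num 1) w)
             (cong₂ ℤ._+_ (trans (eval-⊙ (+ 5) 𝐭 w) (cong (+ 5 ℤ.*_) (eval-unit (# 6) (ρ H)))) (eval-const (+ 1) w)))
             (eval-unit (# 5) (ρ H)) ⟩
      + 5 ℤ.* + t ℤ.+ + 1 ℤ.- + k ≡⟨ cong (λ z → z ℤ.+ + 1 ℤ.- + k) (ℤₚ.pos-* 5 t) ⟨
      + (5 * t + 1) ℤ.- + k ≡⟨ cong (λ z → + z ℤ.- + k) size ⟨
      + n ℤ.+ + k ℤ.- + k ≡⟨ lemma (+ n) (+ k) ⟩
      + n ∎
      where
      open ≡-Reasoning
      open ℤ-Solver
      lemma : ∀ x y → x ℤ.+ y ℤ.- y ≡ x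
      lemma = solve 2 (λ x y → x :+ y :- y := x) refl

    eval-total : ∀ g → eval (total g) w ≡ + (∑[ v < n ] g (deg H v))
    eval-total g = trans expand (sym (solve-for (+ (∑[ v < n ] g (deg H v))) cast))
      where
      open ℤ-Solver
      gg : ℕ → ℤ
      gg i = + g i
      scaled : ∀ i f x → eval f w ≡ x → eval (g i • f) w ≡ gg i ℤ.* x
      scaled i f x eq = trans (eval-⊙ (gg i) f w) (cong (gg i ℤ.*_) eq)
      plus : ∀ f h {x y} → eval f w ≡ x → eval h w ≡ y → eval (f ⊕ h) w ≡ x ℤ.+ y
      plus f h p r = trans (eval-⊕ f h w) (cong₂ ℤ._+_ p r)
      minus : ∀ f h {x y} → eval f w ≡ x → eval h w ≡ y → eval (f ⊖ h) w ≡ x ℤ.- y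
      minus f h p r = trans (eval-⊖ f h w) (cong₂ ℤ._-_ p r)
      N : ℤ
      N = + n
      r₁ r₂ r₃ : Form 7
      r₃ = g 3 • 𝐜 3 ⊕ g 4 • 𝐜 4
      r₂ = g 2 • 𝐜 2 ⊕ r₃
      r₁ = g 1 • 𝐜 1 ⊕ r₂
      expand : eval (total g) w ≡ gg 0 ℤ.* m₀ ℤ.+ (gg 1 ℤ.* (m₁ ℤ.- m₀) ℤ.+ (gg 2 ℤ.* (m₂ ℤ.- m₁) ℤ.+ (gg 3 ℤ.* (m₃ ℤ.- m₂) ℤ.+ gg 4 ℤ.* (N ℤ.- m₃))))
      expand = plus (g 0 • 𝐜 0) r₁ (scaled 0 (𝐜 0) m₀ E₀)
        (plus (g 1 • 𝐜 1) r₂ (scaled 1 (𝐜 1) _ (minus 𝐌₁ 𝐌₀ E₁ E₀))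
        (plus (g 2 • 𝐜 2) r₃ (scaled 2 (𝐜 2) _ (minus 𝐌₂ 𝐌₁ E₂ E₁))
        (plus (g 3 • 𝐜 3) (g 4 • 𝐜 4) (scaled 3 (𝐜 3) _ (minus 𝐌₃ 𝐌₂ E₃ E₂))
          (scaled 4 (𝐜 4) _ (minus 𝐧 𝐌₃ eval-𝐧 E₃)))))
      cast : + (∑[ v < n ] g (deg H v)) ℤ.+ (gg 1 ℤ.* m₀ ℤ.+ (gg 2 ℤ.* m₁ ℤ.+ (gg 3 ℤ.* m₂ ℤ.+ gg 4 ℤ.* m₃)))
           ≡ gg 0 ℤ.* m₀ ℤ.+ (gg 1 ℤ.* m₁ ℤ.+ (gg 2 ℤ.* m₂ ℤ.+ (gg 3 ℤ.* m₃ ℤ.+ gg 4 ℤ.* N)))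
      cast rewrite sym (ℤₚ.pos-* (g 1) (M 0 H)) | sym (ℤₚ.pos-* (g 2) (M 1 H)) | sym (ℤₚ.pos-* (g 3) (M 2 H)) | sym (ℤₚ.pos-* (g 4) (M 3 H))
                 | sym (ℤₚ.pos-* (g 0) (M 0 H)) | sym (ℤₚ.pos-* (g 1) (M 1 H)) | sym (ℤₚ.pos-* (g 2) (M 2 H)) | sym (ℤₚ.pos-* (g 3) (M 3 H)) | sym (ℤₚ.pos-* (g 4) n)
        = cong +_ (tally H g)
      solve-for : ∀ s → s ℤ.+ (gg 1 ℤ.* m₀ ℤ.+ (gg 2 ℤ.* m₁ ℤ.+ (gg 3 ℤ.* m₂ ℤ.+ gg 4 ℤ.* m₃)))
           ≡ gg 0 ℤ.* m₀ ℤ.+ (gg 1 ℤ.* m₁ ℤ.+ (gg 2 ℤ.* m₂ ℤ.+ (gg 3 ℤ.* m₃ ℤ.+ gg 4 ℤ.* N)))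
        → s ≡ gg 0 ℤ.* m₀ ℤ.+ (gg 1 ℤ.* (m₁ ℤ.- m₀) ℤ.+ (gg 2 ℤ.* (m₂ ℤ.- m₁) ℤ.+ (gg 3 ℤ.* (m₃ ℤ.- m₂) ℤ.+ gg 4 ℤ.* (N ℤ.- m₃))))
      solve-for s eq = trans (lemma s A) (trans (cong (ℤ._- A) eq) (lemma₂ (gg 0) (gg 1) (gg 2) (gg 3) (gg 4) m₀ m₁ m₂ m₃ N))
        where
        A : ℤ
        A = gg 1 ℤ.* m₀ ℤ.+ (gg 2 ℤ.* m₁ ℤ.+ (gg 3 ℤ.* m₂ ℤ.+ gg 4 ℤ.* m₃))
        lemma : ∀ x y → x ≡ x ℤ.+ y ℤ.- y
        lemma = solve 2 (λ x y → x := x :+ y :- y) refl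
        lemma₂ : ∀ a b c d e x y z u v →
          a ℤ.* x ℤ.+ (b ℤ.* y ℤ.+ (c ℤ.* z ℤ.+ (d ℤ.* u ℤ.+ e ℤ.* v))) ℤ.- (b ℤ.* x ℤ.+ (c ℤ.* y ℤ.+ (d ℤ.* z ℤ.+ e ℤ.* u)))
          ≡ a ℤ.* x ℤ.+ (b ℤ.* (y ℤ.- x) ℤ.+ (c ℤ.* (z ℤ.- y) ℤ.+ (d ℤ.* (u ℤ.- z) ℤ.+ e ℤ.* (v ℤ.- u))))
        lemma₂ = solve 10 (λ a b c d e x y z u v →
          a :* x :+ (b :* y :+ (c :* z :+ (d :* u :+ e :* v))) :- (b :* x :+ (c :* y :+ (d :* z :+ e :* u)))
          := a :* x :+ (b :* (y :- x) :+ (c :* (z :- y) :+ (d :* (u :- z) :+ e :* (v :- u))))) refl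

    ≤-total-form : ∀ g h → ∑[ v < n ] g (deg H v) ≤ ∑[ v < n ] h (deg H v) → Holds w (total g ≼ total h)
    ≤-total-form g h le = holds (subst (0ℤ ℤ.≤_) (sym (trans (eval-⊖ (total h) (total g) w) (cong₂ ℤ._-_ (eval-total h) (eval-total g))))
      (ℤₚ.i≤j⇒0≤j-i (ℤ.+≤+ le)))

  count-form : ∀ H c g → c ≤ ∑[ v < n ] g (deg H v) → Holds (ρ H) (num c ≼ total g)
  count-form H c g le = holds (subst (0ℤ ℤ.≤_) (sym (trans (eval-⊖ (total g) (num c) (ρ H))
    (cong₂ ℤ._-_ (eval-total H g) (eval-const (+ c) (ρ H))))) (ℤₚ.i≤j⇒0≤j-i (ℤ.+≤+ le)))

  record Edge (b : Bool) (H : EdgeSet) (i j : ℕ) : Set where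
    constructor mkEdge
    field
      e    : Fin m
      u v  : Fin n
      link : Link e u v
      in-b : H e ≡ b
      du   : deg H u ≡ i
      dv   : deg H v ≡ j

    on-u : On u e
    on-u with link
    ... | inj₁ (p , _) = inj₁ p
    ... | inj₂ (_ , p) = inj₂ p

    on-v : On v e
    on-v with link
    ... | inj₁ (_ , p) = inj₂ p
    ... | inj₂ (p , _) = inj₁ p

    u≢v : u ≢ v
    u≢v with link
    ... | inj₁ (p , r) = λ eq → loopless e (trans p (trans eq (sym r)))
    ... | inj₂ (p , r) = λ eq → loopless e (trans p (trans (sym eq) (sym r)))

  swap : ∀ {b H i j} → Edge b H i j → Edge b H j i
  swap E = mkEdge e v u (Sum.swap link) in-b dv du
    where open Edge E

  Found : Bool → EdgeSet → Types → Set
  Found b H W = Any (λ (i , j) → Edge b H i j) W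

  locate : ∀ {b H i j} W → T (elem i j W) → Edge b H i j → Found b H W
  locate {i = i} {j} ((i′ , j′) ∷ W) h E with (i ≡ᵇ i′) ∧ (j ≡ᵇ j′) in eq
  ... | false = there (locate W h E)
  ... | true with Equivalence.to (T-∧ {i ≡ᵇ i′}) (subst T (sym eq) _)
  ... | p , r = here (subst₂ (Edge _ _) (≡ᵇ⇒≡ i i′ p) (≡ᵇ⇒≡ j j′ r) E)

  side-true : ∀ b {H : EdgeSet} {e} → H e ≡ b → side b H e ≡ true
  side-true true  p = p
  side-true false p rewrite p = refl

  side-false : ∀ b {H : EdgeSet} {e} → H e ≢ b → side b H e ≡ false
  side-false true  {H} {e} p with H e
  ... | true  = contradiction refl p
  ... | false = refl
  side-false false {H} {e} p with H e
  ... | true  = refl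
  ... | false = contradiction refl p

  share-positive : ∀ b {H e v} → On v e → H e ≡ b → 1 ≤ share b (deg H v)
  share-positive b {H} {e} {v} on p = subst (1 ≤_) (deg-side b H v)
    (subst (_≤ deg (side b H) v) (cong₂ (λ i s → i * χ s) (inc-on on) (side-true b {H} p))
      (∑-term (λ e → inc e v * χ (side b H e)) e))

  end-degree : ∀ b {H e v} → On v e → H e ≡ b → ∃ λ x → x < 4 × deg H v ≡ low b + x
  end-degree true {H} {e} {v} on p with deg H v | deg≤4 H v | share-positive true {H} on p
  ... | suc x | x≤ | _ = x , x≤ , refl
  end-degree false {H} {e} {v} on p with deg H v | share-positive false {H} on p
  ... | x | h = x , room x h , refl
    where
    room : ∀ x → 1 ≤ 4 ∸ x → x < 4
    room 0 _ = s≤s z≤n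
    room 1 _ = s≤s (s≤s z≤n)
    room 2 _ = s≤s (s≤s (s≤s z≤n))
    room 3 _ = s≤s (s≤s (s≤s (s≤s z≤n)))
    room (suc (suc (suc (suc x)))) h = contradiction (subst (1 ≤_) (m≤n⇒m∸n≡0 {0} {x} z≤n) h) λ ()

  -- A vertex of degree `d` is an end of `share b d` edges of the side `b`, so this is its
  -- contribution when `φ` is summed over the ends of those edges.
  weighted : Bool → (ℕ → ℕ) → ℕ → ℕ
  weighted b φ d = share b d * φ d

  gap : Bool → (φ ψ : ℕ → ℕ) → Form 7
  gap b φ ψ = total (weighted b φ) ≼ total (weighted b ψ)

  edge-weight : ∀ b H (φ : ℕ → ℕ) → ∑[ v < n ] (share b (deg H v) * φ (deg H v))
    ≡ ∑[ e < m ] (χ (side b H e) * (φ (deg H (src e)) + φ (deg H (tgt e))))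
  edge-weight b H φ = begin
    ∑[ v < n ] (share b (deg H v) * φ (deg H v))
      ≡⟨ sum-cong-≗ (λ v → cong (_* φ (deg H v)) (deg-side b H v)) ⟨
    ∑[ v < n ] (deg (side b H) v * φ (deg H v))
      ≡⟨ sum-cong-≗ (λ v → *-distribʳ-sum (φ (deg H v)) (λ e → inc e v * χ (side b H e))) ⟩
    ∑[ v < n ] ∑[ e < m ] (inc e v * χ (side b H e) * φ (deg H v))
      ≡⟨ sum-cong-≗ (λ v → sum-cong-≗ (λ e → *-assoc (inc e v) (χ (side b H e)) (φ (deg H v)))) ⟩
    ∑[ v < n ] ∑[ e < m ] (inc e v * (χ (side b H e) * φ (deg H v)))
      ≡⟨ handshake (λ e v → χ (side b H e) * φ (deg H v)) ⟩
    _ ≡⟨ sum-cong-≗ (λ e → *-distribˡ-+ (χ (side b H e)) _ _) ⟨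
    ∑[ e < m ] (χ (side b H e) * (φ (deg H (src e)) + φ (deg H (tgt e)))) ∎
    where open ≡-Reasoning

  -- The alternative edge by edge. `search` sums it over all edges, `fan` uses it to charge single
  -- edges.
  lookout : ∀ b H W (φ ψ : ℕ → ℕ) → T (covers b W φ ψ) → Found b H W ⊎
    (∀ e → H e ≡ b → φ (deg H (src e)) + φ (deg H (tgt e)) ≤ ψ (deg H (src e)) + ψ (deg H (tgt e)))
  lookout b H W φ ψ c with any? (λ e → (H e ≟ᵇ b) ×-dec
      ((ψ (deg H (src e)) + ψ (deg H (tgt e))) <? (φ (deg H (src e)) + φ (deg H (tgt e)))))
  ... | no none = inj₂ λ e p → ≮⇒≥ λ lt → none (e , p , lt)
  ... | yes (e , p , lt)
    with x , x<4 , eqx ← end-degree b {H} {e} {src e} (inj₁ refl) p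
       | y , y<4 , eqy ← end-degree b {H} {e} {tgt e} (inj₂ refl) p
    = inj₁ (conclude (Equivalence.to T-∨ (all₄-sound (λ y → permitted W φ ψ (low b + x) (low b + y))
        (all₄-sound (λ x → all₄ λ y → permitted W φ ψ (low b + x) (low b + y)) c x<4) y<4)))
    where
    E : Edge b H (low b + x) (low b + y)
    E = mkEdge e (src e) (tgt e) (inj₁ (refl , refl)) p eqx eqy
    conclude : T (φ (low b + x) + φ (low b + y) ≤ᵇ ψ (low b + x) + ψ (low b + y))
             ⊎ T (elem (low b + x) (low b + y) W ∨ elem (low b + y) (low b + x) W) → Found b H W
    conclude (inj₁ le) = contradiction (≤ᵇ⇒≤ _ _ le) (<⇒≱ (subst₂ (λ i j → ψ i + ψ j < φ i + φ j) eqx eqy lt))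
    conclude (inj₂ h) with Equivalence.to T-∨ h
    ... | inj₁ w = locate W w E
    ... | inj₂ w = locate W w (swap E)

  -- Double counting: unless an edge of one of the types in W exists, every edge on the
  -- side b has ψ-weight at least its φ-weight, and so have the two total weights.
  search : ∀ b H W φ ψ → T (covers b W φ ψ) → Found b H W ⊎ Holds (ρ H) (gap b φ ψ)
  search b H W φ ψ c with lookout b H W φ ψ c
  ... | inj₁ found = inj₁ found
  ... | inj₂ none  = inj₂ (≤-total-form H (weighted b φ) (weighted b ψ)
    (subst₂ _≤_ (sym (edge-weight b H φ)) (sym (edge-weight b H ψ)) (∑-mono λ e → bound e)))
    where
    bound : ∀ e → χ (side b H e) * (φ (deg H (src e)) + φ (deg H (tgt e)))
                ≤ χ (side b H e) * (ψ (deg H (src e)) + ψ (deg H (tgt e)))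
    bound e with H e ≟ᵇ b
    ... | yes p = *-monoʳ-≤ (χ (side b H e)) (none e p)
    ... | no ¬p rewrite side-false b {H} ¬p = z≤n

  -- Moves and their effect on the counts

  record At (H : EdgeSet) (δ : Vec ℤ 7) (H′ : EdgeSet) : Set where
    constructor mkAt
    field
      moved : ρ H′ ≡ zipWith ℤ._+_ (ρ H) δ

  Ctx : EdgeSet → List (Form 7) → Set
  Ctx H Γ = All (Holds (ρ H)) Γ

  offsets : (ℕ → ℤ) → Vec ℤ 7
  offsets x = x 0 ∷ x 3 ∷ x 1 ∷ x 2 ∷ 0ℤ ∷ 0ℤ ∷ 0ℤ ∷ []

  -- An end of degree i lowers `M i` when its edge is added, and raises M (i - 1) when its edge is
  -- deleted.
  addΔ delΔ : ℕ → ℕ → Vec ℤ 7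
  addΔ i j = offsets λ d → ℤ.- + (χ (i ≡ᵇ d) + χ (j ≡ᵇ d))
  delΔ i j = offsets λ d → + (χ (i ≡ᵇ suc d) + χ (j ≡ᵇ suc d))

  at-offsets : ∀ {H H′} x → (∀ d → + M d H′ ≡ + M d H ℤ.+ x d) → At H (offsets x) H′
  at-offsets x h = mkAt (cong₂ _∷_ (h 0) (cong₂ _∷_ (h 3) (cong₂ _∷_ (h 1) (cong₂ _∷_ (h 2)
    (cong₂ _∷_ (sym (ℤₚ.+-identityʳ _)) (cong₂ _∷_ (sym (ℤₚ.+-identityʳ _)) (cong₂ _∷_ (sym (ℤₚ.+-identityʳ _)) refl)))))))

  at-refl : ∀ {H} → At H (offsets λ _ → 0ℤ) H
  at-refl = at-offsets (λ _ → 0ℤ) λ d → sym (ℤₚ.+-identityʳ _)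

  infixl 5 _⨾_
  _⨾_ : ∀ {H δ H′ ε H″} → At H δ H′ → At H′ ε H″ → At H (zipWith ℤ._+_ δ ε) H″
  _⨾_ {H} {δ} {ε = ε} (mkAt p) (mkAt r) = mkAt (trans r (trans (cong (λ z → zipWith ℤ._+_ z ε) p)
    (zipWith-assoc ℤₚ.+-assoc (ρ H) δ ε)))

  with-edge without-edge : ∀ {b H i j} → Edge b H i j → EdgeSet
  with-edge    {H = H} E = set (Edge.e E) true H
  without-edge {H = H} E = set (Edge.e E) false H

  module _ {H : EdgeSet} {i j : ℕ} where

    private
      ends : ∀ {b} (E : Edge b H i j) (f : ℕ → ℕ) → f (deg H (src (Edge.e E))) + f (deg H (tgt (Edge.e E))) ≡ f i + f j
      ends (mkEdge e u v (inj₁ (refl , refl)) _ du dv) f = cong₂ (λ a b → f a + f b) du dv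
      ends (mkEdge e u v (inj₂ (refl , refl)) _ du dv) f =
        trans (cong₂ (λ a b → f a + f b) dv du) (+-comm (f j) (f i))

    add : (E : Edge false H i j) → At H (addΔ i j) (with-edge E)
    add E = at-offsets {H} (λ d → ℤ.- + (χ (i ≡ᵇ d) + χ (j ≡ᵇ d))) λ d → cancel d (trans (cong (λ z → M d (with-edge E) + z) (sym (ends E (λ a → χ (a ≡ᵇ d)))))
        (M-adds (insert (Edge.in-b E)) d))
      where
      lemma : ∀ x y → x ≡ x ℤ.+ y ℤ.+ ℤ.- y
      lemma = solve 2 (λ x y → x := x :+ y :+ :- y) refl where open ℤ-Solver
      cancel : ∀ d {x} → M d (with-edge E) + x ≡ M d H → + M d (with-edge E) ≡ + M d H ℤ.+ ℤ.- + x
      cancel d {x} eq = trans (lemma (+ M d (with-edge E)) (+ x)) (cong (λ z → + z ℤ.+ ℤ.- + x) eq)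

    del : (E : Edge true H i j) → At H (delΔ i j) (without-edge E)
    del E = at-offsets {H} (λ d → + (χ (i ≡ᵇ suc d) + χ (j ≡ᵇ suc d))) λ d → cong +_ (trans (sym (M-adds a d)) (cong (λ z → M d H + z) (trans
        (cong₂ _+_ (cong (λ z → χ (z ≡ᵇ suc d)) (up (inj₁ refl))) (cong (λ z → χ (z ≡ᵇ suc d)) (up (inj₂ refl))))
        (ends E (λ z → χ (z ≡ᵇ suc d))))))
      where
      a : Adds (without-edge E) (Edge.e E) H
      a = delete (Edge.in-b E)
      up : ∀ {v} → On v (Edge.e E) → suc (deg (without-edge E) v) ≡ deg H v
      up {v} on = trans (+-comm 1 _) (sym (trans (deg-adds a v) (cong (λ z → deg (without-edge E) v + z) (inc-on on))))

  module _ {H i₀ j₀} (A : Edge false H i₀ j₀) where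
    private
      e₀ = Edge.e A
      a = insert {H} (Edge.in-b A)

    after-add : ∀ {b i j} (E : Edge b H i j) → e₀ ≢ Edge.e E →
      Edge b (with-edge A) (i + inc e₀ (Edge.u E)) (j + inc e₀ (Edge.v E))
    after-add (mkEdge e u v l p du dv) e₀≢e = mkEdge e u v l (trans (Adds.others a e₀≢e) p)
      (trans (deg-adds a u) (cong (λ z → z + inc e₀ u) du)) (trans (deg-adds a v) (cong (λ z → z + inc e₀ v) dv))

  untouched : ∀ {b H i j w} (A : Edge b H i j) → Edge.u A ≢ w → Edge.v A ≢ w → inc (Edge.e A) w ≡ 0
  untouched A u≢ v≢ with Edge.link A
  ... | inj₁ (refl , refl) = inc-off u≢ v≢
  ... | inj₂ (refl , refl) = inc-off v≢ u≢

  -- Two edges whose end degrees have no value in common share no vertex, so toggling one leaves the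
  -- type of the other unchanged.
  apart : ℕ → ℕ → ℕ → ℕ → Bool
  apart i j i′ j′ = not (i ≡ᵇ i′) ∧ not (i ≡ᵇ j′) ∧ not (j ≡ᵇ i′) ∧ not (j ≡ᵇ j′)

  module _ {b b′ H i j i₀ j₀} (A : Edge b′ H i₀ j₀) (E : Edge b H i j) (h : T (apart i j i₀ j₀)) where
    private
      differ : ∀ {v w a c} → T (not (a ≡ᵇ c)) → deg H v ≡ a → deg H w ≡ c → v ≢ w
      differ {a = a} h refl refl refl = subst (λ z → T (not z)) (Equivalence.to T-≡ (≡⇒≡ᵇ a a refl)) h

      h₁ = Equivalence.to (T-∧ {not (i ≡ᵇ i₀)}) h
      h₂ = Equivalence.to (T-∧ {not (i ≡ᵇ j₀)}) (proj₂ h₁)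
      h₃ = Equivalence.to (T-∧ {not (j ≡ᵇ i₀)}) (proj₂ h₂)

      off-u : inc (Edge.e A) (Edge.u E) ≡ 0
      off-u = untouched A (differ (proj₁ h₁) (Edge.du E) (Edge.du A) ∘ sym) (differ (proj₁ h₂) (Edge.du E) (Edge.dv A) ∘ sym)
      off-v : inc (Edge.e A) (Edge.v E) ≡ 0
      off-v = untouched A (differ (proj₁ h₃) (Edge.dv E) (Edge.du A) ∘ sym) (differ (proj₂ h₃) (Edge.dv E) (Edge.dv A) ∘ sym)
      other : Edge.e A ≢ Edge.e E
      other eq = contradiction (trans (sym off-u) (subst (λ e → inc e (Edge.u E) ≡ 1) (sym eq) (inc-on (Edge.on-u E)))) λ ()

    keep-set : ∀ c → (∀ w → inc (Edge.e A) w ≡ 0 → deg (set (Edge.e A) c H) w ≡ deg H w) → Edge b (set (Edge.e A) c H) i j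
    keep-set c d = record { Edge E
      ; in-b = trans (set-other c H other) (Edge.in-b E)
      ; du = trans (d _ off-u) (Edge.du E) ; dv = trans (d _ off-v) (Edge.dv E) }

  keep-add : ∀ {b H i j i₀ j₀} (A : Edge false H i₀ j₀) (E : Edge b H i j) {h : T (apart i j i₀ j₀)} → Edge b (with-edge A) i j
  keep-add {H = H} A E {h} = keep-set A E h true λ w off →
    trans (deg-adds (insert (Edge.in-b A)) w) (trans (cong (λ z → deg H w + z) off) (+-identityʳ _))

  keep-del : ∀ {b H i j i₀ j₀} (A : Edge true H i₀ j₀) (E : Edge b H i j) {h : T (apart i j i₀ j₀)} → Edge b (without-edge A) i j
  keep-del A E {h} = keep-set A E h false λ w off →
    sym (trans (deg-adds (delete (Edge.in-b A)) w) (trans (cong (λ z → deg (without-edge A) w + z) off) (+-identityʳ _)))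

  -- Fans

  deg∈ : List ℕ → ℕ → ℕ
  deg∈ []      d = 0
  deg∈ (i ∷ D) d = if d ≡ᵇ i then 1 else deg∈ D d

  -- After the left edge has been added the centre has degree i + 1. Adding both edges therefore
  -- takes only one from `M i`, where two disjoint edges would take two; the other unit comes from M
  -- (i + 1).
  record Fan (H : EdgeSet) (i j : ℕ) : Set where
    field
      left right : Edge false H i j
      centre     : Edge.u left ≡ Edge.u right
      distinct   : Edge.e left ≢ Edge.e right

  fan-right : ∀ {H i j} (F : Fan H i j) → Edge false (with-edge (Fan.left F)) (suc i) j
  fan-right {H} {i} {j} F = subst₂ (Edge false _) (trans (cong (λ z → i + z) at-u) (+-comm i 1))
      (trans (cong (λ z → j + z) at-v) (+-identityʳ j)) (after-add left right distinct)
    where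
    open Fan F
    at-u : inc (Edge.e left) (Edge.u right) ≡ 1
    at-u = inc-on (subst (λ w → On w (Edge.e left)) centre (Edge.on-u left))
    -- The far ends differ, since otherwise the two edges would be parallel.
    at-v : inc (Edge.e left) (Edge.v right) ≡ 0
    at-v with on? (Edge.v right) (Edge.e left)
    ... | inj₂ (s≢ , t≢) = inc-off s≢ t≢
    ... | inj₁ on = contradiction (simple (Edge.u≢v right) (subst (λ w → On w (Edge.e left)) centre (Edge.on-u left)) on
                      (Edge.on-u right) (Edge.on-v right)) distinct

  fan-gap : ℕ → ℕ → Form 7
  fan-gap i j = total (weighted false (deg∈ (j ∷ []))) ≼ total (deg∈ (i ∷ []))

  -- If no edge of a type in `W` exists, all edges missing at vertices of degree `j` lead to
  -- vertices of degree `i`. Unless two of them meet at such a vertex, their number (4 - j) · c j is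
  -- at most c i.
  fan : ∀ H i j W → T (not (i ≡ᵇ j)) → T (covers false W (deg∈ (j ∷ [])) (deg∈ (i ∷ []))) →
        Found false H W ⊎ (Fan H i j ⊎ Holds (ρ H) (fan-gap i j))
  fan H i j W i≢j c with lookout false H W (deg∈ (j ∷ [])) (deg∈ (i ∷ [])) c
  ... | inj₁ found = inj₁ found
  ... | inj₂ none = inj₂ choose
    where
    φ ψ : Fin n → ℕ
    φ v = deg∈ (j ∷ []) (deg H v)
    ψ v = deg∈ (i ∷ []) (deg H v)

    f : Fin m → ℕ
    f e = χ (∁ H e) * (φ (src e) + φ (tgt e))

    reach : Fin n → ℕ
    reach w = ∑[ e < m ] (inc e w * f e)

    indicator : ∀ i d → deg∈ (i ∷ []) d ≡ χ (d ≡ᵇ i)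
    indicator i d with d ≡ᵇ i
    ... | true  = refl
    ... | false = refl

    at-degree : ∀ i d → 1 ≤ deg∈ (i ∷ []) d → d ≡ i
    at-degree i d h with d ≡ᵇ i in eq
    ... | true  = ≡ᵇ⇒≡ d i (subst T (sym eq) _)
    ... | false = contradiction h λ ()

    ≤1 : ∀ i d → deg∈ (i ∷ []) d ≤ 1
    ≤1 i d rewrite indicator i d with d ≡ᵇ i
    ... | true  = s≤s z≤n
    ... | false = z≤n

    centre-φ : ∀ {w} → deg H w ≡ i → φ w ≡ 0
    centre-φ {w} refl rewrite indicator j (deg H w) with deg H w ≡ᵇ j
    ... | false = refl

    module _ {w} (dw : deg H w ≡ i) where
      f≤1 : ∀ e → inc e w * f e ≤ 1
      f≤1 e with on? w e
      ... | inj₂ (s≢ , t≢) rewrite inc-off s≢ t≢ = z≤n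
      ... | inj₁ on rewrite inc-on on | +-identityʳ (f e) = *-mono-≤ {χ (∁ H e)} {1} {_} {1} (χ≤1 (∁ H e)) (one on)
        where
        one : On w e → φ (src e) + φ (tgt e) ≤ 1
        one (inj₁ refl) rewrite centre-φ dw = ≤1 j (deg H (tgt e))
        one (inj₂ refl) rewrite centre-φ dw | +-identityʳ (φ (src e)) = ≤1 j (deg H (src e))

      edge : ∀ e → 1 ≤ inc e w * f e → Σ[ E ∈ Edge false H i j ] (Edge.u E ≡ w × Edge.e E ≡ e)
      edge e h with on? w e
      ... | inj₂ (s≢ , t≢) = contradiction (subst (λ z → 1 ≤ z * f e) (inc-off s≢ t≢) h) λ ()
      edge e h | inj₁ on with H e in eq
      ... | true  = contradiction (subst (1 ≤_) (*-zeroʳ (inc e w)) h) λ ()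
      edge e h | inj₁ (inj₁ refl) | false = mkEdge e (src e) (tgt e) (inj₁ (refl , refl)) eq dw
        (at-degree j _ (positive h)) , refl , refl
        where
        positive : 1 ≤ inc e (src e) * (φ (src e) + φ (tgt e) + 0) → 1 ≤ φ (tgt e)
        positive h rewrite inc-src e | centre-φ dw | +-identityʳ (φ (tgt e)) | +-identityʳ (φ (tgt e)) = h
      edge e h | inj₁ (inj₂ refl) | false = mkEdge e (tgt e) (src e) (inj₂ (refl , refl)) eq dw
        (at-degree j _ (positive h)) , refl , refl
        where
        positive : 1 ≤ inc e (tgt e) * (φ (src e) + φ (tgt e) + 0) → 1 ≤ φ (src e)
        positive h rewrite inc-tgt e | centre-φ dw | +-identityʳ (φ (src e)) | +-identityʳ (φ (src e)) | +-identityʳ (φ (src e)) = h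

    choose : Fan H i j ⊎ Holds (ρ H) (fan-gap i j)
    choose with any? (λ w → (deg H w ≟ⁿ i) ×-dec (2 ≤? reach w))
    ... | yes (w , dw , h)
      with e₁ , e₂ , e₁≢e₂ , h₁ , h₂ ← ∑-exists-two (λ e → inc e w * f e) (f≤1 dw) h
      with E₁ , refl , refl ← edge dw e₁ h₁ | E₂ , p₂ , refl ← edge dw e₂ h₂
      = inj₁ (record { left = E₁ ; right = E₂ ; centre = sym p₂ ; distinct = e₁≢e₂ })
    ... | no few = inj₂ (≤-total-form H (weighted false (deg∈ (j ∷ []))) (deg∈ (i ∷ [])) (begin
      ∑[ v < n ] (share false (deg H v) * φ v)
        ≡⟨ edge-weight false H (deg∈ (j ∷ [])) ⟩
      ∑[ e < m ] f e
        ≤⟨ ∑-mono pay ⟩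
      ∑[ e < m ] (f e * ψ (src e) + f e * ψ (tgt e))
        ≡⟨ handshake (λ e v → f e * ψ v) ⟨
      ∑[ v < n ] ∑[ e < m ] (inc e v * (f e * ψ v))
        ≡⟨ sum-cong-≗ (λ v → sum-cong-≗ (λ e → *-assoc (inc e v) (f e) (ψ v))) ⟨
      ∑[ v < n ] ∑[ e < m ] (inc e v * f e * ψ v)
        ≡⟨ sum-cong-≗ (λ v → *-distribʳ-sum (ψ v) (λ e → inc e v * f e)) ⟨
      ∑[ v < n ] (reach v * ψ v)
        ≤⟨ ∑-mono receive ⟩
      ∑[ v < n ] ψ v ∎))
      where
      open ≤-Reasoning
      receive : ∀ v → reach v * ψ v ≤ ψ v
      receive v with deg H v ≟ⁿ i
      ... | yes dv = ≤-trans (*-monoˡ-≤ (ψ v) (s≤s⁻¹ (≰⇒> λ h → few (v , dv , h)))) (≤-reflexive (+-identityʳ (ψ v)))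
      ... | no ¬dv with ψ v in eq
      ...   | zero = ≤-reflexive (*-zeroʳ (reach v))
      ...   | suc _ = contradiction (at-degree i (deg H v) (subst (1 ≤_) (sym eq) (s≤s z≤n))) ¬dv
      -- An edge of positive weight has an end of degree `i` by `none` and is charged there;
      -- `receive` allows each such vertex one charge.
      pay : ∀ e → f e ≤ f e * ψ (src e) + f e * ψ (tgt e)
      pay e with H e in eq
      ... | true  = z≤n
      ... | false with φ (src e) + φ (tgt e) in eqφ | none e eq
      ...   | zero  | _ = z≤n
      ...   | suc x | h = ≤-trans (m≤m*n (suc x + 0) (ψ (src e) + ψ (tgt e)) {{>-nonZero (≤-trans (s≤s z≤n) h)}})
                            (≤-reflexive (*-distribˡ-+ (suc x + 0) (ψ (src e)) (ψ (tgt e))))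

  by-cases : ∀ {A : Set} H f → (Holds (ρ H) f → A) → (Holds (ρ H) (neg f) → A) → A
  by-cases H f yes-case no-case = [ yes-case , no-case ]′ (excluded-middle f (ρ H))

  impossible : ∀ {A : Set} {H} Γ → Ctx H Γ → {T (refutes Γ)} → A
  impossible {H = H} Γ ctx {r} = ⊥-elim (refutes-sound Γ r (ρ H) ctx)

  forth : ∀ {H δ H′} → At H δ H′ → ∀ f → Holds (ρ H′) f → Holds (ρ H) (shift δ f)
  forth {H} {δ} (mkAt moved) f (holds h) = holds (subst (0ℤ ℤ.≤_) (sym (trans (eval-shift f (ρ H) δ) (cong (eval f) (sym moved)))) h)

  back : ∀ {H δ H′} → At H δ H′ → ∀ f → Holds (ρ H) (shift δ f) → Holds (ρ H′) f
  back {H} {δ} (mkAt moved) f (holds h) = holds (subst (0ℤ ℤ.≤_) (trans (eval-shift f (ρ H) δ) (cong (eval f) (sym moved))) h)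

  finish : ∀ {H δ H′ Γ} gs → Ctx H Γ → At H δ H′ → {T (entails Γ (List.map (shift δ) gs))} → Ctx H′ gs
  finish {H} {δ} {H′} {Γ} gs ctx a {c} = all gs (entails-sound Γ (List.map (shift δ) gs) c (ρ H) ctx)
    where
    all : ∀ gs → All (Holds (ρ H)) (List.map (shift δ) gs) → Ctx H′ gs
    all []       []       = []
    all (g ∷ gs) (h ∷ hs) = back a g h ∷ all gs hs

  look : ∀ {H δ H′} → At H δ H′ → ∀ b W φ ψ → {T (covers b W φ ψ)} →
         Found b H′ W ⊎ Holds (ρ H) (shift δ (gap b φ ψ))
  look {H′ = H′} a b W φ ψ {c} = [ inj₁ , inj₂ ∘ forth a (gap b φ ψ) ]′ (search b H′ W φ ψ c)

  pick : ∀ {H δ H′ Γ} → Ctx H Γ → At H δ H′ → ∀ b W φ ψ → {T (covers b W φ ψ)} →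
         {T (refutes (shift δ (gap b φ ψ) ∷ Γ))} → Found b H′ W
  pick {δ = δ} {Γ = Γ} ctx a b W φ ψ {c} {r} =
    [ id , (λ h → impossible (shift δ (gap b φ ψ) ∷ Γ) (h ∷ ctx) {r}) ]′ (look a b W φ ψ {c})

-- Local search

below-zero : ℤ → Bool
below-zero (+ _)    = false
below-zero -[1+ _ ] = true

-- The fourth inequality expresses `5 ≤ n`.
params : List (Form 7)
params = (num 1 ≼ 𝐭) ∷ (num 0 ≼ 𝐤) ∷ (𝐤 ≼ num 4) ∷ (𝐤 ⊕ num 4 ≼ 5 • 𝐭) ∷ (𝐪 ≼ 4 • 𝐭) ∷ (𝐪 ≼ 𝐧) ∷ []

base : List (Form 7)
base = (num 0 ≼ 𝐜 0) ∷ (num 0 ≼ 𝐜 1) ∷ (num 0 ≼ 𝐜 2) ∷ (num 0 ≼ 𝐜 3) ∷ (num 0 ≼ 𝐜 4) ∷ params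

W₁ W₂ : List (Form 7)
W₁ = (2 • 𝐭 ≼ 𝐌₁) ∷ (𝐌₁ ≼ 2 • 𝐭 ⊕ num 1) ∷ []
W₂ = (3 • 𝐭 ≼ 𝐌₂) ∷ (𝐌₂ ≼ 3 • 𝐭 ⊕ num 1) ∷ []

-- The counts of the complement: M d (∁ H) = n − M (3 − d) H.
mirror : Vec (Form 7) 7
mirror = (𝐧 ⊖ 𝐌₃) ∷ (𝐧 ⊖ 𝐌₀) ∷ (𝐧 ⊖ 𝐌₂) ∷ (𝐧 ⊖ 𝐌₁) ∷ 𝐪 ∷ 𝐤 ∷ 𝐭 ∷ []

-- q is the lower bound aimed at for M 3, namely 4 t or n, whichever is smaller.
module Search {n m : ℕ} (G : Simple4 n m) (q k t : ℕ) (size : n + k ≡ 5 * t + 1)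
  (1≤t : 1 ≤ t) (k≤4 : k ≤ 4) (k+4≤5t : k + 4 ≤ 5 * t) (q≤4t : q ≤ 4 * t) (q≤n : q ≤ n) where
  open Counting G q k t size public

  private
    pos-neg : ∀ {f : Form 7} {a b H} → eval f (ρ H) ≡ + b ℤ.- + a → a ≤ b → Holds (ρ H) f
    pos-neg eq le = holds (subst (0ℤ ℤ.≤_) (sym eq) (ℤₚ.i≤j⇒0≤j-i (ℤ.+≤+ le)))

  params-hold : ∀ H → Ctx H params
  params-hold H = pos-neg (ev (num 1) 𝐭 (eval-const (+ 1) (ρ H)) et) 1≤t
      ∷ pos-neg (ev (num 0) 𝐤 (eval-const (+ 0) (ρ H)) ek) z≤n
      ∷ pos-neg (ev 𝐤 (num 4) ek (eval-const (+ 4) (ρ H))) k≤4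
      ∷ pos-neg (ev (𝐤 ⊕ num 4) (5 • 𝐭) (trans (eval-⊕ 𝐤 (num 4) (ρ H)) (cong₂ ℤ._+_ ek (eval-const (+ 4) (ρ H)))) (multiple 5)) k+4≤5t
      ∷ pos-neg (ev 𝐪 (4 • 𝐭) eq (multiple 4)) q≤4t
      ∷ pos-neg (ev 𝐪 𝐧 eq (eval-𝐧 H)) q≤n ∷ []
    where
    et : eval 𝐭 (ρ H) ≡ + t
    et = eval-unit (# 6) (ρ H)
    ek : eval 𝐤 (ρ H) ≡ + k
    ek = eval-unit (# 5) (ρ H)
    eq : eval 𝐪 (ρ H) ≡ + q
    eq = eval-unit (# 4) (ρ H)
    multiple : ∀ c → eval (c • 𝐭) (ρ H) ≡ + (c * t)
    multiple c = trans (eval-⊙ (+ c) 𝐭 (ρ H)) (trans (cong (+ c ℤ.*_) et) (sym (ℤₚ.pos-* c t)))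
    ev : ∀ f g {a b} → eval f (ρ H) ≡ + a → eval g (ρ H) ≡ + b → eval (f ≼ g) (ρ H) ≡ + b ℤ.- + a
    ev f g p r = trans (eval-⊖ g f (ρ H)) (cong₂ ℤ._-_ r p)

  base-holds : ∀ H → Ctx H base
  base-holds H = class 0 ∷ class 1 ∷ class 2 ∷ class 3 ∷ class 4 ∷ params-hold H
    where
    class : ∀ i → Holds (ρ H) (total (λ _ → 0) ≼ total (deg∈ (i ∷ [])))
    class i = ≤-total-form H (λ _ → 0) (deg∈ (i ∷ [])) (∑-mono {n} {λ _ → 0} {λ v → deg∈ (i ∷ []) (deg H v)} λ v → z≤n)

  toggleΔ : Bool → ℕ → ℕ → Vec ℤ 7
  toggleΔ false = addΔ
  toggleΔ true  = delΔ

  toggled : ∀ {b H i j} (E : Edge b H i j) → At H (toggleΔ b i j) (set (Edge.e E) (not b) H)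
  toggled {false} E = add E
  toggled {true}  E = del E

  added : ∀ {H i j} (E : Edge false H i j) → Edge true (with-edge E) (suc i) (suc j)
  added {H} {i} {j} E = record { Edge E
    ; in-b = set-self e true H
    ; du = trans (deg-adds (insert in-b) u) (trans (cong₂ _+_ du (inc-on on-u)) (+-comm i 1))
    ; dv = trans (deg-adds (insert in-b) v) (trans (cong₂ _+_ dv (inc-on on-v)) (+-comm j 1)) }
    where open Edge E

  -- Local search: every move preserves the inequalities I and decreases μ, until stop holds.
  module Descent (I : List (Form 7)) (μ stop : Form 7) where

    improves : List (Form 7) → Vec ℤ 7 → Bool
    improves Γ δ = entails Γ (List.map (shift δ) I) ∧ below-zero (slope μ δ)

    record Progress (H : EdgeSet) : Set where
      constructor progress
      field
        {δ}      : Vec ℤ 7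
        {H′}     : EdgeSet
        move     : At H δ H′
        kept     : Ctx H′ I
        smaller  : T (below-zero (slope μ δ))

    done : ∀ {H δ H′} Γ → Ctx H Γ → At H δ H′ → {T (improves Γ δ)} → Progress H
    done {δ = δ} Γ ctx a {c} = progress a
      (finish I ctx a {proj₁ (Equivalence.to (T-∧ {entails Γ (List.map (shift δ) I)}) c)})
      (proj₂ (Equivalence.to (T-∧ {entails Γ (List.map (shift δ) I)}) c))

    one : ∀ {H δ H′ Γ b i j} → Ctx H Γ → At H δ H′ → Edge b H′ i j →
          {T (improves Γ (zipWith ℤ._+_ δ (toggleΔ b i j)))} → Progress H
    one {Γ = Γ} ctx a E {c} = done Γ ctx (a ⨾ toggled E) {c}

    improvesAll : List (Form 7) → Vec ℤ 7 → Bool → Types → Bool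
    improvesAll Γ δ b []            = true
    improvesAll Γ δ b ((i , j) ∷ W) = improves Γ (zipWith ℤ._+_ δ (toggleΔ b i j)) ∧ improvesAll Γ δ b W

    close : ∀ {H δ H′ Γ b W} → Ctx H Γ → At H δ H′ → Found b H′ W → {T (improvesAll Γ δ b W)} → Progress H
    close {δ = δ} {Γ = Γ} {b} {(i , j) ∷ W} ctx a (here E) {c} =
      one ctx a E {proj₁ (Equivalence.to (T-∧ {improves Γ (zipWith ℤ._+_ δ (toggleΔ b i j))}) c)}
    close {δ = δ} {Γ = Γ} {b} {(i , j) ∷ W} ctx a (there E) {c} =
      close ctx a E {proj₂ (Equivalence.to (T-∧ {improves Γ (zipWith ℤ._+_ δ (toggleΔ b i j))}) c)}

    strike : ∀ {H δ H′ Γ} → Ctx H Γ → At H δ H′ → ∀ b W φ ψ → {T (covers b W φ ψ)} →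
             {T (refutes (shift δ (gap b φ ψ) ∷ Γ))} → {T (improvesAll Γ δ b W)} → Progress H
    strike ctx a b W φ ψ {c} {r} {i} = close ctx a (pick ctx a b W φ ψ {c} {r}) {i}

    below : ∀ {H H′ δ} → At H δ H′ → T (below-zero (slope μ δ)) → eval μ (ρ H′) ℤ.< eval μ (ρ H)
    below {H} {H′} {δ} (mkAt moved) c = subst (ℤ._< eval μ (ρ H))
      (trans (sym (trans (eval-⊕ μ (const (slope μ δ)) (ρ H)) (cong (λ z → eval μ (ρ H) ℤ.+ z) (eval-const (slope μ δ) (ρ H)))))
        (trans (eval-shift μ (ρ H) δ) (cong (eval μ) (sym moved))))
      (lt (slope μ δ) c)
      where
      lt : ∀ s → T (below-zero s) → eval μ (ρ H) ℤ.+ s ℤ.< eval μ (ρ H)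
      lt -[1+ s ] _ = subst (eval μ (ρ H) ℤ.+ -[1+ s ] ℤ.<_) (ℤₚ.+-identityʳ _) (ℤₚ.+-monoʳ-< (eval μ (ρ H)) ℤ.-<+)

    Step : Set
    Step = ∀ H → Ctx H (neg stop ∷ I ++ base) → Progress H

    -- The invariants force `μ` to be nonnegative, so its value bounds the number of moves.
    run : {T (entails (I ++ base) (μ ∷ []))} → Step → ∀ H → Ctx H I → ∃ λ H′ → Ctx H′ (stop ∷ I)
    run {c} step H ctx = go ℤ.∣ eval μ (ρ H) ∣ H (ℤₚ.≤-reflexive (sym (ℤₚ.0≤i⇒+∣i∣≡i (nonneg H ctx)))) ctx
      where
      nonneg : ∀ H → Ctx H I → 0ℤ ℤ.≤ eval μ (ρ H)
      nonneg H ctx = Holds.nonneg (All.head (entails-sound (I ++ base) (μ ∷ []) c (ρ H) (++⁺ ctx (base-holds H))))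
      go : ∀ N H → eval μ (ρ H) ℤ.≤ + N → Ctx H I → ∃ λ H′ → Ctx H′ (stop ∷ I)
      next : ∀ N H → eval μ (ρ H) ℤ.≤ + N → Progress H → ∃ λ H′ → Ctx H′ (stop ∷ I)
      go N H le ctx = by-cases H stop (λ h → H , h ∷ ctx) (λ h → next N H le (step H (h ∷ ++⁺ ctx (base-holds H))))
      next zero    H le (progress {H′ = H′} move kept smaller) =
        contradiction (ℤₚ.<-≤-trans (below move smaller) le) (ℤₚ.≤⇒≯ (nonneg H′ kept))
      next (suc N) H le (progress {H′ = H′} move kept smaller) =
        go N H′ (ℤₚ.i<j⇒i≤pred[j] (ℤₚ.<-≤-trans (below move smaller) le)) kept

  -- Bring M 2 into its window from below.
  module Lower where
    -- An additional invariant that depends on how the cut was obtained: `true` for an even `Good`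
    -- set, `false` for an odd one.
    X : Bool → Form 7
    X true  = 2 • 𝐭 ≼ 𝐌₀
    X false = 𝐌₃ ≼ 𝐌₀ ⊕ 𝐌₂

    I : Bool → List (Form 7)
    I x = X x ∷ (𝐭 ≼ 𝐌₀) ∷ (𝐌₂ ≼ 3 • 𝐭 ⊕ num 1) ∷ W₁

    -- The sum of all degrees, which every deletion lowers by two.
    μ : Form 7
    μ = 4 • 𝐧 ⊖ (𝐌₀ ⊕ 𝐌₁ ⊕ 𝐌₂ ⊕ 𝐌₃)

    module D (x : Bool) = Descent (I x) μ (3 • 𝐭 ≼ 𝐌₂)

    step : ∀ x → D.Step x
    -- Ends of degree 2 are avoided, as deletions there would raise `M 1`. If every edge had such an
    -- end, the few vertices of degree 2 would have to absorb all edges at degrees 1, 3 and 4.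
    step true H ctx = D.strike true ctx at-refl true
      ((1 , 1) ∷ (1 , 3) ∷ (1 , 4) ∷ (3 , 3) ∷ (3 , 4) ∷ (4 , 4) ∷ []) (deg∈ (1 ∷ 3 ∷ 4 ∷ [])) (deg∈ (2 ∷ []))
    -- Deleting a (4 , 4) edge raises `M 3` by two against `X false`. It is done only when the other
    -- types are absent; `few` then bounds the vertices of degree 3 and leaves room.
    step false H ctx = [ D.close false ctx at-refl
      , (λ few → D.strike false (few ∷ ctx) at-refl true ((4 , 4) ∷ []) (deg∈ (4 ∷ [])) (deg∈ (1 ∷ 2 ∷ 3 ∷ []))) ]′
      (look {H} at-refl true ((1 , 1) ∷ (1 , 3) ∷ (1 , 4) ∷ (3 , 3) ∷ (3 , 4) ∷ []) (deg∈ (1 ∷ 3 ∷ [])) (deg∈ (2 ∷ [])))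

    lower : ∀ x H → Ctx H (I x) → ∃ λ H′ → Ctx H′ ((3 • 𝐭 ≼ 𝐌₂) ∷ I x)
    lower true  = D.run true (step true)
    lower false = D.run false (step false)

  none : ℕ → ℕ
  none = deg∈ []

  -- Bring M 2 into its window from above.
  module Raise where
    -- As long as M 2 ≥ 3 t + 2, the relations with `M 0` give M 0 ≥ t + 1 and M 3 ≤ M 0 + 3 t, so a
    -- vertex of degree 0 can be spent.
    I : List (Form 7)
    I = (3 • 𝐭 ≼ 𝐌₂) ∷ (𝐌₂ ⊕ 𝐌₃ ≼ 𝐌₀ ⊕ 6 • 𝐭 ⊕ num 2) ∷ (𝐌₃ ≼ 𝐌₀ ⊕ 3 • 𝐭 ⊕ num 1)
      ∷ (𝐌₂ ≼ 𝐌₀ ⊕ 2 • 𝐭 ⊕ num 1) ∷ (𝐭 ≼ 𝐌₀) ∷ W₁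

    stop : Form 7
    stop = 𝐌₂ ≼ 3 • 𝐭 ⊕ num 1

    open Descent I 𝐌₂ stop

    narrow : ∀ {H} → Ctx H ((𝐌₁ ≼ 2 • 𝐭) ∷ neg stop ∷ I ++ base) → Fan H 1 2 → Progress H
    narrow {H} ctx F = choose (pick ctx both true ((2 , 3) ∷ (2 , 1) ∷ (2 , 2) ∷ (2 , 4) ∷ []) (deg∈ (2 ∷ [])) none)
      where
      right : Edge false (with-edge (Fan.left F)) 2 2
      right = fan-right F
      both : At H _ (with-edge right)
      both = add (Fan.left F) ⨾ add right
      -- The fan lowers `M 1` by one and `M 2` by three. A deletion at (2 , 3) returns `M 1` and one
      -- unit of `M 2`. With any other type `M 2` could end up too low, so the right edge is taken
      -- out again; its ends have degree 3, hence it is disjoint from the edge found.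
      left-only : At H _ (without-edge (added right))
      left-only = both ⨾ del (added right)
      choose : Found true (with-edge right) ((2 , 3) ∷ (2 , 1) ∷ (2 , 2) ∷ (2 , 4) ∷ []) → Progress H
      choose (here E)                         = one ctx both E
      choose (there (here E))                 = one ctx left-only (keep-del (added right) E)
      choose (there (there (here E)))         = one ctx left-only (keep-del (added right) E)
      choose (there (there (there (here E)))) = one ctx left-only (keep-del (added right) E)

    step : Step
    step H ctx = by-cases H (2 • 𝐭 ⊕ num 1 ≼ 𝐌₁)
      (λ h → strike (h ∷ ctx) at-refl false ((2 , 0) ∷ (2 , 1) ∷ (2 , 2) ∷ (2 , 3) ∷ []) (deg∈ (2 ∷ [])) none)
      (λ h → tight (finish-here h))
      where
      Γ : List (Form 7)
      Γ = (𝐌₁ ≼ 2 • 𝐭) ∷ neg stop ∷ I ++ base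
      finish-here : Holds (ρ H) (neg (2 • 𝐭 ⊕ num 1 ≼ 𝐌₁)) → Ctx H Γ
      finish-here h = h ∷ ctx
      tight : Ctx H Γ → Progress H
      tight ctx = [ (λ f → close ctx at-refl f) , [ narrow ctx , (λ few → impossible (fan-gap 1 2 ∷ Γ) (few ∷ ctx)) ]′ ]′
        (fan H 1 2 ((2 , 0) ∷ (2 , 2) ∷ (2 , 3) ∷ []) _ _)

    raise : ∀ H → Ctx H I → ∃ λ H′ → Ctx H′ (stop ∷ I)
    raise = run step

  by-degree : ∀ {H v w i j} → deg H v ≡ i → deg H w ≡ j → i ≢ j → v ≢ w
  by-degree p r i≢j refl = i≢j (trans (sym p) r)

  same-end : ∀ {b b′ H i j i′ j′} (E : Edge b H i j) (E′ : Edge b′ H i′ j′) →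
    Edge.e E ≡ Edge.e E′ → Edge.u E ≡ Edge.u E′ → Edge.v E ≡ Edge.v E′
  same-end E E′ refl refl with Edge.link E | Edge.link E′
  ... | inj₁ (_ , p) | inj₁ (_ , r) = trans (sym p) r
  ... | inj₂ (p , _) | inj₂ (r , _) = trans (sym p) r
  ... | inj₁ (p , _) | inj₂ (_ , r) = contradiction (trans p (sym r)) (loopless _)
  ... | inj₂ (_ , p) | inj₁ (r , _) = contradiction (trans r (sym p)) (loopless _)

  -- A vertex of degree 3 has a single edge outside H.
  lonely : ∀ {H i j} (E : Edge false H 3 i) (E′ : Edge false H 3 j) → i ≢ j → Edge.u E ≢ Edge.u E′
  lonely {H} E E′ i≢j same with Edge.e E ≟ Edge.e E′
  ... | yes eq = by-degree (Edge.dv E) (Edge.dv E′) i≢j (same-end E E′ eq same)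
  ... | no ≢e = contradiction two λ { (s≤s ()) }
    where
    u : Fin n
    u = Edge.u E
    f : Fin m → ℕ
    f e = inc e u * χ (∁ H e)
    counted : ∀ {e} → On u e → H e ≡ false → f e ≡ 1
    counted on p rewrite inc-on on | p = refl
    two : 2 ≤ 1
    two = subst₂ _≤_
      (cong₂ _+_ (counted (Edge.on-u E) (Edge.in-b E)) (counted (subst (λ w → On w (Edge.e E′)) (sym same) (Edge.on-u E′)) (Edge.in-b E′)))
      (trans (deg-side false H u) (cong (λ d → 4 ∸ d) (Edge.du E))) (∑-two-terms f ≢e)

  nonempty : ∀ {b H i j} → Edge b H i j → Holds (ρ H) (total (λ d → χ (d ≡ᵇ i)) ⊖ num 1)
  nonempty {H = H} {i} E = subst (Holds (ρ H)) refl (count-form H 1 (λ d → χ (d ≡ᵇ i))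
    (≤-trans (≤-reflexive (sym (trans (cong (λ d → χ (d ≡ᵇ i)) (Edge.du E)) (cong χ (Equivalence.to T-≡ (≡⇒≡ᵇ i i refl))))))
      (∑-term (λ v → χ (deg H v ≡ᵇ i)) (Edge.u E))))

  -- Bring M 3 below its upper bound, trading vertices of degree 0 for vertices of degree 4.
  module Fill where
    -- The second inequality keeps (3 , 0) available: M 3 ≥ 4 t + 2 forces M 0 ≥ t + 1.
    I : List (Form 7)
    I = (𝐭 ≼ 𝐌₀) ∷ (𝐌₃ ≼ 𝐌₀ ⊕ 3 • 𝐭 ⊕ num 1) ∷ W₁ ++ W₂

    stop : Form 7
    stop = 𝐌₃ ≼ 4 • 𝐭 ⊕ num 1

    open Descent I 𝐌₃ stop

    -- A count at the upper end of its window may fall but not rise; otherwise it stands at the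
    -- lower end and may rise but not fall.
    full₁ full₂ : Form 7
    full₁ = 2 • 𝐭 ⊕ num 1 ≼ 𝐌₁
    full₂ = 3 • 𝐭 ⊕ num 1 ≼ 𝐌₂

    Γ : List (Form 7) → List (Form 7)
    Γ fs = fs ++ neg stop ∷ I ++ base

    Γ₀₀ Γ₀₁ Γ₁₀ Γ₁₁ : List (Form 7)
    Γ₀₀ = Γ (neg full₁ ∷ neg full₂ ∷ [])
    Γ₀₁ = Γ (neg full₁ ∷ full₂ ∷ [])
    Γ₁₀ = Γ (full₁ ∷ neg full₂ ∷ [])
    Γ₁₁ = Γ (full₁ ∷ full₂ ∷ [])

    case₁₁ : ∀ {H} → Ctx H Γ₁₁ → Progress H
    case₁₁ ctx = strike ctx at-refl false ((3 , 0) ∷ (3 , 1) ∷ (3 , 2) ∷ (3 , 3) ∷ []) (deg∈ (3 ∷ [])) none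

    case₀₁ : ∀ {H} → Ctx H Γ₀₁ → Progress H
    case₀₁ {H} ctx = [ (λ f → close ctx at-refl f) , [ widen , (λ few → impossible (fan-gap 1 3 ∷ Γ₀₁) (few ∷ ctx)) ]′ ]′
        (fan H 1 3 ((3 , 0) ∷ (3 , 2) ∷ (3 , 3) ∷ []) _ _)
      where
      -- The fan lowers `M 1` and `M 2` by one and `M 3` by two. `M 2` can afford this, and a
      -- deletion at degree 2 returns `M 1`.
      widen : Fan H 1 3 → Progress H
      widen F = strike ctx (add (Fan.left F) ⨾ add (fan-right F)) true
        ((2 , 1) ∷ (2 , 2) ∷ (2 , 3) ∷ (2 , 4) ∷ []) (deg∈ (2 ∷ [])) none

    case₁₀ : ∀ {H} → Ctx H Γ₁₀ → Progress H
    case₁₀ {H} ctx = [ (λ f → close ctx at-refl f) , [ widen , (λ few → impossible (fan-gap 2 3 ∷ Γ₁₀) (few ∷ ctx)) ]′ ]′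
        (fan H 2 3 ((3 , 0) ∷ (3 , 1) ∷ (3 , 3) ∷ []) _ _)
      where
      -- The fan lowers `M 2` by one and `M 3` by three. A deletion at degree 3 returns `M 2`; its
      -- other end must not have degree 2, as `M 1` cannot rise.
      widen : Fan H 2 3 → Progress H
      widen F = strike ctx (add (Fan.left F) ⨾ add (fan-right F)) true
        ((3 , 1) ∷ (3 , 3) ∷ (3 , 4) ∷ []) (deg∈ (3 ∷ [])) (deg∈ (2 ∷ []))

    module _ {H} (ctx : Ctx H Γ₀₀) where

      Γ⁺ : List (Form 7)
      Γ⁺ = (num 1 ≼ 𝐜 1) ∷ Γ₀₀

      -- Two edges have been added at vertices of degree 3, lowering M 1 and M 2 by one.
      repair : ∀ {H″} → Holds (ρ H) (num 1 ≼ 𝐜 1) → At H (zipWith ℤ._+_ (addΔ 1 3) (addΔ 2 3)) H″ → Progress H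
      -- A deletion at degree 2 returns `M 1` and one at degree 3 returns `M 2`; a (2 , 3) edge does
      -- both.
      repair {H″} some at = at-two (pick ctx⁺ at true ((2 , 1) ∷ (2 , 2) ∷ (2 , 3) ∷ (2 , 4) ∷ []) (deg∈ (2 ∷ [])) none)
        where
        ctx⁺ : Ctx H Γ⁺
        ctx⁺ = some ∷ ctx
        thirds : ∀ {δ H‴} → At H δ H‴ → {T (refutes (shift δ (gap true (deg∈ (3 ∷ [])) (deg∈ (2 ∷ []))) ∷ Γ⁺))} →
          {T (improvesAll Γ⁺ δ true ((3 , 1) ∷ (3 , 3) ∷ (3 , 4) ∷ []))} → Progress H
        thirds a {r} {c} = strike ctx⁺ a true ((3 , 1) ∷ (3 , 3) ∷ (3 , 4) ∷ []) (deg∈ (3 ∷ [])) (deg∈ (2 ∷ [])) {_} {r} {c}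
        -- Deleting the (2 , 4) edge `F` would return `M 1` but raise `M 3`. It is held back until
        -- an edge at degree 2 replaces it, or an edge disjoint from it returns `M 2` and makes it
        -- affordable.
        at-four : Edge true H″ 2 4 → Found true H″ ((2 , 2) ∷ (2 , 1) ∷ (2 , 3) ∷ (3 , 3) ∷ (3 , 1) ∷ []) → Progress H
        at-four F (here E)                                 = thirds (at ⨾ del E)
        at-four F (there (here E))                         = thirds (at ⨾ del E)
        at-four F (there (there (here E)))                 = one ctx⁺ at E
        at-four F (there (there (there (here E))))         = one ctx⁺ (at ⨾ del E) (keep-del E F)
        at-four F (there (there (there (there (here E))))) = one ctx⁺ (at ⨾ del E) (keep-del E F)
        at-two : Found true H″ ((2 , 1) ∷ (2 , 2) ∷ (2 , 3) ∷ (2 , 4) ∷ []) → Progress H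
        at-two (here E)                         = thirds (at ⨾ del E)
        at-two (there (here E))                 = thirds (at ⨾ del E)
        at-two (there (there (here E)))         = one ctx⁺ at E
        at-two (there (there (there (here E)))) = at-four E (pick ctx⁺ at true
          ((2 , 2) ∷ (2 , 1) ∷ (2 , 3) ∷ (3 , 3) ∷ (3 , 1) ∷ []) (deg∈ (2 ∷ 3 ∷ [])) (deg∈ (4 ∷ [])))

      case₀₀ : Progress H
      case₀₀ = [ ones , [ (λ F → repair (nonempty (Fan.left F)) (add (Fan.left F) ⨾ add (fan-right F)))
                        , (λ few → impossible (fan-gap 1 3 ∷ Γ₀₀) (few ∷ ctx)) ]′ ]′
          (fan H 1 3 ((3 , 0) ∷ (3 , 3) ∷ (3 , 2) ∷ []) _ _)
        where
        -- A vertex of degree 3 has one missing edge, so the two edges have different ends of degree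
        -- 3. Adding both changes the counts exactly as a fan of type 1 3 does.
        both : Edge false H 3 2 → Edge false H 3 1 → Progress H
        both E E′ = repair (nonempty (swap E′)) (add (swap E′) ⨾ add (swap E″))
          where
          apart′ : ∀ {w} → Edge.u E′ ≢ w → Edge.v E′ ≢ w → inc (Edge.e E′) w ≡ 0
          apart′ = untouched E′
          u-off : inc (Edge.e E′) (Edge.u E) ≡ 0
          u-off = apart′ (lonely E′ E λ ()) (by-degree (Edge.dv E′) (Edge.du E) λ ())
          v-off : inc (Edge.e E′) (Edge.v E) ≡ 0
          v-off = apart′ (by-degree (Edge.du E′) (Edge.dv E) λ ()) (by-degree (Edge.dv E′) (Edge.dv E) λ ())
          E″ : Edge false (with-edge (swap E′)) 3 2
          E″ = subst₂ (Edge false _) (cong (λ z → 3 + z) u-off) (cong (λ z → 2 + z) v-off) (after-add (swap E′) E other)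
            where
            other : Edge.e E′ ≢ Edge.e E
            other eq = contradiction (trans (sym u-off) (subst (λ e → inc e (Edge.u E) ≡ 1) (sym eq) (inc-on (Edge.on-u E)))) λ ()
        twos : Edge false H 3 2 → Found false H ((3 , 0) ∷ (3 , 3) ∷ (3 , 1) ∷ []) → Progress H
        twos E (here F)                 = one ctx at-refl F
        twos E (there (here F))         = one ctx at-refl F
        twos E (there (there (here F))) = both E F
        ones : Found false H ((3 , 0) ∷ (3 , 3) ∷ (3 , 2) ∷ []) → Progress H
        ones (here E)                 = one ctx at-refl E
        ones (there (here E))         = one ctx at-refl E
        ones (there (there (here E))) = [ twos E , [ widen , (λ few → impossible (fan-gap 2 3 ∷ Γ₀₀) (few ∷ ctx)) ]′ ]′
            (fan H 2 3 ((3 , 0) ∷ (3 , 3) ∷ (3 , 1) ∷ []) _ _)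
          where
          widen : Fan H 2 3 → Progress H
          widen F = strike ctx (add (Fan.left F) ⨾ add (fan-right F)) true
            ((3 , 1) ∷ (3 , 2) ∷ (3 , 3) ∷ (3 , 4) ∷ []) (deg∈ (3 ∷ [])) none

    step : Step
    step H ctx = by-cases H full₁
      (λ f₁ → by-cases H full₂ (λ f₂ → case₁₁ (f₁ ∷ f₂ ∷ ctx)) (λ f₂ → case₁₀ (f₁ ∷ f₂ ∷ ctx)))
      (λ f₁ → by-cases H full₂ (λ f₂ → case₀₁ (f₁ ∷ f₂ ∷ ctx)) (λ f₂ → case₀₀ (f₁ ∷ f₂ ∷ ctx)))

    fill : ∀ H → Ctx H I → ∃ λ H′ → Ctx H′ (stop ∷ I)
    fill = run step

  zero-outside : ∀ {H x e} → deg H x ≡ 0 → On x e → H e ≡ false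
  zero-outside {H} {x} {e} dx on with H e in eq
  ... | false = refl
  ... | true  = contradiction (subst (1 ≤_) dx (share-positive true {H} on eq)) λ ()

  -- The neighbours of a vertex x of degree 0, when they all have degree 2.
  module Spread {H : EdgeSet} (x y : Fin n) (dx : deg H x ≡ 0) where
    twos : Fin n → Bool
    twos w = (deg H w ≡ᵇ 2) ∧ not (is y w)

    To-y : Set
    To-y = Σ[ E ∈ Edge false H 0 2 ] (Edge.u E ≡ x × Edge.v E ≡ y)

    spread : (Found false H ((0 , 0) ∷ (0 , 1) ∷ (0 , 3) ∷ []) ⊎ To-y) ⊎ 4 ≤ ∑[ w < n ] χ (twos w)
    spread = [ (λ (e , w , l , p) → inj₁ (to e w l p)) , inj₂ ]′ (neighbours x twos)
      where
      to : ∀ e w → Link e x w → twos w ≡ false → Found false H ((0 , 0) ∷ (0 , 1) ∷ (0 , 3) ∷ []) ⊎ To-y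
      to e w l p = classify (deg H w) refl
        where
        out : H e ≡ false
        out = zero-outside dx ([ (λ q → inj₁ (proj₁ q)) , (λ q → inj₂ (proj₂ q)) ]′ l)
        on-w : On w e
        on-w = [ (λ q → inj₂ (proj₂ q)) , (λ q → inj₁ (proj₁ q)) ]′ l
        classify : ∀ d → deg H w ≡ d → Found false H ((0 , 0) ∷ (0 , 1) ∷ (0 , 3) ∷ []) ⊎ To-y
        classify 0 dw = inj₁ (here (mkEdge e x w l out dx dw))
        classify 1 dw = inj₁ (there (here (mkEdge e x w l out dx dw)))
        classify 2 dw = inj₂ (mkEdge e x w l out dx dw , refl , target)
          where
          target : w ≡ y
          target with y ≟ w | subst (λ d → (d ≡ᵇ 2) ∧ not (is y w) ≡ false) dw p
          ... | yes y≡w | _ = sym y≡w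
          ... | no _ | ()
        classify 3 dw = inj₁ (there (there (here (mkEdge e x w l out dx dw))))
        classify (suc (suc (suc (suc d)))) dw = contradiction
          (subst (1 ≤_) (trans (cong (λ z → 4 ∸ z) dw) (0∸n≡0 d)) (share-positive false {H} on-w out)) λ ()

    four-twos : 4 ≤ ∑[ w < n ] χ (twos w) → Holds (ρ H) (num 4 ≼ 𝐜 2)
    four-twos h = count-form H 4 (deg∈ (2 ∷ [])) (≤-trans h (∑-mono λ w → bound (deg H w ≡ᵇ 2) (is y w)))
      where
      bound : ∀ a b → χ (a ∧ not b) ≤ (if a then 1 else 0)
      bound true  true  = z≤n
      bound true  false = s≤s z≤n
      bound false _     = z≤n

    -- `twos` leaves out `y`, so `y` is a fifth vertex of degree 2.
    five-twos : deg H y ≡ 2 → 4 ≤ ∑[ w < n ] χ (twos w) → Holds (ρ H) (num 5 ≼ 𝐜 2)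
    five-twos dy h = count-form H 5 (deg∈ (2 ∷ [])) (begin
      5 ≤⟨ +-mono-≤ h (≤-reflexive (sym (∑-pick y (λ _ → 1)))) ⟩
      ∑[ w < n ] χ (twos w) + ∑[ w < n ] (χ (is y w) * 1) ≡⟨ ∑-distrib-+ (λ w → χ (twos w)) (λ w → χ (is y w) * 1) ⟨
      ∑[ w < n ] (χ (twos w) + χ (is y w) * 1) ≤⟨ ∑-mono bound ⟩
      ∑[ w < n ] deg∈ (2 ∷ []) (deg H w) ∎)
      where
      open ≤-Reasoning
      bound : ∀ w → χ (twos w) + χ (is y w) * 1 ≤ deg∈ (2 ∷ []) (deg H w)
      bound w with y ≟ w
      ... | yes refl rewrite dy = s≤s z≤n
      ... | no _ with deg H w ≡ᵇ 2
      ...   | true  = s≤s z≤n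
      ...   | false = z≤n

  -- Rotate the edge f at its end of degree 2 towards a vertex of degree 0.
  through : ∀ {H i} (A : Edge false H 0 2) (f : Edge true H 2 i) → Edge.v A ≡ Edge.u f → i ≢ 0 →
            Edge true (with-edge A) 3 i
  through {H} {i} A f same i≢0 = subst₂ (Edge true _) (cong (λ z → 2 + z) u-on) (trans (cong (λ z → i + z) v-off) (+-identityʳ i))
      (after-add A f λ eq → contradiction (trans (sym (Edge.in-b A)) (trans (cong H eq) (Edge.in-b f))) λ ())
    where
    u-on : inc (Edge.e A) (Edge.u f) ≡ 1
    u-on = inc-on (subst (λ w → On w (Edge.e A)) same (Edge.on-v A))
    v-off : inc (Edge.e A) (Edge.v f) ≡ 0
    v-off = untouched A (by-degree (Edge.du A) (Edge.dv f) (i≢0 ∘ sym)) (λ eq → Edge.u≢v f (trans (sym same) eq))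

  -- Too many vertices of degree 0, with no lower bound on M 3.
  module Drain where
    -- The bounds of `Fill` seen in the complement. Since n = 5 t + 1 - k, all windows are lowered
    -- by `k`.
    I : List (Form 7)
    I = (𝐭 ≼ 𝐌₀ ⊕ 𝐤) ∷ (2 • 𝐭 ≼ 𝐌₁ ⊕ 𝐤) ∷ (𝐌₁ ⊕ 𝐤 ≼ 2 • 𝐭 ⊕ num 1)
      ∷ (3 • 𝐭 ≼ 𝐌₂ ⊕ 𝐤) ∷ (𝐌₂ ⊕ 𝐤 ≼ 3 • 𝐭 ⊕ num 1) ∷ (𝐌₃ ⊕ 𝐤 ≼ 4 • 𝐭 ⊕ num 1) ∷ []

    stop : Form 7
    stop = 𝐌₀ ⊕ 𝐪 ≼ 𝐧

    open Descent I 𝐌₀ stop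

    -- `full₃` rules out deletions at degree 4, since they raise `M 3`.
    full₁ full₂ full₃ : Form 7
    full₁ = 2 • 𝐭 ⊕ num 1 ≼ 𝐌₁ ⊕ 𝐤
    full₂ = 3 • 𝐭 ⊕ num 1 ≼ 𝐌₂ ⊕ 𝐤
    full₃ = 4 • 𝐭 ⊕ num 1 ≼ 𝐌₃ ⊕ 𝐤

    Γ : List (Form 7) → List (Form 7)
    Γ fs = fs ++ neg stop ∷ I ++ base

    Γ₁₁ Γ₁₀ Γ₀₁ Γ₀₀ : List (Form 7)
    Γ₁₁ = Γ (full₁ ∷ full₂ ∷ [])
    Γ₁₀ = Γ (full₁ ∷ neg full₂ ∷ [])
    Γ₀₁ = Γ (neg full₁ ∷ full₂ ∷ [])
    Γ₀₀ = Γ (neg full₁ ∷ neg full₂ ∷ [])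

    case₁₁ : ∀ {H} → Ctx H Γ₁₁ → Progress H
    case₁₁ ctx = strike ctx at-refl false ((0 , 0) ∷ (0 , 1) ∷ (0 , 2) ∷ (0 , 3) ∷ []) (deg∈ (0 ∷ [])) none

    case₀₁ : ∀ {H} → Ctx H Γ₀₁ → Progress H
    case₀₁ ctx = strike ctx at-refl false ((0 , 0) ∷ (0 , 2) ∷ (0 , 3) ∷ []) (deg∈ (0 ∷ [])) (deg∈ (1 ∷ []))

    case₁₀ : ∀ {H} → Ctx H Γ₁₀ → Progress H
    case₁₀ {H} ctx = choose (pick ctx at-refl false ((0 , 0) ∷ (0 , 1) ∷ (0 , 3) ∷ (0 , 2) ∷ []) (deg∈ (0 ∷ [])) none)
      where
      choose : Found false H ((0 , 0) ∷ (0 , 1) ∷ (0 , 3) ∷ (0 , 2) ∷ []) → Progress H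
      choose (here E)                         = one ctx at-refl E
      choose (there (here E))                 = one ctx at-refl E
      choose (there (there (here E)))         = one ctx at-refl E
      -- Here M 2 - M 1 = t - 1. If all missing edges at degree 0 lead to degree 2, counting leaves
      -- only small `t`; but then four neighbours have degree 2, which needs t ≥ 5. With `y` equal
      -- to `x` the middle outcome would be a loop.
      choose (there (there (there (here E)))) = [ [ (λ f → close ctx at-refl f)
          , (λ (A , p , r) → contradiction (trans p (sym r)) (Edge.u≢v A)) ]′
          , (λ h → strike (four-twos h ∷ ctx) at-refl false ((0 , 0) ∷ (0 , 1) ∷ (0 , 3) ∷ []) (deg∈ (0 ∷ [])) (deg∈ (2 ∷ []))) ]′ spread
        where open Spread (Edge.u E) (Edge.u E) (Edge.du E)

    module _ {H} (ctx : Ctx H Γ₀₀) where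

      -- Adding `A` is paid back by a deletion at degree 3, adding `B` by one at degree 2. The
      -- choice follows the edge `f` to be deleted, so that the two edges have no end degree in
      -- common.
      with-two-and-one : Edge false H 0 2 → Edge false H 0 1 → Progress H
      with-two-and-one A B = by-cases H full₃ tight loose
        where
        tight : Holds (ρ H) full₃ → Progress H
        tight h = choose (pick (h ∷ ctx) at-refl true ((2 , 2) ∷ (2 , 3) ∷ (3 , 3) ∷ []) (deg∈ (2 ∷ 3 ∷ [])) (deg∈ (1 ∷ 4 ∷ [])))
          where
          choose : Found true H ((2 , 2) ∷ (2 , 3) ∷ (3 , 3) ∷ []) → Progress H
          choose (here f)                 = one (h ∷ ctx) (add B) (keep-add B f)
          choose (there (here f))         = one (h ∷ ctx) (add B) (keep-add B f)
          choose (there (there (here f))) = one (h ∷ ctx) (add A) (keep-add A f)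
        loose : Holds (ρ H) (neg full₃) → Progress H
        loose h = choose (pick (h ∷ ctx) at-refl true ((2 , 2) ∷ (2 , 3) ∷ (2 , 4) ∷ (3 , 3) ∷ (3 , 4) ∷ []) (deg∈ (2 ∷ 3 ∷ [])) (deg∈ (1 ∷ [])))
          where
          choose : Found true H ((2 , 2) ∷ (2 , 3) ∷ (2 , 4) ∷ (3 , 3) ∷ (3 , 4) ∷ []) → Progress H
          choose (here f)                                 = one (h ∷ ctx) (add B) (keep-add B f)
          choose (there (here f))                         = one (h ∷ ctx) (add B) (keep-add B f)
          choose (there (there (here f)))                 = one (h ∷ ctx) (add B) (keep-add B f)
          choose (there (there (there (here f))))         = one (h ∷ ctx) (add A) (keep-add A f)
          choose (there (there (there (there (here f))))) = one (h ∷ ctx) (add A) (keep-add A f)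

      with-two : Edge false H 0 2 → Progress H
      with-two A = [ ones , (λ few → by-cases H full₃ (tight few) (loose few)) ]′
          (look {H} at-refl false ((0 , 0) ∷ (0 , 1) ∷ (0 , 3) ∷ []) (deg∈ (0 ∷ [])) (deg∈ (2 ∷ [])))
        where
        ones : Found false H ((0 , 0) ∷ (0 , 1) ∷ (0 , 3) ∷ []) → Progress H
        ones (here E)                 = one ctx at-refl E
        ones (there (here E))         = with-two-and-one A E
        ones (there (there (here E))) = one ctx at-refl E
        tight : Holds (ρ H) _ → Holds (ρ H) full₃ → Progress H
        tight few h = choose (pick (h ∷ ctx) at-refl true ((2 , 2) ∷ (2 , 3) ∷ (3 , 3) ∷ []) (deg∈ (2 ∷ 3 ∷ [])) (deg∈ (1 ∷ 4 ∷ [])))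
          where
          -- If the vertex of degree 0 is joined to the end of `f` of degree 2, adding that edge
          -- turns `f` into an edge at degree 3. Otherwise at least five vertices have degree 2,
          -- although M 2 - M 1 = t; together with `few` this is impossible.
          turn : ∀ {i} (f : Edge true H 2 i) → i ≢ 0 →
            {T (improves (full₃ ∷ Γ₀₀) (zipWith ℤ._+_ (addΔ 0 2) (delΔ 3 i)))} → Progress H
          turn f i≢0 {c} = [ [ ones , (λ (A′ , _ , r) → one (h ∷ ctx) (add A′) (through A′ f r i≢0) {c}) ]′
              , (λ four → impossible _ (five-twos (Edge.du f) four ∷ few ∷ ctx)) ]′ spread
            where open Spread (Edge.u A) (Edge.u f) (Edge.du A)
          choose : Found true H ((2 , 2) ∷ (2 , 3) ∷ (3 , 3) ∷ []) → Progress H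
          choose (here f)                 = turn f λ ()
          choose (there (here f))         = turn f λ ()
          choose (there (there (here f))) = one (h ∷ ctx) (add A) (keep-add A f)
        loose : Holds (ρ H) _ → Holds (ρ H) (neg full₃) → Progress H
        loose few h = choose (pick (h ∷ ctx) at-refl true ((2 , 2) ∷ (2 , 3) ∷ (2 , 4) ∷ (3 , 3) ∷ (3 , 4) ∷ []) (deg∈ (2 ∷ 3 ∷ [])) (deg∈ (1 ∷ [])))
          where
          turn : ∀ {i} (f : Edge true H 2 i) → i ≢ 0 →
            {T (improves (neg full₃ ∷ Γ₀₀) (zipWith ℤ._+_ (addΔ 0 2) (delΔ 3 i)))} → Progress H
          turn f i≢0 {c} = [ [ ones , (λ (A′ , _ , r) → one (h ∷ ctx) (add A′) (through A′ f r i≢0) {c}) ]′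
              , (λ four → impossible _ (five-twos (Edge.du f) four ∷ few ∷ ctx)) ]′ spread
            where open Spread (Edge.u A) (Edge.u f) (Edge.du A)
          choose : Found true H ((2 , 2) ∷ (2 , 3) ∷ (2 , 4) ∷ (3 , 3) ∷ (3 , 4) ∷ []) → Progress H
          choose (here f)                                 = turn f λ ()
          choose (there (here f))                         = turn f λ ()
          choose (there (there (here f)))                 = turn f λ ()
          choose (there (there (there (here f))))         = one (h ∷ ctx) (add A) (keep-add A f)
          choose (there (there (there (there (here f))))) = one (h ∷ ctx) (add A) (keep-add A f)

      case₀₀ : Progress H
      case₀₀ = choose (pick ctx at-refl false ((0 , 0) ∷ (0 , 3) ∷ (0 , 2) ∷ []) (deg∈ (0 ∷ [])) (deg∈ (1 ∷ [])))
        where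
        choose : Found false H ((0 , 0) ∷ (0 , 3) ∷ (0 , 2) ∷ []) → Progress H
        choose (here E)                 = one ctx at-refl E
        choose (there (here E))         = one ctx at-refl E
        choose (there (there (here E))) = with-two E

    step : Step
    step H ctx = by-cases H full₁
      (λ f₁ → by-cases H full₂ (λ f₂ → case₁₁ (f₁ ∷ f₂ ∷ ctx)) (λ f₂ → case₁₀ (f₁ ∷ f₂ ∷ ctx)))
      (λ f₁ → by-cases H full₂ (λ f₂ → case₀₁ (f₁ ∷ f₂ ∷ ctx)) (λ f₂ → case₀₀ (f₁ ∷ f₂ ∷ ctx)))

    drain : ∀ H → Ctx H I → ∃ λ H′ → Ctx H′ (stop ∷ I)
    drain = run step

  -- Too many vertices of degree 0, with all the other counts in their windows.
  module Settle where
    I : List (Form 7)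
    I = (𝐭 ≼ 𝐌₀) ∷ (𝐪 ≼ 𝐌₃) ∷ (𝐌₃ ≼ 4 • 𝐭 ⊕ num 1) ∷ W₁ ++ W₂

    stop : Form 7
    stop = 𝐌₀ ≼ 𝐭 ⊕ num 1

    open Descent I 𝐌₀ stop

    full₁ full₂ full₃ : Form 7
    full₁ = 2 • 𝐭 ⊕ num 1 ≼ 𝐌₁
    full₂ = 3 • 𝐭 ⊕ num 1 ≼ 𝐌₂
    full₃ = 4 • 𝐭 ⊕ num 1 ≼ 𝐌₃

    Γ : List (Form 7) → List (Form 7)
    Γ fs = fs ++ neg stop ∷ I ++ base

    -- M 3 = 4 t + 1 may fall but not rise: (0 , 3) may be added, while nothing may be deleted at
    -- degree 4.
    module Full where
      case₁₁ : ∀ {H} → Ctx H (Γ (full₁ ∷ full₂ ∷ full₃ ∷ [])) → Progress H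
      case₁₁ ctx = strike ctx at-refl false ((0 , 0) ∷ (0 , 1) ∷ (0 , 2) ∷ (0 , 3) ∷ []) (deg∈ (0 ∷ [])) none
      case₁₀ : ∀ {H} → Ctx H (Γ (full₁ ∷ neg full₂ ∷ full₃ ∷ [])) → Progress H
      case₁₀ ctx = strike ctx at-refl false ((0 , 0) ∷ (0 , 1) ∷ (0 , 3) ∷ []) (deg∈ (0 ∷ [])) (deg∈ (2 ∷ []))
      case₀₁ : ∀ {H} → Ctx H (Γ (neg full₁ ∷ full₂ ∷ full₃ ∷ [])) → Progress H
      case₀₁ ctx = strike ctx at-refl false ((0 , 0) ∷ (0 , 2) ∷ (0 , 3) ∷ []) (deg∈ (0 ∷ [])) (deg∈ (1 ∷ []))
      case₀₀ : ∀ {H} → Ctx H (Γ (neg full₁ ∷ neg full₂ ∷ full₃ ∷ [])) → Progress H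
      case₀₀ {H} ctx = ones (pick ctx at-refl false ((0 , 0) ∷ (0 , 3) ∷ (0 , 1) ∷ []) (deg∈ (0 ∷ [])) (deg∈ (2 ∷ [])))
        where
        inner : Edge false H 0 1 → Edge false H 0 2 → Found true H ((2 , 2) ∷ (2 , 3) ∷ (3 , 3) ∷ []) → Progress H
        inner B A (here f)                 = one ctx (add B) (keep-add B f)
        inner B A (there (here f))         = one ctx (add B) (keep-add B f)
        inner B A (there (there (here f))) = one ctx (add A) (keep-add A f)
        twos : Edge false H 0 1 → Found false H ((0 , 0) ∷ (0 , 3) ∷ (0 , 2) ∷ []) → Progress H
        twos B (here E)                 = one ctx at-refl E
        twos B (there (here E))         = one ctx at-refl E
        twos B (there (there (here A))) = inner B A (pick ctx at-refl true ((2 , 2) ∷ (2 , 3) ∷ (3 , 3) ∷ []) (deg∈ (2 ∷ 3 ∷ [])) (deg∈ (1 ∷ 4 ∷ [])))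
        ones : Found false H ((0 , 0) ∷ (0 , 3) ∷ (0 , 1) ∷ []) → Progress H
        ones (here E)                 = one ctx at-refl E
        ones (there (here E))         = one ctx at-refl E
        ones (there (there (here B))) = twos B (pick ctx at-refl false ((0 , 0) ∷ (0 , 3) ∷ (0 , 2) ∷ []) (deg∈ (0 ∷ [])) (deg∈ (1 ∷ [])))

    -- M 3 ≤ 4 t may rise but possibly not fall: (0 , 3) is avoided and deletions at degree 4 become
    -- available.
    module Slack where
      case₁₁ : ∀ {H} → Ctx H (Γ (full₁ ∷ full₂ ∷ neg full₃ ∷ [])) → Progress H
      case₁₁ ctx = strike ctx at-refl false ((0 , 0) ∷ (0 , 1) ∷ (0 , 2) ∷ []) (deg∈ (0 ∷ [])) (deg∈ (3 ∷ []))
      case₁₀ : ∀ {H} → Ctx H (Γ (full₁ ∷ neg full₂ ∷ neg full₃ ∷ [])) → Progress H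
      case₁₀ ctx = strike ctx at-refl false ((0 , 0) ∷ (0 , 1) ∷ []) (deg∈ (0 ∷ [])) (deg∈ (2 ∷ 3 ∷ []))
      case₀₁ : ∀ {H} → Ctx H (Γ (neg full₁ ∷ full₂ ∷ neg full₃ ∷ [])) → Progress H
      case₀₁ ctx = strike ctx at-refl false ((0 , 0) ∷ (0 , 2) ∷ []) (deg∈ (0 ∷ [])) (deg∈ (1 ∷ 3 ∷ []))
      case₀₀ : ∀ {H} → Ctx H (Γ (neg full₁ ∷ neg full₂ ∷ neg full₃ ∷ [])) → Progress H
      case₀₀ {H} ctx = ones (pick ctx at-refl false ((0 , 0) ∷ (0 , 1) ∷ []) (deg∈ (0 ∷ [])) (deg∈ (2 ∷ 3 ∷ [])))
        where
        inner : Edge false H 0 1 → Edge false H 0 2 → Found true H ((2 , 2) ∷ (2 , 3) ∷ (2 , 4) ∷ (3 , 3) ∷ (3 , 4) ∷ []) → Progress H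
        inner B A (here f)                                 = one ctx (add B) (keep-add B f)
        inner B A (there (here f))                         = one ctx (add B) (keep-add B f)
        inner B A (there (there (here f)))                 = one ctx (add B) (keep-add B f)
        inner B A (there (there (there (here f))))         = one ctx (add A) (keep-add A f)
        inner B A (there (there (there (there (here f))))) = one ctx (add A) (keep-add A f)
        twos : Edge false H 0 1 → Found false H ((0 , 0) ∷ (0 , 2) ∷ []) → Progress H
        twos B (here E)         = one ctx at-refl E
        twos B (there (here A)) = inner B A (pick ctx at-refl true ((2 , 2) ∷ (2 , 3) ∷ (2 , 4) ∷ (3 , 3) ∷ (3 , 4) ∷ []) (deg∈ (2 ∷ 3 ∷ [])) (deg∈ (1 ∷ [])))
        ones : Found false H ((0 , 0) ∷ (0 , 1) ∷ []) → Progress H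
        ones (here E)         = one ctx at-refl E
        ones (there (here B)) = twos B (pick ctx at-refl false ((0 , 0) ∷ (0 , 2) ∷ []) (deg∈ (0 ∷ [])) (deg∈ (1 ∷ 3 ∷ [])))

    step : Step
    step H ctx = by-cases H full₁
      (λ f₁ → by-cases H full₂
        (λ f₂ → by-cases H full₃
          (λ f₃ → Full.case₁₁ (f₁ ∷ f₂ ∷ f₃ ∷ ctx)) (λ f₃ → Slack.case₁₁ (f₁ ∷ f₂ ∷ f₃ ∷ ctx)))
        (λ f₂ → by-cases H full₃
          (λ f₃ → Full.case₁₀ (f₁ ∷ f₂ ∷ f₃ ∷ ctx)) (λ f₃ → Slack.case₁₀ (f₁ ∷ f₂ ∷ f₃ ∷ ctx))))
      (λ f₁ → by-cases H full₂
        (λ f₂ → by-cases H full₃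
          (λ f₃ → Full.case₀₁ (f₁ ∷ f₂ ∷ f₃ ∷ ctx)) (λ f₃ → Slack.case₀₁ (f₁ ∷ f₂ ∷ f₃ ∷ ctx)))
        (λ f₂ → by-cases H full₃
          (λ f₃ → Full.case₀₀ (f₁ ∷ f₂ ∷ f₃ ∷ ctx)) (λ f₃ → Slack.case₀₀ (f₁ ∷ f₂ ∷ f₃ ∷ ctx))))

    settle : ∀ H → Ctx H I → ∃ λ H′ → Ctx H′ (stop ∷ I)
    settle = run step

  -- From a cut to balanced counts

  open Cuts G using (VertexSet; ∣_∣ᵥ; cut; dcut; Good; even; odd; grow; refine; one-side)

  module Values (H : EdgeSet) where
    record Value (f : Form 7) (a : ℕ) : Set where
      constructor value
      field
        evaluates : eval f (ρ H) ≡ + a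

    v₀ : Value 𝐌₀ (M 0 H)
    v₀ = value (eval-unit (# 0) (ρ H))
    v₁ : Value 𝐌₁ (M 1 H)
    v₁ = value (eval-unit (# 2) (ρ H))
    v₂ : Value 𝐌₂ (M 2 H)
    v₂ = value (eval-unit (# 3) (ρ H))
    v₃ : Value 𝐌₃ (M 3 H)
    v₃ = value (eval-unit (# 1) (ρ H))
    vq : Value 𝐪 q
    vq = value (eval-unit (# 4) (ρ H))
    vk : Value 𝐤 k
    vk = value (eval-unit (# 5) (ρ H))
    vt : Value 𝐭 t
    vt = value (eval-unit (# 6) (ρ H))

    infixl 6 _⟨+⟩_
    infixl 7 _⟨•⟩_
    _⟨+⟩_ : ∀ {f g a b} → Value f a → Value g b → Value (f ⊕ g) (a + b)
    _⟨+⟩_ {f} {g} (value p) (value r) = value (trans (eval-⊕ f g (ρ H)) (cong₂ ℤ._+_ p r))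
    _⟨•⟩_ : ∀ {f a} c → Value f a → Value (c • f) (c * a)
    _⟨•⟩_ {f} {a} c (value p) = value (trans (eval-⊙ (+ c) f (ρ H)) (trans (cong (λ z → + c ℤ.* z) p) (sym (ℤₚ.pos-* c a))))
    ⟨num⟩ : ∀ c → Value (num c) c
    ⟨num⟩ c = value (eval-const (+ c) (ρ H))

    to : ∀ {f g a b} → Value f a → Value g b → a ≤ b → Holds (ρ H) (f ≼ g)
    to {f} {g} (value p) (value r) le = holds (subst (0ℤ ℤ.≤_) (sym (trans (eval-⊖ g f (ρ H)) (cong₂ ℤ._-_ r p))) (ℤₚ.i≤j⇒0≤j-i (ℤ.+≤+ le)))
    from : ∀ {f g a b} → Value f a → Value g b → Holds (ρ H) (f ≼ g) → a ≤ b
    from {f} {g} (value p) (value r) (holds h) = ℤₚ.drop‿+≤+ (ℤₚ.0≤i-j⇒j≤i (subst (0ℤ ℤ.≤_) (trans (eval-⊖ g f (ρ H)) (cong₂ ℤ._-_ r p)) h))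

  M-∁ : ∀ H e → e ≤ 3 → M e (∁ H) + M (3 ∸ e) H ≡ n
  M-∁ H e e≤3 = trans (sym (∑-distrib-+ (λ v → χ (deg (∁ H) v ≤ᵇ e)) (λ v → χ (deg H v ≤ᵇ 3 ∸ e))))
    (trans (sum-cong-≗ {n} {λ v → χ (deg (∁ H) v ≤ᵇ e) + χ (deg H v ≤ᵇ 3 ∸ e)} {λ _ → 1} pointwise) (∑-one n))
    where
    table : ∀ d e → d ≤ 4 → e ≤ 3 → χ (4 ∸ d ≤ᵇ e) + χ (d ≤ᵇ 3 ∸ e) ≡ 1
    table 0 0 _ _ = refl
    table 0 1 _ _ = refl
    table 0 2 _ _ = refl
    table 0 3 _ _ = refl
    table 1 0 _ _ = refl
    table 1 1 _ _ = refl
    table 1 2 _ _ = refl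
    table 1 3 _ _ = refl
    table 2 0 _ _ = refl
    table 2 1 _ _ = refl
    table 2 2 _ _ = refl
    table 2 3 _ _ = refl
    table 3 0 _ _ = refl
    table 3 1 _ _ = refl
    table 3 2 _ _ = refl
    table 3 3 _ _ = refl
    table 4 0 _ _ = refl
    table 4 1 _ _ = refl
    table 4 2 _ _ = refl
    table 4 3 _ _ = refl
    table (suc (suc (suc (suc (suc _))))) _ (s≤s (s≤s (s≤s (s≤s ())))) _
    table _ (suc (suc (suc (suc _)))) _ (s≤s (s≤s (s≤s ())))
    pointwise : ∀ v → χ (deg (∁ H) v ≤ᵇ e) + χ (deg H v ≤ᵇ 3 ∸ e) ≡ 1
    pointwise v rewrite deg-side false H v = table (deg H v) e (deg≤4 H v) e≤3

  ρ-∁ : ∀ H → ρ (∁ H) ≡ Vec.map (λ g → eval g (ρ H)) mirror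
  ρ-∁ H = cong₂ _∷_ (component 0 z≤n 𝐌₃ v₃) (cong₂ _∷_ (component 3 ≤-refl 𝐌₀ v₀)
    (cong₂ _∷_ (component 1 (s≤s z≤n) 𝐌₂ v₂) (cong₂ _∷_ (component 2 (s≤s (s≤s z≤n)) 𝐌₁ v₁)
    (cong₂ _∷_ (sym (evaluates vq)) (cong₂ _∷_ (sym (evaluates vk)) (cong₂ _∷_ (sym (evaluates vt)) refl))))))
    where
    open Values H
    open Value
    open ℤ-Solver
    lemma : ∀ x y → x ≡ x ℤ.+ y ℤ.- y
    lemma = solve 2 (λ x y → x := x :+ y :- y) refl
    component : ∀ e → e ≤ 3 → ∀ f → Value f (M (3 ∸ e) H) → + M e (∁ H) ≡ eval (𝐧 ⊖ f) (ρ H)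
    component e e≤3 f (value p) = trans (lemma (+ M e (∁ H)) (+ M (3 ∸ e) H))
      (trans (cong (λ z → + z ℤ.- + M (3 ∸ e) H) (M-∁ H e e≤3))
      (sym (trans (eval-⊖ 𝐧 f (ρ H)) (cong₂ ℤ._-_ (eval-𝐧 H) p))))

  complement : ∀ {H} Γ fs → Ctx H Γ → {T (entails Γ (List.map (substitute mirror) fs))} → Ctx (∁ H) fs
  complement {H} Γ fs ctx {c} = all fs (entails-sound Γ (List.map (substitute mirror) fs) c (ρ H) ctx)
    where
    one′ : ∀ f → Holds (ρ H) (substitute mirror f) → Holds (ρ (∁ H)) f
    one′ f (holds h) = holds (subst (0ℤ ℤ.≤_) (trans (eval-substitute f mirror (ρ H)) (cong (eval f) (sym (ρ-∁ H)))) h)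
    all : ∀ fs → All (Holds (ρ H)) (List.map (substitute mirror) fs) → Ctx (∁ H) fs
    all []       []       = []
    all (f ∷ fs) (h ∷ hs) = one′ f h ∷ all fs hs

  weaken : ∀ {H} Γ fs → Ctx H Γ → {T (entails (Γ ++ base) fs)} → Ctx H fs
  weaken {H} Γ fs ctx {c} = entails-sound (Γ ++ base) fs c (ρ H) (++⁺ ctx (base-holds H))

  Windows : List (Form 7)
  Windows = (𝐌₀ ≼ 𝐭 ⊕ num 1) ∷ Settle.I

  -- In the complement the lower bound `q` for `M 3` is an upper bound for `M 0`, the goal of
  -- `Drain`. A second complement turns its result into `Settle.I`.
  balance : ∀ H → Ctx H Fill.I → ∃ λ H′ → Ctx H′ Windows
  balance H ctx = drained (Fill.fill H ctx)
    where
    settled : ∃ (λ H → Ctx H (Drain.stop ∷ Drain.I)) → ∃ λ H′ → Ctx H′ Windows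
    settled (H , c) = Settle.settle (∁ H) (complement ((Drain.stop ∷ Drain.I) ++ base) Settle.I (++⁺ c (base-holds H)))
    drained : ∃ (λ H → Ctx H (Fill.stop ∷ Fill.I)) → ∃ λ H′ → Ctx H′ Windows
    drained (H , c) = settled (Drain.drain (∁ H) (complement ((Fill.stop ∷ Fill.I) ++ base) Drain.I (++⁺ c (base-holds H))))

  Even Odd : List (Form 7)
  Even = (2 • 𝐭 ≼ 𝐌₀) ∷ (𝐌₂ ⊕ 𝐌₃ ≼ 𝐌₀ ⊕ 6 • 𝐭 ⊕ num 2) ∷ (𝐌₂ ≼ 𝐌₀ ⊕ 2 • 𝐭 ⊕ num 1) ∷ W₁
  Odd  = (𝐌₃ ≼ 𝐌₀ ⊕ 𝐌₂) ∷ (𝐭 ≼ 𝐌₀) ∷ (𝐌₂ ≼ 3 • 𝐭 ⊕ num 1) ∷ W₁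

  from-lower : ∀ x H → Ctx H (Lower.I x) → ∃ λ H′ → Ctx H′ Fill.I
  from-lower x H ctx = lowered x (Lower.lower x H ctx)
    where
    lowered : ∀ x → ∃ (λ H → Ctx H ((3 • 𝐭 ≼ 𝐌₂) ∷ Lower.I x)) → ∃ λ H′ → Ctx H′ Fill.I
    lowered true  (H , c) = H , weaken ((3 • 𝐭 ≼ 𝐌₂) ∷ Lower.I true) Fill.I c
    lowered false (H , c) = H , weaken ((3 • 𝐭 ≼ 𝐌₂) ∷ Lower.I false) Fill.I c

  from-even : ∀ H → Ctx H Even → ∃ λ H′ → Ctx H′ Fill.I
  from-even H ctx = by-cases H (𝐌₂ ≼ 3 • 𝐭 ⊕ num 1)
    (λ h → from-lower true H (weaken ((𝐌₂ ≼ 3 • 𝐭 ⊕ num 1) ∷ Even) (Lower.I true) (h ∷ ctx)))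
    (λ h → upper (Raise.raise H (weaken (neg (𝐌₂ ≼ 3 • 𝐭 ⊕ num 1) ∷ Even) Raise.I (h ∷ ctx))))
    where
    upper : ∃ (λ H′ → Ctx H′ (Raise.stop ∷ Raise.I)) → ∃ λ H′ → Ctx H′ Fill.I
    upper (H′ , c) = H′ , weaken (Raise.stop ∷ Raise.I) Fill.I c

  from-good : ∀ B → Good t B → ∃ λ H → Ctx H Fill.I
  from-good B (even sizeB cutB d≤2) = from-even H
      ( to (2 ⟨•⟩ vt) v₀ 2t≤M₀
      ∷ to (v₂ ⟨+⟩ v₃) (v₀ ⟨+⟩ 6 ⟨•⟩ vt ⟨+⟩ ⟨num⟩ 2) (begin
          M 2 H + M 3 H ≤⟨ M₂+M₃≤ d≤2 ⟩
          2 * ∣ B ∣ᵥ + cut B ≤⟨ +-mono-≤ (≤-reflexive (cong (λ z → 2 * z) sizeB)) cutB ⟩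
          2 * (2 * t) + (4 * t + 2) ≡⟨ solve 1 (λ t → con 2 :* (con 2 :* t) :+ (con 4 :* t :+ con 2) := con 2 :* t :+ con 6 :* t :+ con 2) refl t ⟩
          2 * t + 6 * t + 2 ≤⟨ +-monoˡ-≤ 2 (+-monoˡ-≤ (6 * t) 2t≤M₀) ⟩
          M 0 H + 6 * t + 2 ∎)
      ∷ to v₂ (v₀ ⟨+⟩ 2 ⟨•⟩ vt ⟨+⟩ ⟨num⟩ 1) (*-cancelˡ-≤ 2 (begin
          2 * M 2 H ≤⟨ 2M₂≤ ⟩
          2 * ∣ B ∣ᵥ + cut B ≤⟨ +-mono-≤ (≤-reflexive (cong (λ z → 2 * z) sizeB)) cutB ⟩
          2 * (2 * t) + (4 * t + 2) ≡⟨ solve 1 (λ t → con 2 :* (con 2 :* t) :+ (con 4 :* t :+ con 2) := con 2 :* (con 2 :* t :+ con 2 :* t :+ con 1)) refl t ⟩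
          2 * (2 * t + 2 * t + 1) ≤⟨ *-monoʳ-≤ 2 (+-monoˡ-≤ 1 (+-monoˡ-≤ (2 * t) 2t≤M₀)) ⟩
          2 * (M 0 H + 2 * t + 1) ∎))
      ∷ to (2 ⟨•⟩ vt) v₁ (subst (_≤ M 1 H) sizeB (size≤ 1 λ u Au → ≤-trans (zeros-inside d≤2 u Au) z≤n))
      ∷ to v₁ (2 ⟨•⟩ vt ⟨+⟩ ⟨num⟩ 1) (≤-trans M₁≤size (≤-trans (≤-reflexive sizeB) (m≤m+n _ 1)))
      ∷ [])
    where
    open FromCut G B
    open Values H
    open ≤-Reasoning
    open ℕ-Solver
    2t≤M₀ : 2 * t ≤ M 0 H
    2t≤M₀ = subst (_≤ M 0 H) sizeB (size≤ 0 (zeros-inside d≤2))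
  from-good B (odd sizeB d≤1) = from-lower false H (weaken Odd (Lower.I false)
      -- `extra` cancels: the vertices that `A` may lose from `M 0` are offset by the saving in
      -- `M₃+extra≤`.
      ( to v₃ (v₀ ⟨+⟩ v₂) (+-cancelʳ-≤ extra _ _ (begin
          M 3 H + extra ≤⟨ M₃+extra≤ d≤1 ⟩
          M 2 H + cut B ≤⟨ +-monoʳ-≤ (M 2 H) (≤-trans cut≤ size≤M₀+extra) ⟩
          M 2 H + (M 0 H + extra) ≡⟨ solve 3 (λ a b c → a :+ (b :+ c) := b :+ a :+ c) refl (M 2 H) (M 0 H) extra ⟩
          M 0 H + M 2 H + extra ∎))
      -- M 0 is at least |B| minus half of the cut, which is at least (2 t + 1) / 2.
      ∷ to vt v₀ (≮⇒≥ λ small → <-irrefl refl (begin-strict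
          2 * (2 * t + 1) ≡⟨ cong (λ z → 2 * z) sizeB ⟨
          2 * ∣ B ∣ᵥ ≤⟨ *-monoʳ-≤ 2 size≤M₀+extra ⟩
          2 * (M 0 H + extra) ≡⟨ *-distribˡ-+ 2 (M 0 H) extra ⟩
          2 * M 0 H + 2 * extra ≤⟨ +-mono-≤ (*-monoʳ-≤ 2 (<⇒≤ small)) (≤-trans 2extra≤ (≤-trans cut≤ (≤-reflexive sizeB))) ⟩
          2 * t + (2 * t + 1) <⟨ ≤-reflexive (solve 1 (λ t → con 1 :+ (con 2 :* t :+ (con 2 :* t :+ con 1)) := con 2 :* (con 2 :* t :+ con 1)) refl t) ⟩
          2 * (2 * t + 1) ∎))
      -- 2 M 2 ≤ 3 (2 t + 1) < 2 (3 t + 2).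
      ∷ to v₂ (3 ⟨•⟩ vt ⟨+⟩ ⟨num⟩ 1) (≮⇒≥ λ large → <-irrefl refl (begin-strict
          2 * M 2 H ≤⟨ 2M₂≤ ⟩
          2 * ∣ B ∣ᵥ + cut B ≤⟨ +-mono-≤ (≤-reflexive (cong (λ z → 2 * z) sizeB)) (≤-trans cut≤ (≤-reflexive sizeB)) ⟩
          2 * (2 * t + 1) + (2 * t + 1) <⟨ ≤-reflexive (solve 1 (λ t → con 1 :+ (con 2 :* (con 2 :* t :+ con 1) :+ (con 2 :* t :+ con 1)) := con 2 :* (con 1 :+ (con 3 :* t :+ con 1))) refl t) ⟩
          2 * suc (3 * t + 1) ≤⟨ *-monoʳ-≤ 2 large ⟩
          2 * M 2 H ∎))
      ∷ to (2 ⟨•⟩ vt) v₁ (≤-trans (m≤m+n _ 1) (subst (_≤ M 1 H) sizeB (size≤ 1 λ u Au → ≤-trans (inside u Au) (d≤1 u Au))))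
      ∷ to v₁ (2 ⟨•⟩ vt ⟨+⟩ ⟨num⟩ 1) (≤-trans M₁≤size (≤-reflexive sizeB))
      ∷ []))
    where
    open FromCut G B
    open Values H
    open ≤-Reasoning
    open ℕ-Solver
    cut≤ : cut B ≤ ∣ B ∣ᵥ
    cut≤ = subst (_≤ ∣ B ∣ᵥ) (one-side B false) (∑-mono λ u → bound′ u)
      where
      bound′ : ∀ u → χ (B u) * dcut B u ≤ χ (B u)
      bound′ u with B u in eq
      ... | true  = ≤-trans (≤-reflexive (+-identityʳ _)) (d≤1 u eq)
      ... | false = z≤n

  start : ∃ λ H → Ctx H Fill.I
  start = from-cut (grow (2 * t) 2t≤n)
    where
    refined : ∃ (Good t) → ∃ λ H → Ctx H Fill.I
    refined (B , good) = from-good B good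
    from-cut : Σ[ A ∈ VertexSet ] (∣ A ∣ᵥ ≡ 2 * t × cut A ≤ 2 * (2 * t) + 2) → ∃ λ H → Ctx H Fill.I
    from-cut (A , sizeA , bound) =
      refined (refine t (cut A) A ≤-refl sizeA (≤-trans bound (≤-reflexive (cong (λ z → z + 2) (sym (*-assoc 2 2 t))))))
    2t≤n : 2 * t ≤ n
    2t≤n = +-cancelʳ-≤ k _ _ (begin
      2 * t + k ≤⟨ +-monoʳ-≤ (2 * t) (≤-trans k≤4 (≤-trans (s≤s (*-monoʳ-≤ 3 1≤t)) (≤-reflexive (+-comm 1 (3 * t))))) ⟩
      2 * t + (3 * t + 1) ≡⟨ solve 1 (λ t → con 2 :* t :+ (con 3 :* t :+ con 1) := con 5 :* t :+ con 1) refl t ⟩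
      5 * t + 1 ≡⟨ size ⟨
      n + k ∎)
      where
      open ≤-Reasoning
      open ℕ-Solver

  Balanced : EdgeSet → Set
  Balanced H = (t ≤ M 0 H × M 0 H ≤ t + 1) × (2 * t ≤ M 1 H × M 1 H ≤ 2 * t + 1)
             × (3 * t ≤ M 2 H × M 2 H ≤ 3 * t + 1) × (q ≤ M 3 H × M 3 H ≤ 4 * t + 1)

  windows-balanced : ∀ H → Ctx H Windows → Balanced H
  windows-balanced H (a ∷ b ∷ c ∷ d ∷ e ∷ f ∷ g ∷ h ∷ []) =
      (from vt v₀ b , from v₀ (vt ⟨+⟩ ⟨num⟩ 1) a)
    , (from (2 ⟨•⟩ vt) v₁ e , from v₁ (2 ⟨•⟩ vt ⟨+⟩ ⟨num⟩ 1) f)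
    , (from (3 ⟨•⟩ vt) v₂ g , from v₂ (3 ⟨•⟩ vt ⟨+⟩ ⟨num⟩ 1) h)
    , (from vq v₃ c , from v₃ (4 ⟨•⟩ vt ⟨+⟩ ⟨num⟩ 1) d)
    where open Values H

  balanced : ∃ Balanced
  balanced = conclude start
    where
    settled : ∃ (λ H → Ctx H Windows) → ∃ Balanced
    settled (H , c) = H , windows-balanced H c
    conclude : ∃ (λ H → Ctx H Fill.I) → ∃ Balanced
    conclude (H , c) = settled (balance H c)

-- Labelings

private variable
  n : ℕ

χ∈ : Fin n → Subset n → ℕ
χ∈ v p = χ (does (v ∈? p))

χ∈-empty : ∀ (p : Subset n) → ∣ p ∣ ≡ 0 → ∀ v → χ∈ v p ≡ 0
χ∈-empty (false ∷ p) eq zero    = refl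
χ∈-empty (false ∷ p) eq (suc v) = χ∈-empty p eq v

χ∈-singleton : ∀ (p : Subset n) → ∣ p ∣ ≡ 1 → ∃ λ a → ∀ v → χ∈ v p ≡ χ (is a v)
χ∈-singleton (true ∷ p)  eq = zero , λ { zero → refl ; (suc v) → χ∈-empty p (suc-injective eq) v }
χ∈-singleton (false ∷ p) eq with a , h ← χ∈-singleton p eq = suc a , λ { zero → refl ; (suc v) → h v }

χ∈-pair : ∀ (p : Subset n) → ∣ p ∣ ≡ 2 →
  Σ[ a ∈ Fin n ] Σ[ b ∈ Fin n ] (a ≢ b × (∀ v → χ∈ v p ≡ χ (is a v) + χ (is b v)))
χ∈-pair (true ∷ p)  eq with b , h ← χ∈-singleton p (suc-injective eq) =
  zero , suc b , (λ ()) , λ { zero → refl ; (suc v) → h v }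
χ∈-pair (false ∷ p) eq with a , b , a≢b , h ← χ∈-pair p eq =
  suc a , suc b , (λ { refl → a≢b refl }) , λ { zero → refl ; (suc v) → h v }

χ∈-injective : ∀ (p q : Subset n) → (∀ v → χ∈ v p ≡ χ∈ v q) → p ≡ q
χ∈-injective []            []            h = refl
χ∈-injective (true ∷ p)  (true ∷ q)  h = cong (true ∷_) (χ∈-injective p q (h ∘ suc))
χ∈-injective (true ∷ p)  (false ∷ q) h = contradiction (h zero) λ ()
χ∈-injective (false ∷ p) (true ∷ q)  h = contradiction (h zero) λ ()
χ∈-injective (false ∷ p) (false ∷ q) h = cong (false ∷_) (χ∈-injective p q (h ∘ suc))

sum-filter : ∀ {m k} {ℓ} {P : Pred (Fin k) ℓ} (P? : Decidable P) (f : Fin k → ℕ) (g : Fin m → Fin k) →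
  List-sum (List.map f (filter P? (tabulate g))) ≡ ∑[ i < m ] (χ (does (P? (g i))) * f (g i))
sum-filter {zero}  P? f g = refl
sum-filter {suc m} P? f g with P? (g zero)
... | yes _ = cong₂ _+_ (sym (+-identityʳ _)) (sum-filter P? f (g ∘ suc))
... | no  _ = sum-filter P? f (g ∘ suc)

sum-ones : ∀ {A : Set} (xs : List A) → List-sum (List.map (λ _ → 1) xs) ≡ length xs
sum-ones []       = refl
sum-ones (x ∷ xs) = cong suc (sum-ones xs)

module Underlying {n : ℕ} (G : Graph n) (regular : Regular 4 G) where
  open Graph G

  ends : ∀ e → Σ[ a ∈ Fin n ] Σ[ b ∈ Fin n ] (a ≢ b × (∀ v → χ∈ v (edge e) ≡ χ (is a v) + χ (is b v)))
  ends e = χ∈-pair (edge e) (twoElement e)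

  multigraph : Multigraph n size
  multigraph = record { src = λ e → proj₁ (ends e) ; tgt = λ e → proj₁ (proj₂ (ends e)) }

  open Multigraph multigraph

  loopless : ∀ e → src e ≢ tgt e
  loopless e = proj₁ (proj₂ (proj₂ (ends e)))

  χ∈-inc : ∀ e v → χ∈ v (edge e) ≡ inc e v
  χ∈-inc e = proj₂ (proj₂ (proj₂ (ends e)))

  incident-sum : ∀ v (f : Fin size → ℕ) →
    List-sum (List.map f (incidentEdges v)) ≡ ∑[ e < size ] (inc e v * f e)
  incident-sum v f = trans (sum-filter (λ e → v ∈? edge e) f id)
    (sum-cong-≗ λ e → cong (_* f e) (χ∈-inc e v))

  -- Two different vertices on an edge determine its set of ends. With `edgeInjective` this excludes
  -- parallel edges.
  inc-pair : ∀ {e v w} → v ≢ w → On v e → On w e → ∀ x → inc e x ≡ χ (is v x) + χ (is w x)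
  inc-pair v≢w (inj₁ p)    (inj₁ q)    x = contradiction (trans (sym p) q) v≢w
  inc-pair v≢w (inj₁ refl) (inj₂ refl) x = refl
  inc-pair {e} v≢w (inj₂ refl) (inj₁ refl) x = +-comm (χ (is (src e) x)) (χ (is (tgt e) x))
  inc-pair v≢w (inj₂ p)    (inj₂ q)    x = contradiction (trans (sym p) q) v≢w

  simple4 : Simple4 n size
  simple4 = record
    { multigraph = multigraph
    ; loopless   = loopless
    ; simple     = λ {e} {e′} v≢w v∈e w∈e v∈e′ w∈e′ → edgeInjective (χ∈-injective (edge e) (edge e′) λ x → begin
        χ∈ x (edge e)  ≡⟨ χ∈-inc e x ⟩
        inc e x        ≡⟨ inc-pair v≢w v∈e w∈e x ⟩
        _              ≡⟨ inc-pair v≢w v∈e′ w∈e′ x ⟨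
        inc e′ x       ≡⟨ χ∈-inc e′ x ⟨
        χ∈ x (edge e′) ∎)
    ; regular    = λ v → begin
        ∑[ e < size ] inc e v                        ≡⟨ sum-cong-≗ (λ e → *-identityʳ (inc e v)) ⟨
        ∑[ e < size ] (inc e v * 1)                  ≡⟨ incident-sum v (λ _ → 1) ⟨
        List-sum (List.map (λ _ → 1) (incidentEdges v)) ≡⟨ sum-ones (incidentEdges v) ⟩
        degree v                                     ≡⟨ regular v ⟩
        4                                            ∎
    }
    where open ≡-Reasoning

-- Ranks

∑-strict : ∀ {n} {f g : Fin n → ℕ} → (∀ i → f i ≤ g i) → ∀ i → f i < g i → sum f < sum g
∑-strict h zero    lt = +-mono-<-≤ lt (∑-mono (h ∘ suc))
∑-strict h (suc i) lt = +-mono-≤-< (h zero) (∑-strict (h ∘ suc) i lt)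

injective⇒surjective : ∀ {n} (f : Fin n → Fin n) → Injective _≡_ _≡_ f → ∀ y → ∃ λ x → f x ≡ y
injective⇒surjective {suc n} f inj y with any? (λ x → f x ≟ y)
... | yes found  = found
... | no missing = contradiction
  (injective⇒≤ {f = λ x → punchOut (avoids x)} λ {x} {x′} eq → inj (punchOut-injective (avoids x) (avoids x′) eq))
  (<⇒≱ (n<1+n n))
  where
  avoids : ∀ x → y ≢ f x
  avoids x y≡fx = missing (x , sym y≡fx)

χ-≤ : ∀ {a b} → (a ≡ true → b ≡ true) → χ a ≤ χ b
χ-≤ {false} h = z≤n
χ-≤ {true}  h = ≤-reflexive (cong χ (sym (h refl)))

<ᵇ-true : ∀ {a b} → a < b → (a <ᵇ b) ≡ true
<ᵇ-true {zero}  {suc b} _   = refl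
<ᵇ-true {suc a} {suc b} a<b = <ᵇ-true (s<s⁻¹ a<b)

<ᵇ-irrefl : ∀ a → (a <ᵇ a) ≡ false
<ᵇ-irrefl zero    = refl
<ᵇ-irrefl (suc a) = <ᵇ-irrefl a

true⇒< : ∀ {a b} → (a <ᵇ b) ≡ true → a < b
true⇒< {a} eq = <ᵇ⇒< a _ (subst T (sym eq) _)

module Ranking {n : ℕ} (key : Fin n → ℕ) (key-injective : Injective _≡_ _≡_ key) where

  rank : Fin n → ℕ
  rank v = ∑[ w < n ] χ (key w <ᵇ key v)

  -- Strict because `v` satisfies `P` but is not counted in its own rank.
  rank< : ∀ v → (P : Fin n → Bool) → (∀ w → key w ≤ key v → P w ≡ true) → rank v < ∑[ w < n ] χ (P w)
  rank< v P h = ∑-strict (λ w → χ-≤ (h w ∘ <⇒≤ ∘ true⇒<)) v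
    (≤-reflexive (trans (cong (suc ∘ χ) (<ᵇ-irrefl (key v))) (cong χ (sym (h v ≤-refl)))))

  ≤rank : ∀ v → (P : Fin n → Bool) → (∀ w → P w ≡ true → key w < key v) → ∑[ w < n ] χ (P w) ≤ rank v
  ≤rank v P h = ∑-mono λ w → χ-≤ (<ᵇ-true ∘ h w)

  rank<n : ∀ v → rank v < n
  rank<n v = subst (rank v <_) (∑-one n) (rank< v (λ _ → true) λ _ _ → refl)

  rank-mono : ∀ {u v} → key u < key v → rank u < rank v
  rank-mono {u} {v} u<v = rank< u (λ w → key w <ᵇ key v) λ w w≤u → <ᵇ-true (≤-<-trans w≤u u<v)

  rank-injective : Injective _≡_ _≡_ rank
  rank-injective {u} {v} eq with <-cmp (key u) (key v)
  ... | tri< u<v _ _ = contradiction eq (<⇒≢ (rank-mono u<v))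
  ... | tri≈ _ u≈v _ = key-injective u≈v
  ... | tri> _ _ v<u = contradiction (sym eq) (<⇒≢ (rank-mono v<u))

  rank-surjective : ∀ {r} → r < n → ∃ λ v → rank v ≡ r
  rank-surjective {r} r<n with v , eq ← injective⇒surjective (λ v → fromℕ< (rank<n v))
      (λ {u} {v} eq → rank-injective (trans (sym (toℕ-fromℕ< (rank<n u))) (trans (cong toℕ eq) (toℕ-fromℕ< (rank<n v)))))
      (fromℕ< r<n)
    = v , trans (sym (toℕ-fromℕ< (rank<n v))) (trans (cong toℕ eq) (toℕ-fromℕ< r<n))

module Lexicographic {n : ℕ} (d : Fin n → ℕ) where

  -- Degree first, index second: as `toℕ v < n`, these are digits in base `n`.
  lex : Fin n → ℕ
  lex v = toℕ v + d v * n

  lex-< : ∀ {u v} → d u < d v → lex u < lex v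
  lex-< {u} {v} lt = <-≤-trans (+-monoˡ-< (d u * n) (toℕ<n u))
    (≤-trans (*-monoˡ-≤ n lt) (m≤n+m (d v * n) (toℕ v)))

  lex-≤ : ∀ {u v} → lex u ≤ lex v → d u ≤ d v
  lex-≤ le = ≮⇒≥ λ lt → <⇒≱ (lex-< lt) le

  lex-injective : Injective _≡_ _≡_ lex
  lex-injective {u} {v} eq = toℕ-injective (+-cancelʳ-≡ (d u * n) (toℕ u) (toℕ v)
    (trans eq (cong (λ z → toℕ v + z * n) (sym same))))
    where
    same : d u ≡ d v
    same = ≤-antisym (lex-≤ (≤-reflexive eq)) (lex-≤ (≤-reflexive (sym eq)))

-- The ceiling of a / 5 is minus the floor of - a / 5, so the defect is the remainder of - a modulo
-- 5.
ceiling-bound : ∀ a s → + s ≡ ceiling ((+ a) / 5) → ∃ λ r → r ≤ 4 × a + r ≡ 5 * s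
ceiling-bound a s eq = r , s≤s⁻¹ (ℤD.n%d<d z (+ 5)) , ℤₚ.+-injective (begin
    + a ℤ.+ + r                      ≡⟨ cong (ℤ._+ + r) (ℤₚ.neg-involutive (+ a)) ⟨
    ℤ.- z ℤ.+ + r                    ≡⟨ cong (λ y → ℤ.- y ℤ.+ + r) (ℤD.a≡a%n+[a/n]*n z (+ 5)) ⟩
    ℤ.- (+ r ℤ.+ q ℤ.* + 5) ℤ.+ + r  ≡⟨ lemma (+ r) q ⟩
    + 5 ℤ.* ℤ.- q                    ≡⟨ cong (+ 5 ℤ.*_) eq ⟨
    + 5 ℤ.* + s                      ≡⟨ ℤₚ.pos-* 5 s ⟨
    + (5 * s)                        ∎)
  where
  open ≡-Reasoning
  z q : ℤ
  z = ℤ.- + a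
  q = z ℤ./ + 5
  r : ℕ
  r = z ℤ.% + 5
  lemma : ∀ x y → ℤ.- (x ℤ.+ y ℤ.* + 5) ℤ.+ x ≡ + 5 ℤ.* ℤ.- y
  lemma = solve 2 (λ x y → :- (x :+ y :* con (+ 5)) :+ x := con (+ 5) :* :- y) refl
    where open ℤ-Solver

length≤sum : ∀ {A : Set} {f : A → ℕ} → (∀ x → 1 ≤ f x) → ∀ xs → length xs ≤ List-sum (List.map f xs)
length≤sum 1≤f []       = z≤n
length≤sum 1≤f (x ∷ xs) = +-mono-≤ (1≤f x) (length≤sum 1≤f xs)

sum≤length* : ∀ {A : Set} {f : A → ℕ} {j} → (∀ x → f x ≤ j) → ∀ xs → List-sum (List.map f xs) ≤ length xs * j
sum≤length* f≤j []       = z≤n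
sum≤length* f≤j (x ∷ xs) = +-mono-≤ (f≤j x) (sum≤length* f≤j xs)

module _ {n : ℕ} (G : Graph n) (regular : Regular 4 G) where
  open Graph G

  order-bound : ∀ {j} → 1 ≤ j → HasVertexIrregularLabeling G j → n + 4 ≤ 5 * j
  order-bound {j} 1≤j (L , irregular) = begin
    n + 4           ≤⟨ +-monoˡ-≤ 4 (injective⇒≤ {f = λ v → fromℕ< (in-range v)} index-injective) ⟩
    5 * j ∸ 4 + 4   ≡⟨ m∸n+n≡m 4≤5j ⟩
    5 * j           ∎
    where
    open TotalLabeling L
    open ≤-Reasoning
    4≤5j : 4 ≤ 5 * j
    4≤5j = ≤-trans (m≤m+n 4 1) (*-monoʳ-≤ 5 1≤j)
    5≤weight : ∀ v → 5 ≤ weight v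
    5≤weight v = +-mono-≤ (1≤label (inj₁ v)) (subst (_≤ List-sum (List.map (label ∘ inj₂) (incidentEdges v)))
      (regular v) (length≤sum (1≤label ∘ inj₂) (incidentEdges v)))
    weight≤5j : ∀ v → weight v ≤ 5 * j
    weight≤5j v = +-mono-≤ (label≤k (inj₁ v)) (subst (λ d → List-sum (List.map (label ∘ inj₂) (incidentEdges v)) ≤ d * j)
      (regular v) (sum≤length* (label≤k ∘ inj₂) (incidentEdges v)))
    in-range : ∀ v → weight v ∸ 5 < 5 * j ∸ 4
    in-range v = subst (suc (weight v ∸ 5) ≤_) (sym (+-∸-assoc 1 {5 * j} {5} (≤-trans (5≤weight v) (weight≤5j v))))
      (s≤s (∸-monoˡ-≤ 5 (weight≤5j v)))
    index-injective : ∀ {u v} → fromℕ< (in-range u) ≡ fromℕ< (in-range v) → u ≡ v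
    index-injective {u} {v} eq with u ≟ v
    ... | yes u≡v = u≡v
    ... | no  u≢v = contradiction (∸-cancelʳ-≡ (5≤weight u) (5≤weight v) (fromℕ<-injective _ _ (in-range u) (in-range v) eq)) (irregular u v u≢v)

  -- The labeling of an edge set

  module FromEdgeSet (k t : ℕ) (order : n + k ≡ 5 * t + 1) where
    open Underlying G regular
    open Graphs simple4 using (EdgeSet; deg; deg≤4; M)

    module Labels (H : EdgeSet)
      (w₀ : t ≤ M 0 H × M 0 H ≤ t + 1) (w₁ : 2 * t ≤ M 1 H × M 1 H ≤ 2 * t + 1)
      (w₂ : 3 * t ≤ M 2 H × M 2 H ≤ 3 * t + 1) (w₃ : (4 * t) ⊓ n ≤ M 3 H × M 3 H ≤ 4 * t + 1) where

      open Lexicographic (deg H)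
      open Ranking lex lex-injective

      M≤rank : ∀ {e} v → e < deg H v → M e H ≤ rank v
      M≤rank {e} v e<d = ≤rank v (λ w → deg H w ≤ᵇ e) λ w low →
        lex-< (≤-<-trans (≤ᵇ⇒≤ (deg H w) e (Equivalence.from T-≡ low)) e<d)

      rank<M : ∀ v → rank v < M (deg H v) H
      rank<M v = rank< v (λ w → deg H w ≤ᵇ deg H v) λ w le → Equivalence.to T-≡ (≤⇒≤ᵇ (lex-≤ le))

      -- The vertices of degree d have the ranks from M (d - 1) to M d - 1, so the bounds on these
      -- two counts are exactly what is required.
      window : ∀ v → deg H v * t ≤ rank v × rank v ≤ t + deg H v * t
      window v = at (deg H v) refl (deg≤4 H v)
        where
        above : ∀ {e b} → e < deg H v → b ≤ M e H → b ≤ rank v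
        above e<d b≤M = ≤-trans b≤M (M≤rank v e<d)
        below : ∀ {b d} → d ≡ deg H v → M d H ≤ b + 1 → rank v ≤ b
        below {b} refl M≤ = s≤s⁻¹ (≤-trans (rank<M v) (≤-trans M≤ (≤-reflexive (+-comm b 1))))
        at : ∀ d → d ≡ deg H v → d ≤ 4 → d * t ≤ rank v × rank v ≤ t + d * t
        at 0 eq _ = z≤n , below eq (subst (λ z → M 0 H ≤ z + 1) (sym (+-identityʳ t)) (proj₂ w₀))
        at 1 eq _ = above (≤-reflexive eq) (subst (_≤ M 0 H) (sym (+-identityʳ t)) (proj₁ w₀)) , below eq (proj₂ w₁)
        at 2 eq _ = above (≤-reflexive eq) (proj₁ w₁) , below eq (proj₂ w₂)
        at 3 eq _ = above (≤-reflexive eq) (proj₁ w₂) , below eq (proj₂ w₃)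
        -- If the minimum is `n`, then M 3 = n and no vertex has degree 4.
        at 4 eq _ = [ (λ q≡4t → above (≤-reflexive eq) (subst (_≤ M 3 H) q≡4t (proj₁ w₃)))
                    , (λ q≡n → contradiction (≤-trans (subst (_≤ M 3 H) q≡n (proj₁ w₃)) (M≤rank v (≤-reflexive eq)))
                                             (<⇒≱ (rank<n v))) ]′ (⊓-sel (4 * t) n)
                  -- M 4 = n ≤ 5 t + 1 plays the part of the missing upper bound.
                  , s≤s⁻¹ (≤-trans (rank<n v) (≤-trans (m≤m+n n k) (≤-reflexive (trans order (+-comm (5 * t) 1)))))
        at (suc (suc (suc (suc (suc _))))) _ (s≤s (s≤s (s≤s (s≤s ()))))

      labeling : TotalLabeling G (suc t)
      labeling = record
        -- The truncated subtraction is exact by the lower half of `window`.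
        { label   = [ (λ v → suc (rank v ∸ deg H v * t)) , (λ e → suc (χ (H e) * t)) ]′
        ; 1≤label = λ { (inj₁ _) → s≤s z≤n ; (inj₂ _) → s≤s z≤n }
        ; label≤k = λ { (inj₁ v) → s≤s (≤-trans (∸-monoˡ-≤ (deg H v * t) (proj₂ (window v))) (≤-reflexive (m+n∸n≡m t (deg H v * t))))
                      ; (inj₂ e) → s≤s (χ*≤ (H e)) } }
        where
        χ*≤ : ∀ b → χ b * t ≤ t
        χ*≤ true  = ≤-reflexive (+-identityʳ t)
        χ*≤ false = z≤n

      open TotalLabeling labeling using (weight)

      weight≡ : ∀ v → weight v ≡ 5 + rank v
      weight≡ v = begin
        weight v ≡⟨ cong (λ z → suc (rank v ∸ d * t) + z) (incident-sum v (λ e → suc (χ (H e) * t))) ⟩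
        suc (rank v ∸ d * t) + ∑[ e < size ] (inc e v * suc (χ (H e) * t))
          ≡⟨ cong (λ z → suc (rank v ∸ d * t) + z) edge-labels ⟩
        suc (rank v ∸ d * t) + (4 + d * t) ≡⟨ lemma (rank v ∸ d * t) (d * t) ⟩
        5 + (rank v ∸ d * t + d * t) ≡⟨ cong (λ z → 5 + z) (m∸n+n≡m (proj₁ (window v))) ⟩
        5 + rank v ∎
        where
        open ≡-Reasoning
        open ℕ-Solver
        open Simple4 simple4 using (inc)
        d : ℕ
        d = deg H v
        lemma : ∀ x y → suc x + (4 + y) ≡ 5 + (x + y)
        lemma = solve 2 (λ x y → con 1 :+ x :+ (con 4 :+ y) := con 5 :+ (x :+ y)) refl
        expand : ∀ i c t → i * suc (c * t) ≡ i + i * c * t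
        expand = solve 3 (λ i c t → i :* (con 1 :+ c :* t) := i :+ i :* c :* t) refl
        edge-labels : ∑[ e < size ] (inc e v * suc (χ (H e) * t)) ≡ 4 + d * t
        edge-labels = begin
          ∑[ e < size ] (inc e v * suc (χ (H e) * t)) ≡⟨ sum-cong-≗ (λ e → expand (inc e v) (χ (H e)) t) ⟩
          ∑[ e < size ] (inc e v + inc e v * χ (H e) * t) ≡⟨ ∑-distrib-+ (λ e → inc e v) (λ e → inc e v * χ (H e) * t) ⟩
          ∑[ e < size ] inc e v + ∑[ e < size ] (inc e v * χ (H e) * t)
            ≡⟨ cong₂ _+_ (Simple4.regular simple4 v) (sym (*-distribʳ-sum t (λ e → inc e v * χ (H e)))) ⟩
          4 + d * t ∎

      irregular : VertexIrregular labeling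
      irregular u v u≢v eq = u≢v (rank-injective (+-cancelˡ-≡ 5 (rank u) (rank v)
        (trans (sym (weight≡ u)) (trans eq (weight≡ v)))))

      exact-weights : ∀ w → (∃[ v ] weight v ≡ w) ⇔ (5 ≤ w × w ≤ n + 4)
      exact-weights w = mk⇔
        (λ { (v , refl) → subst (λ z → 5 ≤ z × z ≤ n + 4) (sym (weight≡ v))
               (m≤m+n 5 (rank v) , ≤-trans (+-monoʳ-≤ 4 (rank<n v)) (≤-reflexive (+-comm 4 n))) })
        (λ (5≤w , w≤n+4) → attained 5≤w w≤n+4)
        where
        attained : 5 ≤ w → w ≤ n + 4 → ∃[ v ] weight v ≡ w
        attained 5≤w w≤n+4 = weigh (rank-surjective {w ∸ 5} (+-cancelˡ-≤ 5 _ _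
            (≤-trans (≤-reflexive (trans (+-suc 5 (w ∸ 5)) (cong suc (m+[n∸m]≡n 5≤w)))) (s≤s (≤-trans w≤n+4 (≤-reflexive (+-comm n 4)))))))
          where
          weigh : (∃ λ v → rank v ≡ w ∸ 5) → ∃[ v ] weight v ≡ w
          weigh (v , eq) = v , trans (weight≡ v) (trans (cong (λ z → 5 + z) eq) (m+[n∸m]≡n 5≤w))

  Exact : ℕ → Set
  Exact s = Σ[ L ∈ TotalLabeling G s ]
    (VertexIrregular L × (∀ w → (∃[ v ] TotalLabeling.weight L v ≡ w) ⇔ (5 ≤ w × w ≤ n + 4)))

  exact-nonempty : ∀ k t → n + k ≡ 5 * t + 1 → k ≤ 4 → 5 ≤ n → Exact (suc t)
  exact-nonempty k t order k≤4 5≤n = conclude balanced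
    where
    open Underlying G regular using (simple4)
    k+4≤5t : k + 4 ≤ 5 * t
    k+4≤5t = +-cancelʳ-≤ 1 _ _ (≤-trans (≤-reflexive (trans (+-assoc k 4 1) (+-comm k 5))) (≤-trans (+-monoˡ-≤ k 5≤n) (≤-reflexive order)))
    1≤t : 1 ≤ t
    1≤t = ≮⇒≥ λ t<1 → <⇒≱ (s≤s (z≤n {3})) (subst (4 ≤_) (cong (λ z → 5 * z) (n<1⇒n≡0 t<1)) (≤-trans (m≤n+m 4 k) k+4≤5t))
    open Search simple4 ((4 * t) ⊓ n) k t order 1≤t k≤4 k+4≤5t (m⊓n≤m (4 * t) n) (m⊓n≤n (4 * t) n)
    conclude : ∃ Balanced → Exact (suc t)
    conclude (H , w₀ , w₁ , w₂ , w₃) = labeling , irregular , exact-weights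
      where open FromEdgeSet.Labels k t order H w₀ w₁ w₂ w₃

-- There are no weights, and no numbers between 5 and 4.
exact-empty : ∀ (G : Graph 0) (regular : Regular 4 G) {s} → 1 ≤ s → Exact G regular s
exact-empty G regular 1≤s = record { label = λ _ → 1 ; 1≤label = λ _ → ≤-refl ; label≤k = λ _ → 1≤s }
  , (λ ()) , λ w → mk⇔ (λ { (() , _) }) (λ (5≤w , w≤4) → contradiction (≤-trans 5≤w w≤4) (<⇒≱ ≤-refl))

exact : ∀ {n} (G : Graph n) (regular : Regular 4 G) {r s} → r ≤ 4 → n + 4 + r ≡ 5 * s → Exact G regular s
exact {n} G regular {r} {zero} r≤4 eq = contradiction (≤-trans (m≤n+m 4 n) (≤-trans (m≤m+n (n + 4) r) (≤-reflexive eq))) λ ()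
exact {zero}  G regular {r} {suc t} r≤4 eq = exact-empty G regular (s≤s z≤n)
exact {suc n} G regular {r} {suc t} r≤4 eq = exact-nonempty G regular r t order r≤4 (Graphs.five-vertices (Underlying.simple4 G regular) zero)
  where
  open ℕ-Solver
  order : suc n + r ≡ 5 * t + 1
  order = +-cancelʳ-≡ 4 _ _ (trans (solve 2 (λ n r → n :+ r :+ con 4 := n :+ con 4 :+ r) refl (suc n) r)
    (trans eq (solve 1 (λ t → con 5 :* (con 1 :+ t) := con 5 :* t :+ con 1 :+ con 4) refl t)))

theorem1p3 : (n : ℕ) (G : Graph n) → Regular 4 G →
    (s : ℕ) → + s ≡ ceiling ((+ (n + 4)) / 5) →
    TVS G s
    × (Σ[ L ∈ TotalLabeling G s ]
    (VertexIrregular L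
    × (∀ w → (∃[ v ] TotalLabeling.weight L v ≡ w) ⇔ (5 ≤ w × w ≤ n + 4))))
theorem1p3 n G regular s eq = conclude (ceiling-bound (n + 4) s eq)
  where
  conclude : (∃ λ r → r ≤ 4 × n + 4 + r ≡ 5 * s) → TVS G s × Exact G regular s
  conclude (r , r≤4 , total) = (1≤s , (proj₁ L , proj₁ (proj₂ L)) , least) , L
    where
    L : Exact G regular s
    L = exact G regular r≤4 total
    1≤s : 1 ≤ s
    1≤s = ≮⇒≥ λ s<1 → contradiction (≤-trans (m≤n+m 4 n) (≤-trans (m≤m+n (n + 4) r)
      (≤-trans (≤-reflexive total) (≤-reflexive (cong (λ z → 5 * z) (n<1⇒n≡0 s<1)))))) λ ()
    least : ∀ j → 1 ≤ j → HasVertexIrregularLabeling G j → s ≤ j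
    -- The defect `r ≤ 4` is too small to reach the next multiple of 5.
    least j 1≤j labelled = s≤s⁻¹ (*-cancelˡ-< 5 s (suc j) (begin-strict
      5 * s       ≡⟨ total ⟨
      n + 4 + r   ≤⟨ +-mono-≤ (order-bound G regular 1≤j labelled) r≤4 ⟩
      5 * j + 4   <⟨ +-monoʳ-< (5 * j) ≤-refl ⟩
      5 * j + 5   ≡⟨ trans (+-comm (5 * j) 5) (sym (*-suc 5 j)) ⟩
      5 * suc j   ∎))
      where open ≤-Reasoning
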